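{- The Firefighting problem is fixed-parameter tractable when parameterized by the distance from the class of disjoint unions of stars. That is, there are a computable function $f:\mathbb{N}\to\mathbb{N}$ and an algorithm that, given a graph $G$, a vertex $s\in V(G)$, and a set $X\subseteq V(G)$ with $|X|=k$ such that $G\setminus X$ is a disjoint union of stars, finds a strategy maximizing the number of saved vertices when the fire starts at $s$, in time $f(k)\cdot |V(G)|^{O(1)}$.
   Context: All graphs are undirected, connected (for input graphs $G$), finite and simple. $G\setminus X$ denotes the graph obtained from $G$ by deleting the vertices of $X$. Firefighting process on $(G,s)$: at time $0$ a fire starts at $s$. At each subsequent time step $i=1,2,\ldots$, the firefighter permanently defends one vertex that is not burning, and then the fire spreads from every burning vertex to all its undefended neighbors. The process stops when the fire can no longer spread. A vertex is saved if it is not burned at the end (defended vertices count as saved). A strategy is a sequence $S=(v_1,\ldots,v_t)$, where $v_i$ is the vertex defended at time step $i$; it is valid if $v_i$ is not burning at the start of time step $i$ for every $i$ and the process stops at time step $t$. The Firefighting problem asks for a valid strategy saving the maximum number of vertices. The modulator $X$ is given as part of the input. -}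

module Defs where

open import Data.Bool.Base using (Bool; true; false)
open import Data.Fin.Base using (Fin; toℕ)
open import Data.Fin.Subset using (Subset; _∈_; _∉_; _⊆_; _∪_; _─_; ∁; ⋃; ⁅_⁆; ∣_∣; ⊥)
open import Data.Fin.Subset.Properties using (_∈?_)
open import Data.List.Base as List using (List; []; _∷_; allFin; filter)
open import Data.Nat.Base using (ℕ; zero; suc; _+_; _≤_)
open import Data.Product.Base using (_×_; ∃-syntax)
open import Data.Sum.Base using (_⊎_)
open import Data.Vec.Base as Vec using (Vec; lookup; replicate; tabulate; _[_]≔_)
open import Function.Bundles using (_⇔_)
open import Relation.Binary.Construct.Closure.ReflexiveTransitive
  using () renaming (Star to ReflTransClosure)
open import Relation.Binary.PropositionalEquality.Core using (_≡_; _≢_)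
open import Relation.Nullary.Negation.Core using (¬_)

------------------------------------------------------------------------
-- Graphs

record Graph (n : ℕ) : Set where
  field
    neighbours  : Fin n → Subset n
    symmetric   : ∀ {u v} → v ∈ neighbours u → u ∈ neighbours v
    irreflexive : ∀ v → v ∉ neighbours v

  Adjacent : Fin n → Fin n → Set
  Adjacent u v = v ∈ neighbours u

open Graph public

Connected : ∀ {n} → Graph n → Set
Connected G = ∀ u v → ReflTransClosure (Adjacent G) u v

-- The edge relation of G ∖ X.
AdjacentOutside : ∀ {n} → Graph n → Subset n → Fin n → Fin n → Set
AdjacentOutside G X u v = u ∉ X × v ∉ X × Adjacent G u v

-- The connected component of v in G ∖ X (meaningful for v ∉ X).
ComponentOutside : ∀ {n} → Graph n → Subset n → Fin n → (Fin n → Set)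
ComponentOutside G X v u = ReflTransClosure (AdjacentOutside G X) v u

-- The subgraph of G induced by W is some K₁,ᵣ with r ≥ 0; in particular a
-- single vertex is a star.
InducesStar : ∀ {n} → Graph n → (Fin n → Set) → Set
InducesStar G W =
  ∃[ c ] W c × (∀ {u v} → W u → W v →
                Adjacent G u v ⇔ (u ≢ v × (u ≡ c ⊎ v ≡ c)))

-- G ∖ X is a disjoint union of stars: all its components are stars.
StarsOutside : ∀ {n} → Graph n → Subset n → Set
StarsOutside G X = ∀ v → v ∉ X → InducesStar G (ComponentOutside G X v)

------------------------------------------------------------------------
-- Firefighting.  B is the set of burning vertices and D the set of
-- defended ones.

neighbourhood : ∀ {n} → Graph n → Subset n → Subset n
neighbourhood {n} G B = ⋃ (List.map (neighbours G) (filter (_∈? B) (allFin n)))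

spread : ∀ {n} → Graph n → (B D : Subset n) → Subset n
spread G B D = B ∪ (neighbourhood G B ─ D)

Stopped : ∀ {n} → Graph n → (B D : Subset n) → Set
Stopped G B D = spread G B D ⊆ B

-- Validity requires the process to stop exactly when the sequence ends,
-- and not earlier.
ValidFrom : ∀ {n} → Graph n → (B D : Subset n) → List (Fin n) → Set
ValidFrom G B D []      = Stopped G B D
ValidFrom G B D (v ∷ S) =
  ¬ Stopped G B D × v ∉ B ×
  ValidFrom G (spread G B (D ∪ ⁅ v ⁆)) (D ∪ ⁅ v ⁆) S

burnedFrom : ∀ {n} → Graph n → (B D : Subset n) → List (Fin n) → Subset n
burnedFrom G B D []      = B
burnedFrom G B D (v ∷ S) = burnedFrom G (spread G B (D ∪ ⁅ v ⁆)) (D ∪ ⁅ v ⁆) S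

Valid : ∀ {n} → Graph n → Fin n → List (Fin n) → Set
Valid G s S = ValidFrom G ⁅ s ⁆ ⊥ S

saved : ∀ {n} → Graph n → Fin n → List (Fin n) → ℕ
saved G s S = ∣ ∁ (burnedFrom G ⁅ s ⁆ ⊥ S) ∣

Optimal : ∀ {n} → Graph n → Fin n → List (Fin n) → Set
Optimal G s S = Valid G s S × (∀ S′ → Valid G s S′ → saved G s S′ ≤ saved G s S)

------------------------------------------------------------------------
-- Model of computation: Jones' WHILE language over binary trees, with its
-- standard cost measure (one unit per operation).  Trees are understood to
-- be shared through pointers, so cons, hd and tl take constant time; there
-- is deliberately no unit-cost equality test on trees.  Running times agree
-- with those of Turing machines up to a polynomial.

data Tree : Set where
  nil  : Tree
  cons : Tree → Tree → Tree

head : Tree → Tree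
head nil        = nil
head (cons a _) = a

tail : Tree → Tree
tail nil        = nil
tail (cons _ b) = b

-- m is the number of program variables.
data Expr (m : ℕ) : Set where
  var   : Fin m → Expr m
  nil   : Expr m
  cons  : Expr m → Expr m → Expr m
  hd tl : Expr m → Expr m

infix  6 _:=_
infixr 5 _⨾_

data Cmd (m : ℕ) : Set where
  _:=_          : Fin m → Expr m → Cmd m
  _⨾_           : Cmd m → Cmd m → Cmd m
  if_then_else_ : Expr m → Cmd m → Cmd m → Cmd m
  while_loop_   : Expr m → Cmd m → Cmd m

Store : ℕ → Set
Store m = Vec Tree m

eval : ∀ {m} → Expr m → Store m → Tree
eval (var x)    σ = lookup σ x
eval nil        σ = nil
eval (cons e d) σ = cons (eval e σ) (eval d σ)
eval (hd e)     σ = head (eval e σ)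
eval (tl e)     σ = tail (eval e σ)

cost : ∀ {m} → Expr m → ℕ
cost (var x)    = 1
cost nil        = 1
cost (cons e d) = 1 + cost e + cost d
cost (hd e)     = 1 + cost e
cost (tl e)     = 1 + cost e

-- nil is false; every other tree is true.
data IsCons : Tree → Set where
  isCons : ∀ {a b} → IsCons (cons a b)

-- ⟨ C , σ ⟩⇓ τ [ t ]: started in store σ, C terminates in store τ after
-- time t.
infix 4 ⟨_,_⟩⇓_[_]

data ⟨_,_⟩⇓_[_] {m : ℕ} : Cmd m → Store m → Store m → ℕ → Set where
  assign : ∀ {x e σ} →
           ⟨ x := e , σ ⟩⇓ (σ [ x ]≔ eval e σ) [ 1 + cost e ]
  seq    : ∀ {C C′ σ ρ τ t t′} →
           ⟨ C , σ ⟩⇓ ρ [ t ] → ⟨ C′ , ρ ⟩⇓ τ [ t′ ] →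
           ⟨ C ⨾ C′ , σ ⟩⇓ τ [ 1 + t + t′ ]
  ifTrue : ∀ {e C C′ σ τ t} → IsCons (eval e σ) →
           ⟨ C , σ ⟩⇓ τ [ t ] →
           ⟨ if e then C else C′ , σ ⟩⇓ τ [ 1 + cost e + t ]
  ifFalse : ∀ {e C C′ σ τ t} → eval e σ ≡ nil →
           ⟨ C′ , σ ⟩⇓ τ [ t ] →
           ⟨ if e then C else C′ , σ ⟩⇓ τ [ 1 + cost e + t ]
  whileTrue : ∀ {e C σ ρ τ t t′} → IsCons (eval e σ) →
           ⟨ C , σ ⟩⇓ ρ [ t ] → ⟨ while e loop C , ρ ⟩⇓ τ [ t′ ] →
           ⟨ while e loop C , σ ⟩⇓ τ [ 1 + cost e + t + t′ ]
  whileFalse : ∀ {e C σ} → eval e σ ≡ nil →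
           ⟨ while e loop C , σ ⟩⇓ σ [ 1 + cost e ]

record Program : Set where
  field
    {width} : ℕ
    input   : Fin width
    body    : Cmd width
    output  : Fin width

-- All variables other than the input variable are initially nil.
infix 4 _on_outputs_inTime_

_on_outputs_inTime_ : Program → Tree → Tree → ℕ → Set
P on a outputs b inTime t =
  ∃[ τ ] (⟨ body , replicate width nil [ input ]≔ a ⟩⇓ τ [ t ] × lookup τ output ≡ b)
  where open Program P

------------------------------------------------------------------------
-- Encodings.  Numbers, and hence vertices, are written in unary, so an
-- instance on n vertices has size polynomial in n.

encodeℕ : ℕ → Tree
encodeℕ zero    = nil
encodeℕ (suc n) = cons nil (encodeℕ n)

encodeBool : Bool → Tree
encodeBool false = nil
encodeBool true  = cons nil nil

encodeList : ∀ {A : Set} → (A → Tree) → List A → Tree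
encodeList f []       = nil
encodeList f (x ∷ xs) = cons (f x) (encodeList f xs)

encodeVertex : ∀ {n} → Fin n → Tree
encodeVertex v = encodeℕ (toℕ v)

encodeSubset : ∀ {n} → Subset n → Tree
encodeSubset p = encodeList encodeBool (Vec.toList p)

-- The adjacency matrix, row by row.
encodeGraph : ∀ {n} → Graph n → Tree
encodeGraph G = encodeList encodeSubset (Vec.toList (tabulate (neighbours G)))

encodeInstance : ∀ {n} → Graph n → Fin n → Subset n → Tree
encodeInstance G s X = cons (encodeGraph G) (cons (encodeVertex s) (encodeSubset X))

encodeStrategy : ∀ {n} → List (Fin n) → Tree
encodeStrategy S = encodeList encodeVertex S

Computable : (ℕ → ℕ) → Set
Computable f = ∃[ P ] ∀ k → ∃[ t ] (P on encodeℕ k outputs encodeℕ (f k) inTime t)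

{-# OPTIONS --safe #-}
module Submission where

-- A strategy is certified by a labelling in which every vertex burns at some
-- time, is defended at some time, or is spared.  It suffices that defence
-- times are distinct, that s burns at time 0, and that every neighbour of a
-- vertex burning at time i burns or is defended at a time ≤ i + 1: defending
-- along such labels confines the fire to the vertices labelled as burning,
-- and conversely every valid strategy yields such labels.  Of four vertices
-- catching fire one after the other one lies in X, so times up to 4k + 4 are
-- enough.
--
-- An optimal labelling is found by dynamic programming, labelling X first and
-- then one star after the other, and keeping one best partial labelling among
-- those that no unlabelled vertex can tell apart.  As at most one labelled
-- vertex outside X ∪ {s} has an unlabelled neighbour outside X, what matters
-- of a partial labelling are its values on X and at that vertex and the set
-- of labels in use, so the table has at most f(k) (n + 1) entries.

open import Defs
open import Data.Bool.Base using (Bool; true; false)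
import Data.Bool.Properties as Bool
open import Data.Empty using (⊥; ⊥-elim)
open import Data.Fin.Base using (Fin; zero; suc; toℕ; fromℕ<)
import Data.Fin.Properties as Fin
open import Data.Fin.Subset as Subset using (Subset; ∣_∣; _∪_; _─_; ⁅_⁆; ∁; ⋃; inside; outside)
import Data.Fin.Subset.Properties as Subset
open import Data.List.Base using (List; []; _∷_; _++_; foldl; length; replicate; reverse; map; filter; cartesianProduct; cartesianProductWith; upTo; downFrom; allFin)
open import Data.List.Membership.DecPropositional using () renaming (_∈?_ to member?)
open import Data.List.Membership.Propositional using (_∈_; _∉_; lose; find)
open import Data.List.Membership.Propositional.Properties using (∈-map⁺; ∈-map⁻; ∈-filter⁺; ∈-filter⁻; ∈-cartesianProduct⁺; ∈-upTo⁺; ∈-downFrom⁺; ∈-downFrom⁻; ∈-allFin; ∈-∃++; ∈-++⁺ˡ; ∈-++⁺ʳ; ∈-++⁻)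
open import Data.List.Properties using (length-map; length-++; length-upTo; length-downFrom; length-replicate; length-reverse; ∷-injective; unfold-reverse; ++-assoc; ++-identityʳ)
open import Data.List.Relation.Unary.All as All using (All; []; _∷_)
import Data.List.Relation.Unary.All.Properties as All
open import Data.List.Relation.Unary.AllPairs using (AllPairs; []; _∷_)
import Data.List.Relation.Unary.AllPairs.Properties as AllPairs
open import Data.List.Relation.Unary.Any as Any using (Any; here; there)
open import Data.List.Relation.Unary.Unique.Propositional using (Unique)
import Data.List.Relation.Unary.Unique.Propositional.Properties as Unique
open import Data.Nat.Base using (ℕ; zero; suc; pred; _+_; _*_; _∸_; _^_; _≤_; _<_; z≤n; s≤s; _⊔_; NonZero)
open import Data.Nat.Properties
open import Data.Nat.Tactic.RingSolver using (solve-∀)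
open import Data.Product.Base using (Σ-syntax; ∃-syntax; _×_; _,_; proj₁; proj₂)
open import Data.Product.Properties using (≡-dec)
open import Data.Sum.Base using (_⊎_; inj₁; inj₂; [_,_]′)
open import Data.Unit.Base using (⊤; tt)
open import Data.Vec.Base as Vec using (Vec; []; _∷_; _[_]≔_)
import Data.Vec.Properties as Vec
open import Function.Base using (_∘_; id)
open import Function.Bundles using (module Equivalence)
open import Relation.Binary.Construct.Closure.ReflexiveTransitive using (ε; _◅_)
open import Relation.Binary.PropositionalEquality
open import Relation.Nullary.Decidable using (Dec; yes; no; does; ¬?; _×-dec_)
open import Relation.Nullary.Negation.Core using (¬_)
open import Relation.Nullary.Reflects

-- A typed language of folds and its compilation to WHILE

-- Time is never read off execution traces. The algorithm is a term of a language of folds. If no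
-- list folded over is longer than M, its compiled cost is polynomial in M, with coefficient and
-- degree fixed by the term. For M = 2 ^ `codeBound` k * (n + 1) this has the form f(k) n^c, so the
-- remaining task is to bound every list by M. The program computes neither the one labelled vertex
-- that still matters nor any code of a labelling. It asks directly whether two partial labellings
-- accept the same labels at all unlabelled vertices, and the codes serve only to count the
-- resulting classes. An improvement is added without deleting what it improves on, so a class may
-- hold one entry for every score; hence the factor n + 1. The source s needs separate treatment: it
-- may be a vertex of a star and keep unlabelled neighbours for a long time. It is labelled before
-- everything else, and identically in all entries, so it adds nothing to what must be remembered.
-- The bound 4k + 4 keeps the number of labels, and with it the length of a code, a function of k.

infixr 6 _⊗_

data Ty : Set where
  𝔹 N : Ty
  L   : Ty → Ty
  _⊗_ : Ty → Ty → Ty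

Val : Ty → Set
Val 𝔹       = Bool
Val N       = ℕ
Val (L A)   = List (Val A)
Val (A ⊗ C) = Val A × Val C

encode : ∀ A → Val A → Tree
encode 𝔹       b       = encodeBool b
encode N       m       = encodeℕ m
encode (L A)   xs      = encodeList (encode A) xs
encode (A ⊗ C) (x , y) = cons (encode A x) (encode C y)

Ctx : Set
Ctx = List Ty

Env : Ctx → Set
Env = All Val

encodeEnv : ∀ {Γ} → Env Γ → Tree
encodeEnv []            = nil
encodeEnv (_∷_ {A} x ρ) = cons (encode A x) (encodeEnv ρ)

data Op₀ : Ty → Set where
  ff tt : Op₀ 𝔹
  zero  : Op₀ N
  []    : ∀ {A} → Op₀ (L A)

data Op₁ : Ty → Ty → Set where
  suc prd  : Op₁ N N
  -- The tree of a unary number is that of a list of falses.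
  units    : Op₁ N (L 𝔹)
  fst      : ∀ {A C} → Op₁ (A ⊗ C) A
  snd      : ∀ {A C} → Op₁ (A ⊗ C) C

data Op₂ : Ty → Ty → Ty → Set where
  cons : ∀ {A} → Op₂ A (L A) (L A)
  pair : ∀ {A C} → Op₂ A C (A ⊗ C)

-- Iteration comes from `fold` alone, so every term terminates and its cost is bounded by structural
-- recursion. `call` evaluates a term in the environment of its arguments only, so that it is
-- specified once and used in any context.
data Tm (Γ : Ctx) : Ty → Set
data Tms (Γ : Ctx) : Ctx → Set

data Tm Γ where
  var    : ∀ {A} → A ∈ Γ → Tm Γ A
  op₀    : ∀ {A} → Op₀ A → Tm Γ A
  op₁    : ∀ {A C} → Op₁ A C → Tm Γ A → Tm Γ C
  op₂    : ∀ {A C D} → Op₂ A C D → Tm Γ A → Tm Γ C → Tm Γ D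
  cond   : ∀ {A} → Tm Γ 𝔹 → Tm Γ A → Tm Γ A → Tm Γ A
  caseL  : ∀ {A C} → Tm Γ (L A) → Tm Γ C → Tm (A ∷ L A ∷ Γ) C → Tm Γ C
  letIn  : ∀ {A C} → Tm Γ A → Tm (A ∷ Γ) C → Tm Γ C
  fold   : ∀ {A C} → Tm Γ (L A) → Tm Γ C → Tm (A ∷ C ∷ Γ) C → Tm Γ C
  call   : ∀ {Δ A} → Tm Δ A → Tms Γ Δ → Tm Γ A

data Tms Γ where
  []  : Tms Γ []
  _∷_ : ∀ {A Δ} → Tm Γ A → Tms Γ Δ → Tms Γ (A ∷ Δ)

⟦_⟧₀ : ∀ {A} → Op₀ A → Val A
⟦ ff ⟧₀   = false
⟦ tt ⟧₀   = true
⟦ zero ⟧₀ = zero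
⟦ [] ⟧₀   = []

⟦_⟧₁ : ∀ {A C} → Op₁ A C → Val A → Val C
⟦ suc ⟧₁   m = suc m
⟦ prd ⟧₁   m = pred m
⟦ units ⟧₁ m = replicate m false
⟦ fst ⟧₁   x = proj₁ x
⟦ snd ⟧₁   x = proj₂ x

⟦_⟧₂ : ∀ {A C D} → Op₂ A C D → Val A → Val C → Val D
⟦ cons ⟧₂ x xs = x ∷ xs
⟦ pair ⟧₂ x y  = x , y

ite : ∀ {a} {A : Set a} → Bool → A → A → A
ite true  x y = x
ite false x y = y

caseList : ∀ {a b} {A : Set a} {C : Set b} → List A → C → (A → List A → C) → C
caseList []       c f = c
caseList (x ∷ xs) c f = f x xs

⟦_⟧  : ∀ {Γ A} → Tm Γ A → Env Γ → Val A
⟦_⟧ˢ : ∀ {Γ Δ} → Tms Γ Δ → Env Γ → Env Δ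

⟦ var i ⟧       ρ = All.lookup ρ i
⟦ op₀ o ⟧       ρ = ⟦ o ⟧₀
⟦ op₁ o t ⟧     ρ = ⟦ o ⟧₁ (⟦ t ⟧ ρ)
⟦ op₂ o t u ⟧   ρ = ⟦ o ⟧₂ (⟦ t ⟧ ρ) (⟦ u ⟧ ρ)
⟦ cond b t u ⟧  ρ = ite (⟦ b ⟧ ρ) (⟦ t ⟧ ρ) (⟦ u ⟧ ρ)
⟦ caseL l t u ⟧ ρ = caseList (⟦ l ⟧ ρ) (⟦ t ⟧ ρ) (λ x xs → ⟦ u ⟧ (x ∷ xs ∷ ρ))
⟦ letIn t u ⟧   ρ = ⟦ u ⟧ (⟦ t ⟧ ρ ∷ ρ)
⟦ fold l t u ⟧  ρ = foldl (λ acc x → ⟦ u ⟧ (x ∷ acc ∷ ρ)) (⟦ t ⟧ ρ) (⟦ l ⟧ ρ)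
⟦ call f ts ⟧   ρ = ⟦ f ⟧ (⟦ ts ⟧ˢ ρ)

⟦ [] ⟧ˢ     ρ = []
⟦ t ∷ ts ⟧ˢ ρ = ⟦ t ⟧ ρ ∷ ⟦ ts ⟧ˢ ρ

-- Compilation to WHILE: 𝕖 holds the environment, 𝕣 receives the result
-- and 𝕤 is a stack of saved values.

pattern 𝕖 = zero
pattern 𝕣 = suc zero
pattern 𝕤 = suc (suc zero)

opExpr : ∀ {A C} → Op₁ A C → Expr 3
opExpr suc   = cons nil (var 𝕣)
opExpr prd   = tl (var 𝕣)
opExpr units = var 𝕣
opExpr fst   = hd (var 𝕣)
opExpr snd   = tl (var 𝕣)

litExpr : ∀ {A} → Op₀ A → Expr 3
litExpr ff   = nil
litExpr tt   = cons nil nil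
litExpr zero = nil
litExpr []   = nil

varExpr : ∀ {Γ : Ctx} {A} → A ∈ Γ → Expr 3 → Expr 3
varExpr (here _)  e = hd e
varExpr (there i) e = varExpr i (tl e)

-- Compiled code restores `𝕖` and `𝕤`; results that must survive another evaluation are pushed on
-- `𝕤`. During a `fold` the top of `𝕤` is the rest of the list and `𝕣` is the accumulator.
compile  : ∀ {Γ A} → Tm Γ A → Cmd 3
compileˢ : ∀ {Γ Δ} → Tms Γ Δ → Cmd 3

loopBody : Cmd 3 → Cmd 3
loopBody c =
  𝕖 := cons (hd (hd (var 𝕤))) (cons (var 𝕣) (var 𝕖)) ⨾
  𝕤 := cons (tl (hd (var 𝕤))) (tl (var 𝕤)) ⨾
  c ⨾
  𝕖 := tl (tl (var 𝕖))

compile (var i)       = 𝕣 := varExpr i (var 𝕖)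
compile (op₀ o)       = 𝕣 := litExpr o
compile (op₁ o t)     = compile t ⨾ 𝕣 := opExpr o
compile (op₂ o t u)   =
  compile t ⨾ 𝕤 := cons (var 𝕣) (var 𝕤) ⨾ compile u ⨾
  𝕣 := cons (hd (var 𝕤)) (var 𝕣) ⨾ 𝕤 := tl (var 𝕤)
compile (cond b t u)  = compile b ⨾ if var 𝕣 then compile t else compile u
compile (caseL l t u) =
  compile l ⨾
  if var 𝕣 then
    (𝕖 := cons (hd (var 𝕣)) (cons (tl (var 𝕣)) (var 𝕖)) ⨾ compile u ⨾ 𝕖 := tl (tl (var 𝕖)))
  else compile t
compile (letIn t u)   =
  compile t ⨾ 𝕖 := cons (var 𝕣) (var 𝕖) ⨾ compile u ⨾ 𝕖 := tl (var 𝕖)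
compile (fold l t u)  =
  compile l ⨾ 𝕤 := cons (var 𝕣) (var 𝕤) ⨾ compile t ⨾
  (while hd (var 𝕤) loop loopBody (compile u)) ⨾ 𝕤 := tl (var 𝕤)
compile (call f ts)   =
  compileˢ ts ⨾ 𝕤 := cons (var 𝕖) (var 𝕤) ⨾ 𝕖 := var 𝕣 ⨾ compile f ⨾
  𝕖 := hd (var 𝕤) ⨾ 𝕤 := tl (var 𝕤)

compileˢ []       = 𝕣 := nil
compileˢ (t ∷ ts) =
  compile t ⨾ 𝕤 := cons (var 𝕣) (var 𝕤) ⨾ compileˢ ts ⨾
  𝕣 := cons (hd (var 𝕤)) (var 𝕣) ⨾ 𝕤 := tl (var 𝕤)

-- The predicate sees each element with the accumulator reached there, since the safety of an
-- iteration depends on both.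
Along : ∀ {A C : Set} → (A → C → Set) → (C → A → C) → C → List A → Set
Along P f acc []       = ⊤
Along P f acc (x ∷ xs) = P x acc × Along P f (f acc x) xs

-- Only the lengths of the lists folded over are restricted: together with
-- the nesting depth of the folds they bound the running time.
Safe  : ∀ {Γ A} → ℕ → Tm Γ A → Env Γ → Set
Safeˢ : ∀ {Γ Δ} → ℕ → Tms Γ Δ → Env Γ → Set

Safe M (var i)       ρ = ⊤
Safe M (op₀ o)       ρ = ⊤
Safe M (op₁ o t)     ρ = Safe M t ρ
Safe M (op₂ o t u)   ρ = Safe M t ρ × Safe M u ρ
Safe M (cond b t u)  ρ = Safe M b ρ × ite (⟦ b ⟧ ρ) (Safe M t ρ) (Safe M u ρ)
Safe M (caseL l t u) ρ =
  Safe M l ρ × caseList (⟦ l ⟧ ρ) (Safe M t ρ) (λ x xs → Safe M u (x ∷ xs ∷ ρ))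
Safe M (letIn t u)   ρ = Safe M t ρ × Safe M u (⟦ t ⟧ ρ ∷ ρ)
Safe M (fold l t u)  ρ =
  Safe M l ρ × Safe M t ρ × length (⟦ l ⟧ ρ) ≤ M ×
  Along (λ x acc → Safe M u (x ∷ acc ∷ ρ)) (λ acc x → ⟦ u ⟧ (x ∷ acc ∷ ρ))
        (⟦ t ⟧ ρ) (⟦ l ⟧ ρ)
Safe M (call f ts)   ρ = Safeˢ M ts ρ × Safe M f (⟦ ts ⟧ˢ ρ)

Safeˢ M []       ρ = ⊤
Safeˢ M (t ∷ ts) ρ = Safe M t ρ × Safeˢ M ts ρ

varCost : ∀ {Γ : Ctx} {A} → A ∈ Γ → ℕ
varCost (here _)  = 2
varCost (there i) = suc (varCost i)

-- The constants are the costs of the assignments, tests and sequencings that `compile` places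
-- around the subterms. Alternative branches are added rather than compared.
work  : ∀ {Γ A} → ℕ → Tm Γ A → ℕ
workˢ : ∀ {Γ Δ} → ℕ → Tms Γ Δ → ℕ
work M (var i)       = suc (varCost i)
work M (op₀ o)       = 4
work M (op₁ o t)     = 5 + work M t
work M (op₂ o t u)   = 16 + (work M t + work M u)
work M (cond b t u)  = 3 + (work M b + (work M t + work M u))
work M (caseL l t u) = 17 + (work M l + (work M t + work M u))
work M (letIn t u)   = 10 + (work M t + work M u)
work M (fold l t u)  = 14 + (work M l + work M t) + M * (25 + work M u)
work M (call f ts)   = 17 + (workˢ M ts + work M f)

workˢ M []       = 2
workˢ M (t ∷ ts) = 16 + (work M t + workˢ M ts)

-- Correctness and cost of compiled terms

enc-cons : ∀ {A C D} (o : Op₂ A C D) x y →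
           encode D (⟦ o ⟧₂ x y) ≡ cons (encode A x) (encode C y)
enc-cons cons x y = refl
enc-cons pair x y = refl

enc-lit : ∀ {A} (o : Op₀ A) σ → eval (litExpr o) σ ≡ encode A ⟦ o ⟧₀
enc-lit ff   σ = refl
enc-lit tt   σ = refl
enc-lit zero σ = refl
enc-lit []   σ = refl

cost-lit : ∀ {A} (o : Op₀ A) → cost (litExpr o) ≤ 3
cost-lit ff   = s≤s z≤n
cost-lit tt   = ≤-refl
cost-lit zero = s≤s z≤n
cost-lit []   = s≤s z≤n

enc-units : ∀ m → encodeℕ m ≡ encodeList encodeBool (replicate m false)
enc-units zero    = refl
enc-units (suc m) = cong (cons nil) (enc-units m)

enc-op : ∀ {A C} (o : Op₁ A C) x e s →
         eval (opExpr o) (e ∷ encode A x ∷ s ∷ []) ≡ encode C (⟦ o ⟧₁ x)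
enc-op suc   x       e s = refl
enc-op prd   zero    e s = refl
enc-op prd   (suc m) e s = refl
enc-op units m       e s = enc-units m
enc-op fst   x       e s = refl
enc-op snd   x       e s = refl

cost-op : ∀ {A C} (o : Op₁ A C) → cost (opExpr o) ≤ 3
cost-op suc   = ≤-refl
cost-op prd   = s≤s (s≤s z≤n)
cost-op units = s≤s z≤n
cost-op fst   = s≤s (s≤s z≤n)
cost-op snd   = s≤s (s≤s z≤n)

enc-var : ∀ {Γ A} (i : A ∈ Γ) (ρ : Env Γ) (e : Expr 3) σ → eval e σ ≡ encodeEnv ρ →
          eval (varExpr i e) σ ≡ encode A (All.lookup ρ i)
enc-var (here refl) (x ∷ ρ) e σ eq = cong head eq
enc-var (there i)   (x ∷ ρ) e σ eq = enc-var i ρ (tl e) σ (cong tail eq)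

cost-var : ∀ {Γ : Ctx} {A} (i : A ∈ Γ) (e : Expr 3) →
           cost (varExpr i e) + 1 ≡ varCost i + cost e
cost-var (here _)  e = cong suc (+-comm (cost e) 1)
cost-var (there i) e = trans (cost-var i (tl e)) (+-suc _ _)

-- The derivation does not mention M: termination is unconditional, and one execution carries a time
-- bound for each M that satisfies `S`.
record Runs (c : Cmd 3) (σ τ : Store 3) (S : ℕ → Set) (W : ℕ → ℕ) : Set where
  constructor runs
  field
    {time} : ℕ
    derive : ⟨ c , σ ⟩⇓ τ [ time ]
    bound  : ∀ M → S M → time ≤ W M

set : ∀ {x e σ τ S} → σ [ x ]≔ eval e σ ≡ τ → Runs (x := e) σ τ S (λ _ → 1 + cost e)
set refl = runs assign (λ _ _ → ≤-refl)

infixr 5 _then_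
_then_ : ∀ {c d σ ρ τ S S′ V W} → Runs c σ ρ S V → Runs d ρ τ S′ W →
         Runs (c ⨾ d) σ τ (λ M → S M × S′ M) (λ M → 1 + V M + W M)
runs p b then runs q b′ = runs (seq p q) (λ M (x , y) → s≤s (+-mono-≤ (b M x) (b′ M y)))

weaken : ∀ {c σ τ S S′ V W} → Runs c σ τ S V → (∀ M → S′ M → S M) →
         (∀ M → S′ M → V M ≤ W M) → Runs c σ τ S′ W
weaken (runs p b) f g = runs p (λ M x → ≤-trans (b M (f M x)) (g M x))

store : ∀ {Γ} → Env Γ → Tree → Tree → Store 3
store ρ r s = encodeEnv ρ ∷ r ∷ s ∷ []

recast : ∀ A {Γ} {ρ : Env Γ} {x y c σ s S W} → x ≡ y →
         Runs c σ (store ρ (encode A x) s) S W → Runs c σ (store ρ (encode A y) s) S W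
recast A refl run = run

branch₁ : ∀ {c d ρ a b s τ S W} → Runs c (ρ ∷ cons a b ∷ s ∷ []) τ S W →
          Runs (if var 𝕣 then c else d) (ρ ∷ cons a b ∷ s ∷ []) τ S (λ M → 2 + W M)
branch₁ (runs p b) = runs (ifTrue isCons p) (λ M x → s≤s (s≤s (b M x)))

branch₂ : ∀ {c d ρ s τ S W} → Runs d (ρ ∷ nil ∷ s ∷ []) τ S W →
          Runs (if var 𝕣 then c else d) (ρ ∷ nil ∷ s ∷ []) τ S (λ M → 2 + W M)
branch₂ (runs p b) = runs (ifFalse refl p) (λ M x → s≤s (s≤s (b M x)))

exec  : ∀ {Γ A} (t : Tm Γ A) (ρ : Env Γ) r s →
        Runs (compile t) (store ρ r s) (store ρ (encode A (⟦ t ⟧ ρ)) s)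
             (λ M → Safe M t ρ) (λ M → work M t)
execˢ : ∀ {Γ Δ} (ts : Tms Γ Δ) (ρ : Env Γ) r s →
        Runs (compileˢ ts) (store ρ r s) (store ρ (encodeEnv (⟦ ts ⟧ˢ ρ)) s)
             (λ M → Safeˢ M ts ρ) (λ M → workˢ M ts)

-- The 3 pays for the last, failing test. The 25 per element pays for a successful test, the three
-- assignments of `loopBody` and the sequencing.
exec-loop : ∀ {Γ A C} (u : Tm (A ∷ C ∷ Γ) C) (ρ : Env Γ) acc xs s →
  Runs (while hd (var 𝕤) loop loopBody (compile u))
       (store ρ (encode C acc) (cons (encodeList (encode A) xs) s))
       (store ρ (encode C (foldl (λ acc x → ⟦ u ⟧ (x ∷ acc ∷ ρ)) acc xs)) (cons nil s))
       (λ M → Along (λ x acc → Safe M u (x ∷ acc ∷ ρ)) (λ acc x → ⟦ u ⟧ (x ∷ acc ∷ ρ)) acc xs)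
       (λ M → 3 + length xs * (25 + work M u))

exec (var i) ρ r s =
  weaken (set (cong (λ a → encodeEnv ρ ∷ a ∷ s ∷ []) (enc-var i ρ (var 𝕖) _ refl))) (λ _ x → x)
    (λ _ _ → ≤-reflexive (cong suc (+-cancelʳ-≡ 1 _ _ (cost-var i (var 𝕖)))))
exec (op₀ o) ρ r s =
  weaken (set (cong (λ a → encodeEnv ρ ∷ a ∷ s ∷ []) (enc-lit o _))) (λ _ x → x)
    (λ _ _ → s≤s (cost-lit o))
exec (op₁ o t) ρ r s =
  weaken (exec t ρ r s then
          set {S = λ _ → ⊤} (cong (λ a → encodeEnv ρ ∷ a ∷ s ∷ []) (enc-op o (⟦ t ⟧ ρ) (encodeEnv ρ) s)))
    (λ _ x → x , tt)
    (λ M _ → ≤-trans (+-monoʳ-≤ (1 + work M t) (s≤s (cost-op o)))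
                     (≤-reflexive (+-comm (1 + work M t) 4)))
exec (op₂ o t u) ρ r s =
  weaken (exec t ρ r s then set {S = λ _ → ⊤} refl then exec u ρ _ _ then
          set {S = λ _ → ⊤} (cong (λ a → encodeEnv ρ ∷ a ∷ cons (encode _ (⟦ t ⟧ ρ)) s ∷ [])
                                  (sym (enc-cons o (⟦ t ⟧ ρ) (⟦ u ⟧ ρ)))) then
          set {S = λ _ → ⊤} refl)
    (λ _ (x , y) → x , tt , y , tt , tt)
    (λ M _ → ≤-reflexive (sum₂ (work M t) (work M u)))
  where
  sum₂ : ∀ a b → 1 + a + (1 + 4 + (1 + b + (1 + 5 + 3))) ≡ 16 + (a + b)
  sum₂ = solve-∀
exec (cond b t u) ρ r s with exec b ρ r s | ⟦ b ⟧ ρ in eq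
... | run | true =
  weaken (recast 𝔹 eq run then branch₁ (exec t ρ _ s)) (λ _ x → x)
    (λ M _ → ≤-trans (≤-reflexive (rearrange (work M b) _))
                     (+-monoʳ-≤ 3 (+-monoʳ-≤ (work M b) (m≤m+n (work M t) (work M u)))))
  where
  rearrange : ∀ a b → 1 + a + (2 + b) ≡ 3 + (a + b)
  rearrange = solve-∀
... | run | false =
  weaken (recast 𝔹 eq run then branch₂ (exec u ρ _ s)) (λ _ x → x)
    (λ M _ → ≤-trans (≤-reflexive (rearrange (work M b) _))
                     (+-monoʳ-≤ 3 (+-monoʳ-≤ (work M b) (m≤n+m (work M u) (work M t)))))
  where
  rearrange : ∀ a b → 1 + a + (2 + b) ≡ 3 + (a + b)
  rearrange = solve-∀
exec (caseL {A = A} l t u) ρ r s with exec l ρ r s | ⟦ l ⟧ ρ in eq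
... | run | [] =
  weaken (recast (L A) eq run then branch₂ (exec t ρ _ s)) (λ _ x → x)
    (λ M _ → ≤-trans (≤-reflexive (rearrange (work M l) _))
      (+-mono-≤ 3≤17 (+-monoʳ-≤ (work M l) (m≤m+n (work M t) (work M u)))))
  where
  rearrange : ∀ a b → 1 + a + (2 + b) ≡ 3 + (a + b)
  rearrange = solve-∀
  3≤17 : 3 ≤ 17
  3≤17 = s≤s (s≤s (s≤s z≤n))
... | run | y ∷ ys =
  weaken (recast (L A) eq run then
          branch₁ (set {S = λ _ → ⊤} refl then exec u (y ∷ ys ∷ ρ) _ s then set {S = λ _ → ⊤} refl))
    (λ _ (x , z) → x , tt , z , tt)
    (λ M _ → ≤-trans (≤-reflexive (rearrange (work M l) (work M u)))
      (+-monoʳ-≤ 17 (+-monoʳ-≤ (work M l) (m≤n+m (work M u) (work M t)))))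
  where
  rearrange : ∀ a b → 1 + a + (2 + (1 + 8 + (1 + b + 4))) ≡ 17 + (a + b)
  rearrange = solve-∀
exec (letIn t u) ρ r s =
  weaken (exec t ρ r s then set {S = λ _ → ⊤} refl then exec u (⟦ t ⟧ ρ ∷ ρ) _ s then
          set {S = λ _ → ⊤} refl)
    (λ _ (x , y) → x , tt , y , tt)
    (λ M _ → ≤-reflexive (rearrange (work M t) (work M u)))
  where
  rearrange : ∀ a b → 1 + a + (1 + 4 + (1 + b + 3)) ≡ 10 + (a + b)
  rearrange = solve-∀
exec (fold l t u) ρ r s =
  weaken (exec l ρ r s then set {S = λ _ → ⊤} refl then exec t ρ _ _ then
          exec-loop u ρ (⟦ t ⟧ ρ) (⟦ l ⟧ ρ) s then set {S = λ _ → ⊤} refl)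
    (λ _ (x , y , _ , z) → x , tt , y , z , tt)
    (λ M (_ , _ , le , _) →
      ≤-trans (≤-reflexive (rearrange (work M l) (work M t) (length (⟦ l ⟧ ρ) * (25 + work M u))))
              (+-monoʳ-≤ (14 + (work M l + work M t)) (*-monoˡ-≤ (25 + work M u) le)))
  where
  rearrange : ∀ a b c → 1 + a + (1 + 4 + (1 + b + (1 + (3 + c) + 3))) ≡ 14 + (a + b) + c
  rearrange = solve-∀
exec (call f ts) ρ r s =
  weaken (execˢ ts ρ r s then set {S = λ _ → ⊤} refl then set {S = λ _ → ⊤} refl then
          exec f (⟦ ts ⟧ˢ ρ) _ _ then set {S = λ _ → ⊤} refl then set {S = λ _ → ⊤} refl)
    (λ _ (x , y) → x , tt , tt , y , tt , tt)
    (λ M _ → ≤-reflexive (rearrange (workˢ M ts) (work M f)))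
  where
  rearrange : ∀ a b → 1 + a + (1 + 4 + (1 + 2 + (1 + b + (1 + 3 + 3)))) ≡ 17 + (a + b)
  rearrange = solve-∀

execˢ [] ρ r s = set refl
execˢ (t ∷ ts) ρ r s =
  weaken (exec t ρ r s then set {S = λ _ → ⊤} refl then execˢ ts ρ _ _ then
          set {S = λ _ → ⊤} refl then set {S = λ _ → ⊤} refl)
    (λ _ (x , y) → x , tt , y , tt , tt)
    (λ M _ → ≤-reflexive (rearrange (work M t) (workˢ M ts)))
  where
  rearrange : ∀ a b → 1 + a + (1 + 4 + (1 + b + (1 + 5 + 3))) ≡ 16 + (a + b)
  rearrange = solve-∀

exec-loop u ρ acc []       s = runs (whileFalse refl) (λ _ _ → ≤-refl)
exec-loop {A = A} u ρ acc (x ∷ xs) s =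
  iterate
    (set {S = λ _ → ⊤} refl then set {S = λ _ → ⊤} refl then
     exec u (x ∷ acc ∷ ρ) (encode _ acc) (cons (encodeList (encode A) xs) s) then
     set {S = λ _ → ⊤} refl)
    (exec-loop u ρ (⟦ u ⟧ (x ∷ acc ∷ ρ)) xs s)
  where
  rearrange : ∀ u a → 1 + 2 + (1 + 8 + (1 + 7 + (1 + u + 4))) + (3 + a) ≡ 3 + ((25 + u) + a)
  rearrange = solve-∀
  iterate : ∀ {c e r a b s ρ τ} {S S′ : ℕ → Set} →
    Runs c (e ∷ r ∷ cons (cons a b) s ∷ []) ρ (λ M → ⊤ × ⊤ × S M × ⊤)
         (λ M → 1 + 8 + (1 + 7 + (1 + work M u + 4))) →
    Runs (while hd (var 𝕤) loop c) ρ τ S′ (λ M → 3 + length xs * (25 + work M u)) →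
    Runs (while hd (var 𝕤) loop c) (e ∷ r ∷ cons (cons a b) s ∷ []) τ
         (λ M → S M × S′ M) (λ M → 3 + ((25 + work M u) + length xs * (25 + work M u)))
  iterate (runs p b) (runs q b′) = runs (whileTrue isCons p q) λ M (x , y) →
    ≤-trans (+-mono-≤ (+-monoʳ-≤ 3 (b M (tt , tt , x , tt))) (b′ M y))
            (≤-reflexive (rearrange (work M u) (length xs * (25 + work M u))))

-- Running time

-- The base `suc M` is never zero, so two bounds can be raised to their larger exponent.
Polynomial : (ℕ → ℕ) → Set
Polynomial g = Σ[ c ∈ ℕ ] Σ[ d ∈ ℕ ] (∀ M → g M ≤ c * suc M ^ d)

poly-const : ∀ m → Polynomial (λ _ → m)
poly-const m = m , 0 , λ M → ≤-reflexive (sym (*-identityʳ m))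

poly-+ : ∀ {g h} → Polynomial g → Polynomial h → Polynomial (λ M → g M + h M)
poly-+ {g} {h} (c , d , p) (c′ , d′ , q) = c + c′ , d ⊔ d′ , λ M → begin
  g M + h M
    ≤⟨ +-mono-≤ (p M) (q M) ⟩
  c * suc M ^ d + c′ * suc M ^ d′
    ≤⟨ +-mono-≤ (*-monoʳ-≤ c (^-monoʳ-≤ (suc M) (m≤m⊔n d d′)))
                (*-monoʳ-≤ c′ (^-monoʳ-≤ (suc M) (m≤n⊔m d d′))) ⟩
  c * suc M ^ (d ⊔ d′) + c′ * suc M ^ (d ⊔ d′)
    ≡⟨ *-distribʳ-+ (suc M ^ (d ⊔ d′)) c c′ ⟨
  (c + c′) * suc M ^ (d ⊔ d′) ∎
  where open ≤-Reasoning

poly-* : ∀ {g} → Polynomial g → Polynomial (λ M → M * g M)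
poly-* {g} (c , d , p) = c , suc d , λ M → begin
  M * g M                   ≤⟨ *-mono-≤ (n≤1+n M) (p M) ⟩
  suc M * (c * suc M ^ d)   ≡⟨ swap (suc M) c (suc M ^ d) ⟩
  c * suc M ^ suc d         ∎
  where
  open ≤-Reasoning
  swap : ∀ a b e → a * (b * e) ≡ b * (a * e)
  swap = solve-∀

-- Coefficient and exponent depend on the term alone; this is what makes the exponent of n
-- independent of k.
work-poly  : ∀ {Γ A} (t : Tm Γ A) → Polynomial (λ M → work M t)
work-polyˢ : ∀ {Γ Δ} (ts : Tms Γ Δ) → Polynomial (λ M → workˢ M ts)
work-poly (var i)       = poly-const _
work-poly (op₀ o)       = poly-const 4
work-poly (op₁ o t)     = poly-+ (poly-const 5) (work-poly t)
work-poly (op₂ o t u)   = poly-+ (poly-const 16) (poly-+ (work-poly t) (work-poly u))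
work-poly (cond b t u)  =
  poly-+ (poly-const 3) (poly-+ (work-poly b) (poly-+ (work-poly t) (work-poly u)))
work-poly (caseL l t u) =
  poly-+ (poly-const 17) (poly-+ (work-poly l) (poly-+ (work-poly t) (work-poly u)))
work-poly (letIn t u)   = poly-+ (poly-const 10) (poly-+ (work-poly t) (work-poly u))
work-poly (fold l t u)  =
  poly-+ (poly-+ (poly-const 14) (poly-+ (work-poly l) (work-poly t)))
         (poly-* (poly-+ (poly-const 25) (work-poly u)))
work-poly (call f ts)   = poly-+ (poly-const 17) (poly-+ (work-polyˢ ts) (work-poly f))

work-polyˢ []       = poly-const 2
work-polyˢ (t ∷ ts) = poly-+ (poly-const 16) (poly-+ (work-poly t) (work-polyˢ ts))

program : ∀ {A C} → Tm (A ∷ []) C → Program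
program t = record
  { width  = 3
  ; input  = 𝕣
  ; body   = 𝕖 := cons (var 𝕣) nil ⨾ compile t
  ; output = 𝕣
  }

program-correct : ∀ {A C} (t : Tm (A ∷ []) C) x →
  Σ[ time ∈ ℕ ] (program t on encode A x outputs encode C (⟦ t ⟧ (x ∷ [])) inTime time) ×
                (∀ M → Safe M t (x ∷ []) → time ≤ 5 + work M t)
program-correct t x with exec t (x ∷ []) (encode _ x) nil
... | runs p b = _ , (_ , seq assign p , refl) , λ M s → +-monoʳ-≤ 5 (b M s)

-- Terms that never build a longer list or a larger number only produce
-- values that are parts of their arguments.
Free  : ∀ {Γ A} → Tm Γ A → Set
Freeˢ : ∀ {Γ Δ} → Tms Γ Δ → Set
Free (var i)         = ⊤
Free (op₀ o)         = ⊤
Free (op₁ suc t)     = ⊥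
Free (op₁ o t)       = Free t
Free (op₂ cons t u)  = ⊥
Free (op₂ pair t u)  = Free t × Free u
Free (cond b t u)    = Free b × Free t × Free u
Free (caseL l t u)   = Free l × Free t × Free u
Free (letIn t u)     = Free t × Free u
Free (fold l t u)    = Free l × Free t × Free u
Free (call f ts)     = Freeˢ ts × Free f
Freeˢ []       = ⊤
Freeˢ (t ∷ ts) = Free t × Freeˢ ts

-- Numbers are bounded along with lengths because `units` turns a number into a list that may be
-- folded over.
Bnd : ∀ A → ℕ → Val A → Set
Bnd 𝔹       M _       = ⊤
Bnd N       M m       = m ≤ M
Bnd (L A)   M xs      = length xs ≤ M × All (Bnd A M) xs
Bnd (A ⊗ C) M (x , y) = Bnd A M x × Bnd C M y

BndEnv : ∀ {Γ} → ℕ → Env Γ → Set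
BndEnv M []            = ⊤
BndEnv M (_∷_ {A} x ρ) = Bnd A M x × BndEnv M ρ

bnd-var : ∀ {M Γ A} (i : A ∈ Γ) (ρ : Env Γ) → BndEnv M ρ → Bnd A M (All.lookup ρ i)
bnd-var (here refl) (x ∷ ρ) (b , _)  = b
bnd-var (there i)   (x ∷ ρ) (_ , bs) = bnd-var i ρ bs

along-inv : ∀ {A C : Set} {P : A → C → Set} {f : C → A → C} (I : C → Set) {Q : A → Set} →
            (∀ {x acc} → Q x → I acc → P x acc × I (f acc x)) →
            ∀ {acc xs} → All Q xs → I acc → Along P f acc xs × I (foldl f acc xs)
along-inv I step []       i = tt , i
along-inv I step (q ∷ qs) i =
  let (p , i′) = step q i
      (ps , j) = along-inv I step qs i′
  in (p , ps) , j

-- For a free term the bound is an invariant of the accumulator of every fold, however many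
-- iterations there are.
free-bounded  : ∀ {M Γ A} (t : Tm Γ A) {ρ : Env Γ} → Free t → BndEnv M ρ →
                Safe M t ρ × Bnd A M (⟦ t ⟧ ρ)
free-boundedˢ : ∀ {M Γ Δ} (ts : Tms Γ Δ) {ρ : Env Γ} → Freeˢ ts → BndEnv M ρ →
                Safeˢ M ts ρ × BndEnv M (⟦ ts ⟧ˢ ρ)
free-bounded (var i) {ρ} f b = tt , bnd-var i ρ b
free-bounded (op₀ ff) f b   = tt , tt
free-bounded (op₀ tt) f b   = tt , tt
free-bounded (op₀ zero) f b = tt , z≤n
free-bounded (op₀ []) f b   = tt , z≤n , []
free-bounded (op₁ prd t) f b =
  let (s , c) = free-bounded t f b in s , ≤-trans pred[n]≤n c
free-bounded {M} (op₁ units t) {ρ} f b =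
  let (s , c) = free-bounded t f b in
  s , ≤-trans (≤-reflexive (length-replicate (⟦ t ⟧ ρ))) c , All.universal (λ _ → tt) _
free-bounded (op₁ fst t) f b = let (s , c) = free-bounded t f b in s , proj₁ c
free-bounded (op₁ snd t) f b = let (s , c) = free-bounded t f b in s , proj₂ c
free-bounded (op₂ pair t u) (f , g) b =
  let (s , c) = free-bounded t f b
      (s′ , c′) = free-bounded u g b
  in (s , s′) , c , c′
free-bounded (cond a t u) {ρ} (f , g , h) b
  with free-bounded a f b | ⟦ a ⟧ ρ
... | s , _ | true  = let (s′ , c) = free-bounded t g b in (s , s′) , c
... | s , _ | false = let (s′ , c) = free-bounded u h b in (s , s′) , c
free-bounded (caseL l t u) {ρ} (f , g , h) b
  with ⟦ l ⟧ ρ | free-bounded l f b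
... | [] | s , _ = let (s′ , c) = free-bounded t g b in (s , s′) , c
... | x ∷ xs | s , (le , bx ∷ bxs) =
  let (s′ , c) = free-bounded u h (bx , (≤-trans (n≤1+n _) le , bxs) , b) in (s , s′) , c
free-bounded (letIn t u) (f , g) b =
  let (s , c)   = free-bounded t f b
      (s′ , c′) = free-bounded u g (c , b)
  in (s , s′) , c′
free-bounded {M} (fold {C = C} l t u) (f , g , h) b =
  let (s , (le , cs)) = free-bounded l f b
      (s′ , c′)       = free-bounded t g b
      (as , c″)       = along-inv (Bnd C M) (λ q i → free-bounded u h (q , i , b)) cs c′
  in (s , s′ , le , as) , c″
free-bounded (call k ts) (f , g) b =
  let (s , c)   = free-boundedˢ ts f b
      (s′ , c′) = free-bounded k g c
  in (s , s′) , c′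

free-boundedˢ []       f       b = tt , tt
free-boundedˢ (t ∷ ts) (f , g) b =
  let (s , c)   = free-bounded t f b
      (s′ , c′) = free-boundedˢ ts g b
  in (s , s′) , c , c′

-- The algorithm

infixr 5 _∷ₜ_
infixr 4 _,ₜ_
infixr 3 _∧ₜ_
infixr 2 _∨ₜ_

x₀ : ∀ {A Γ} → Tm (A ∷ Γ) A
x₀ = var (here refl)
x₁ : ∀ {A A₀ Γ} → Tm (A₀ ∷ A ∷ Γ) A
x₁ = var (there (here refl))
x₂ : ∀ {A A₀ A₁ Γ} → Tm (A₀ ∷ A₁ ∷ A ∷ Γ) A
x₂ = var (there (there (here refl)))
x₃ : ∀ {A A₀ A₁ A₂ Γ} → Tm (A₀ ∷ A₁ ∷ A₂ ∷ A ∷ Γ) A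
x₃ = var (there (there (there (here refl))))
x₄ : ∀ {A A₀ A₁ A₂ A₃ Γ} → Tm (A₀ ∷ A₁ ∷ A₂ ∷ A₃ ∷ A ∷ Γ) A
x₄ = var (there (there (there (there (here refl)))))
x₅ : ∀ {A A₀ A₁ A₂ A₃ A₄ Γ} → Tm (A₀ ∷ A₁ ∷ A₂ ∷ A₃ ∷ A₄ ∷ A ∷ Γ) A
x₅ = var (there (there (there (there (there (here refl))))))
x₆ : ∀ {A A₀ A₁ A₂ A₃ A₄ A₅ Γ} → Tm (A₀ ∷ A₁ ∷ A₂ ∷ A₃ ∷ A₄ ∷ A₅ ∷ A ∷ Γ) A
x₆ = var (there (there (there (there (there (there (here refl)))))))
x₇ : ∀ {A A₀ A₁ A₂ A₃ A₄ A₅ A₆ Γ} → Tm (A₀ ∷ A₁ ∷ A₂ ∷ A₃ ∷ A₄ ∷ A₅ ∷ A₆ ∷ A ∷ Γ) A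
x₇ = var (there (there (there (there (there (there (there (here refl))))))))
x₈ : ∀ {A A₀ A₁ A₂ A₃ A₄ A₅ A₆ A₇ Γ} → Tm (A₀ ∷ A₁ ∷ A₂ ∷ A₃ ∷ A₄ ∷ A₅ ∷ A₆ ∷ A₇ ∷ A ∷ Γ) A
x₈ = var (there (there (there (there (there (there (there (there (here refl)))))))))
x₉ : ∀ {A A₀ A₁ A₂ A₃ A₄ A₅ A₆ A₇ A₈ Γ} → Tm (A₀ ∷ A₁ ∷ A₂ ∷ A₃ ∷ A₄ ∷ A₅ ∷ A₆ ∷ A₇ ∷ A₈ ∷ A ∷ Γ) A
x₉ = var (there (there (there (there (there (there (there (there (there (here refl))))))))))

ffₜ ttₜ : ∀ {Γ} → Tm Γ 𝔹
ffₜ = op₀ ff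
ttₜ = op₀ tt

0ₜ : ∀ {Γ} → Tm Γ N
0ₜ = op₀ zero

[]ₜ : ∀ {Γ A} → Tm Γ (L A)
[]ₜ = op₀ []

sucₜ predₜ : ∀ {Γ} → Tm Γ N → Tm Γ N
sucₜ  = op₁ suc
predₜ = op₁ prd

unitsₜ : ∀ {Γ} → Tm Γ N → Tm Γ (L 𝔹)
unitsₜ = op₁ units

fstₜ : ∀ {Γ A C} → Tm Γ (A ⊗ C) → Tm Γ A
fstₜ = op₁ fst

sndₜ : ∀ {Γ A C} → Tm Γ (A ⊗ C) → Tm Γ C
sndₜ = op₁ snd

_,ₜ_ : ∀ {Γ A C} → Tm Γ A → Tm Γ C → Tm Γ (A ⊗ C)
_,ₜ_ = op₂ pair

_∷ₜ_ : ∀ {Γ A} → Tm Γ A → Tm Γ (L A) → Tm Γ (L A)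
_∷ₜ_ = op₂ cons

¬ₜ_ : ∀ {Γ} → Tm Γ 𝔹 → Tm Γ 𝔹
¬ₜ a = cond a ffₜ ttₜ

_∧ₜ_ _∨ₜ_ _⇔ₜ_ : ∀ {Γ} → Tm Γ 𝔹 → Tm Γ 𝔹 → Tm Γ 𝔹
a ∧ₜ b = cond a b ffₜ
a ∨ₜ b = cond a ttₜ b
a ⇔ₜ b = cond a b (cond b ffₜ ttₜ)

-- In the body of a search, x₀ is the element and x₁ the accumulator.
anyₜ allₜ : ∀ {Γ A} → Tm Γ (L A) → Tm (A ∷ 𝔹 ∷ Γ) 𝔹 → Tm Γ 𝔹
anyₜ l b = fold l ffₜ (cond b ttₜ x₁)
allₜ l b = fold l ttₜ (cond b x₁ ffₜ)

-- The fold runs on after a hit, so the last hit is returned; `false` with 0 stands for none.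
findₜ : ∀ {Γ A} → Tm Γ (L A) → Tm (A ∷ 𝔹 ⊗ N ∷ Γ) 𝔹 → Tm (A ∷ 𝔹 ⊗ N ∷ Γ) N → Tm Γ (𝔹 ⊗ N)
findₜ l b v = fold l (ffₜ ,ₜ 0ₜ) (cond b (ttₜ ,ₜ v) x₁)

Matrix Label Entry Scored State : Ty
Matrix = L (L 𝔹)
-- (burns , defended , time)
Label  = 𝔹 ⊗ 𝔹 ⊗ N
Entry  = L (N ⊗ Label)
Scored = N ⊗ Entry
State  = L N ⊗ L Scored

opaque
  subₜ : Tm (N ∷ N ∷ []) N
  subₜ = fold (unitsₜ x₁) x₀ (predₜ x₁)

opaque
  -- Comparison goes through truncated subtraction, since the machine can only test a tree for
  -- `nil`.
  leₜ eqₜ : Tm (N ∷ N ∷ []) 𝔹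
  leₜ = caseL (unitsₜ (call subₜ (x₀ ∷ x₁ ∷ []))) ttₜ ffₜ
  eqₜ = call leₜ (x₀ ∷ x₁ ∷ []) ∧ₜ call leₜ (x₁ ∷ x₀ ∷ [])

opaque
  nthₜ : ∀ {A} → Op₀ A → Tm (L A ∷ N ∷ []) A
  nthₜ d = caseL (fold (unitsₜ x₁) x₀ (caseL x₁ []ₜ x₁)) (op₀ d) x₀

opaque
  memₜ : Tm (N ∷ L N ∷ []) 𝔹
  memₜ = anyₜ x₁ (call eqₜ (x₂ ∷ x₀ ∷ []))

opaque
  adjₜ : Tm (Matrix ∷ N ∷ N ∷ []) 𝔹
  adjₜ = call (nthₜ ff) (call (nthₜ []) (x₀ ∷ x₁ ∷ []) ∷ x₂ ∷ [])

burnsₜ defₜ : ∀ {Γ} → Tm Γ Label → Tm Γ 𝔹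
burnsₜ l = fstₜ l
defₜ l = ¬ₜ fstₜ l ∧ₜ fstₜ (sndₜ l)

timeₜ : ∀ {Γ} → Tm Γ Label → Tm Γ N
timeₜ l = sndₜ (sndₜ l)

opaque
  -- That the second time is at most one more than the first is tested with `predₜ` on the larger
  -- side: `sucₜ` on the other side would not be `Free`.
  closedₜ clashₜ : Tm (Label ∷ Label ∷ []) 𝔹
  closedₜ = ¬ₜ burnsₜ x₀ ∨ₜ
            ((burnsₜ x₁ ∨ₜ fstₜ (sndₜ x₁)) ∧ₜ call leₜ (predₜ (timeₜ x₁) ∷ timeₜ x₀ ∷ []))
  clashₜ  = defₜ x₀ ∧ₜ defₜ x₁ ∧ₜ call eqₜ (timeₜ x₀ ∷ timeₜ x₁ ∷ [])

opaque
  compatₜ : Tm (Matrix ∷ N ⊗ Label ∷ N ⊗ Label ∷ []) 𝔹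
  compatₜ =
    ¬ₜ call clashₜ (sndₜ x₁ ∷ sndₜ x₂ ∷ []) ∧ₜ
    (¬ₜ call adjₜ (x₀ ∷ fstₜ x₁ ∷ fstₜ x₂ ∷ []) ∨ₜ
     call closedₜ (sndₜ x₁ ∷ sndₜ x₂ ∷ []) ∧ₜ call closedₜ (sndₜ x₂ ∷ sndₜ x₁ ∷ []))

opaque
  okₜ : Tm (Matrix ∷ Entry ∷ N ⊗ Label ∷ []) 𝔹
  okₜ = allₜ x₁ (call compatₜ (x₂ ∷ x₀ ∷ x₄ ∷ []))

opaque
  -- Entries are compared by behaviour, as in a Nerode congruence: every label at every unprocessed
  -- vertex is tried on both.
  keyₜ : Tm (Matrix ∷ L N ∷ L Label ∷ L N ∷ Entry ∷ Entry ∷ []) 𝔹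
  keyₜ =
    allₜ x₁ (call memₜ (x₀ ∷ x₅ ∷ []) ∨ₜ
             allₜ x₄ (call okₜ (x₄ ∷ x₈ ∷ (x₂ ,ₜ x₀) ∷ []) ⇔ₜ
                      call okₜ (x₄ ∷ x₉ ∷ (x₂ ,ₜ x₀) ∷ [])))

opaque
  -- Entries that the new one improves on stay in the table, so entries with the same key are told
  -- apart by their scores.
  insertₜ : Tm (Matrix ∷ L N ∷ L Label ∷ L N ∷ Scored ∷ L Scored ∷ []) (L Scored)
  insertₜ =
    cond (anyₜ x₅ (call keyₜ (x₂ ∷ x₃ ∷ x₄ ∷ x₅ ∷ sndₜ x₀ ∷ sndₜ x₆ ∷ []) ∧ₜ
                   call leₜ (fstₜ x₆ ∷ fstₜ x₀ ∷ [])))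
      x₅ (x₄ ∷ₜ x₅)

-- Arguments: matrix, vertices, labels, processed vertices, new vertex,
-- scored entry, label, table.
opaque
  tryₜ : Tm (Matrix ∷ L N ∷ L Label ∷ L N ∷ N ∷ Scored ∷ Label ∷ L Scored ∷ []) (L Scored)
  tryₜ =
    cond (call okₜ (x₀ ∷ sndₜ x₅ ∷ (x₄ ,ₜ x₆) ∷ []))
      (call insertₜ (x₀ ∷ x₁ ∷ x₂ ∷ (x₄ ∷ₜ x₃) ∷
                     (cond (burnsₜ x₆) (fstₜ x₅) (sucₜ (fstₜ x₅)) ,ₜ ((x₄ ,ₜ x₆) ∷ₜ sndₜ x₅)) ∷ x₇ ∷ []))
      x₇

opaque
  extendₜ : Tm (Matrix ∷ L N ∷ L Label ∷ L N ∷ N ∷ L Scored ∷ []) (L Scored)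
  extendₜ =
    fold x₅ []ₜ (fold x₄ x₁ (call tryₜ (x₄ ∷ x₅ ∷ x₆ ∷ x₇ ∷ x₈ ∷ x₂ ∷ x₀ ∷ x₁ ∷ [])))

opaque
  -- As long as a vertex of X is unprocessed, s is the only processed vertex outside X, so the
  -- second alternative takes effect only after X. From then on it completes each component outside
  -- X and s before the next is entered.
  preferredₜ : Tm (Matrix ∷ L 𝔹 ∷ N ∷ L N ∷ N ∷ []) 𝔹
  preferredₜ =
    call (nthₜ ff) (x₁ ∷ x₄ ∷ []) ∨ₜ
    anyₜ x₃ (¬ₜ call (nthₜ ff) (x₃ ∷ x₀ ∷ []) ∧ₜ ¬ₜ call eqₜ (x₀ ∷ x₄ ∷ []) ∧ₜ
             call adjₜ (x₂ ∷ x₀ ∷ x₆ ∷ []))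

opaque
  nextₜ : Tm (Matrix ∷ L N ∷ L 𝔹 ∷ N ∷ L N ∷ []) (𝔹 ⊗ N)
  nextₜ =
    letIn (findₜ x₁ (¬ₜ call memₜ (x₀ ∷ x₆ ∷ []) ∧ₜ
                     call preferredₜ (x₂ ∷ x₄ ∷ x₅ ∷ x₆ ∷ x₀ ∷ [])) x₀)
      (cond (fstₜ x₀) x₀
        (findₜ x₂ (¬ₜ call memₜ (x₀ ∷ x₇ ∷ [])) x₀))

opaque
  roundₜ : Tm (Matrix ∷ L N ∷ L Label ∷ L 𝔹 ∷ N ∷ State ∷ []) State
  roundₜ =
    letIn (call nextₜ (x₀ ∷ x₁ ∷ x₃ ∷ x₄ ∷ fstₜ x₅ ∷ []))
      (cond (fstₜ x₀)
        ((sndₜ x₀ ∷ₜ fstₜ x₆) ,ₜ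
         call extendₜ (x₁ ∷ x₂ ∷ x₃ ∷ fstₜ x₆ ∷ sndₜ x₀ ∷ sndₜ x₆ ∷ []))
        x₆)

opaque
  -- The fold over the vertices counts rounds; which vertex a round processes is decided by `nextₜ`.
  tableₜ : Tm (Matrix ∷ L N ∷ L Label ∷ L 𝔹 ∷ N ∷ []) State
  tableₜ =
    fold x₁ ((x₄ ∷ₜ []ₜ) ,ₜ ((0ₜ ,ₜ ((x₄ ,ₜ (ttₜ ,ₜ ffₜ ,ₜ 0ₜ)) ∷ₜ []ₜ)) ∷ₜ []ₜ))
      (call roundₜ (x₂ ∷ x₃ ∷ x₄ ∷ x₅ ∷ x₆ ∷ x₁ ∷ []))

opaque
  bestₜ : Tm (L Scored ∷ []) Scored
  bestₜ = fold x₀ (0ₜ ,ₜ []ₜ) (cond (call leₜ (fstₜ x₁ ∷ fstₜ x₀ ∷ [])) x₀ x₁)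

opaque
  threatₜ : Tm (Matrix ∷ L N ∷ L N ∷ N ∷ []) 𝔹
  threatₜ = ¬ₜ call memₜ (x₃ ∷ x₁ ∷ []) ∧ₜ ¬ₜ call memₜ (x₃ ∷ x₂ ∷ []) ∧ₜ
            anyₜ x₁ (call adjₜ (x₂ ∷ x₀ ∷ x₅ ∷ []))

opaque
  -- Threats are tested against the fire before the step and not against the accumulator, so the
  -- fire advances by one edge.
  spreadₜ : Tm (Matrix ∷ L N ∷ L N ∷ L N ∷ []) (L N)
  spreadₜ = fold x₁ x₂ (cond (call threatₜ (x₂ ∷ x₄ ∷ x₅ ∷ x₀ ∷ [])) (x₀ ∷ₜ x₁) x₁)

opaque
  -- A valid strategy must defend a vertex in every step while the fire spreads, so some vertex that
  -- is not burning is taken when the labels offer none.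
  pickₜ : Tm (L N ∷ Entry ∷ N ∷ L N ∷ []) N
  pickₜ =
    letIn (findₜ x₁ (defₜ (sndₜ x₀) ∧ₜ call eqₜ (timeₜ (sndₜ x₀) ∷ x₄ ∷ []) ∧ₜ
                     ¬ₜ call memₜ (fstₜ x₀ ∷ x₅ ∷ [])) (fstₜ x₀))
      (cond (fstₜ x₀) (sndₜ x₀) (sndₜ (findₜ x₁ (¬ₜ call memₜ (x₀ ∷ x₆ ∷ [])) x₀)))

-- (time , burning , defended, latest first)
Fire : Ty
Fire = N ⊗ L N ⊗ L N

opaque
  moveₜ : Tm (Matrix ∷ L N ∷ Entry ∷ Fire ∷ []) Fire
  moveₜ =
    cond (anyₜ x₁ (call threatₜ (x₂ ∷ fstₜ (sndₜ x₅) ∷ sndₜ (sndₜ x₅) ∷ x₀ ∷ [])))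
      (letIn (call pickₜ (x₁ ∷ x₂ ∷ sucₜ (fstₜ x₃) ∷ fstₜ (sndₜ x₃) ∷ []) ∷ₜ sndₜ (sndₜ x₃))
        (sucₜ (fstₜ x₄) ,ₜ call spreadₜ (x₁ ∷ x₂ ∷ fstₜ (sndₜ x₄) ∷ x₀ ∷ []) ,ₜ x₀))
      x₃

opaque
  simulateₜ : Tm (Matrix ∷ L N ∷ Entry ∷ N ∷ N ∷ []) Fire
  simulateₜ =
    fold (unitsₜ x₄) (0ₜ ,ₜ (x₃ ∷ₜ []ₜ) ,ₜ []ₜ) (call moveₜ (x₂ ∷ x₃ ∷ x₄ ∷ x₁ ∷ []))

opaque
  reverseₜ : Tm (L N ∷ []) (L N)
  reverseₜ = fold x₀ []ₜ (x₀ ∷ₜ x₁)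

opaque
  verticesₜ : Tm (Matrix ∷ []) (L N)
  verticesₜ = sndₜ (fold x₀ (0ₜ ,ₜ []ₜ) (sucₜ (fstₜ x₁) ,ₜ (fstₜ x₁ ∷ₜ sndₜ x₁)))

opaque
  horizonₜ : Tm (L 𝔹 ∷ []) N
  horizonₜ = fold x₀ (sucₜ (sucₜ (sucₜ (sucₜ 0ₜ))))
               (cond x₀ (sucₜ (sucₜ (sucₜ (sucₜ x₁)))) x₁)

opaque
  -- There is no label for a defence at time 0: the first vertex is defended at time 1.
  labelsₜ : Tm (N ∷ []) (L Label)
  labelsₜ =
    sndₜ (fold (unitsₜ x₀)
      (0ₜ ,ₜ ((ttₜ ,ₜ ffₜ ,ₜ 0ₜ) ∷ₜ (ffₜ ,ₜ ffₜ ,ₜ 0ₜ) ∷ₜ []ₜ))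
      (letIn (sucₜ (fstₜ x₁))
        (x₀ ,ₜ ((ttₜ ,ₜ ffₜ ,ₜ x₀) ∷ₜ (ffₜ ,ₜ ttₜ ,ₜ x₀) ∷ₜ sndₜ x₂))))

opaque
  mainₜ : Tm (Matrix ⊗ N ⊗ L 𝔹 ∷ []) (L N)
  mainₜ =
    letIn (call verticesₜ (fstₜ x₀ ∷ []))
    (letIn (call horizonₜ (sndₜ (sndₜ x₁) ∷ []))
    (letIn (call labelsₜ (x₀ ∷ []))
    (letIn (call tableₜ (fstₜ x₃ ∷ x₂ ∷ x₀ ∷ sndₜ (sndₜ x₃) ∷ fstₜ (sndₜ x₃) ∷ []))
    (letIn (call bestₜ (sndₜ x₀ ∷ []))
    (letIn (call simulateₜ (fstₜ x₅ ∷ x₄ ∷ sndₜ x₀ ∷ fstₜ (sndₜ x₅) ∷ sucₜ x₃ ∷ []))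
     (call reverseₜ (sndₜ (sndₜ x₀) ∷ [])))))))

-- What the decision procedures decide

is-true : ∀ b → Reflects (b ≡ true) b
is-true true  = ofʸ refl
is-true false = ofⁿ λ ()

true⇒ : ∀ {P : Set} {b} → Reflects P b → b ≡ true → P
true⇒ (ofʸ p) refl = p

⇒true : ∀ {P : Set} {b} → Reflects P b → P → b ≡ true
⇒true (ofʸ p)  _ = refl
⇒true (ofⁿ ¬p) p = ⊥-elim (¬p p)

map-reflects : ∀ {P Q : Set} {b} → (P → Q) → (Q → P) → Reflects P b → Reflects Q b
map-reflects f g (ofʸ p)  = ofʸ (f p)
map-reflects f g (ofⁿ ¬p) = ofⁿ (¬p ∘ g)

¬-ite : ∀ {P : Set} {a} → Reflects P a → Reflects (¬ P) (ite a false true)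
¬-ite (ofʸ p)  = ofⁿ (λ ¬p → ¬p p)
¬-ite (ofⁿ ¬p) = ofʸ ¬p

∧-ite : ∀ {P Q : Set} {a b} → Reflects P a → Reflects Q b → Reflects (P × Q) (ite a b false)
∧-ite (ofʸ p)  (ofʸ q)  = ofʸ (p , q)
∧-ite (ofʸ p)  (ofⁿ ¬q) = ofⁿ (¬q ∘ proj₂)
∧-ite (ofⁿ ¬p) _        = ofⁿ (¬p ∘ proj₁)

∨-ite : ∀ {P Q : Set} {a b} → Reflects P a → Reflects Q b → Reflects (P ⊎ Q) (ite a true b)
∨-ite (ofʸ p)  _        = ofʸ (inj₁ p)
∨-ite (ofⁿ ¬p) (ofʸ q)  = ofʸ (inj₂ q)
∨-ite (ofⁿ ¬p) (ofⁿ ¬q) = ofⁿ [ ¬p , ¬q ]′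

→-ite : ∀ {P Q : Set} {a b} → Reflects P a → Reflects Q b →
        Reflects (P → Q) (ite (ite a false true) true b)
→-ite (ofʸ p)  (ofʸ q)  = ofʸ (λ _ → q)
→-ite (ofʸ p)  (ofⁿ ¬q) = ofⁿ (λ f → ¬q (f p))
→-ite (ofⁿ ¬p) _        = ofʸ (⊥-elim ∘ ¬p)

≡-ite : ∀ a b → Reflects (a ≡ b) (ite a b (ite b false true))
≡-ite true  true  = ofʸ refl
≡-ite true  false = ofⁿ λ ()
≡-ite false true  = ofⁿ λ ()
≡-ite false false = ofʸ refl

-- The accumulator is in scope in the body of a fold, so the test may see it; the hypothesis asks
-- for a correct answer at every accumulator.
any-reflects : ∀ {A : Set} {P : A → Set} {p : A → Bool → Bool} →
  (∀ x acc → Reflects (P x) (p x acc)) →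
  ∀ xs → Reflects (Any P xs) (foldl (λ acc x → ite (p x acc) true acc) false xs)
any-reflects {P = P} {p} r = go
  where
  after : ∀ xs → foldl (λ acc x → ite (p x acc) true acc) true xs ≡ true
  after []       = refl
  after (x ∷ xs) with p x true
  ... | true  = after xs
  ... | false = after xs
  go : ∀ xs → Reflects (Any P xs) (foldl (λ acc x → ite (p x acc) true acc) false xs)
  go []       = ofⁿ λ ()
  go (x ∷ xs) with p x false | r x false
  ... | true  | ofʸ px = subst (Reflects _) (sym (after xs)) (ofʸ (here px))
  ... | false | ofⁿ ¬p = map-reflects there (λ { (here px) → ⊥-elim (¬p px) ; (there a) → a }) (go xs)

all-reflects : ∀ {A : Set} {P : A → Set} {p : A → Bool → Bool} →
  (∀ x acc → Reflects (P x) (p x acc)) →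
  ∀ xs → Reflects (All P xs) (foldl (λ acc x → ite (p x acc) acc false) true xs)
all-reflects {P = P} {p} r = go
  where
  after : ∀ xs → foldl (λ acc x → ite (p x acc) acc false) false xs ≡ false
  after []       = refl
  after (x ∷ xs) with p x false
  ... | true  = after xs
  ... | false = after xs
  go : ∀ xs → Reflects (All P xs) (foldl (λ acc x → ite (p x acc) acc false) true xs)
  go []       = ofʸ []
  go (x ∷ xs) with p x true | r x true
  ... | true  | ofʸ px = map-reflects (px ∷_) All.tail (go xs)
  ... | false | ofⁿ ¬p = subst (Reflects _) (sym (after xs)) (ofⁿ (¬p ∘ All.head))

Found : ∀ {A : Set} → (A → Set) → (A → ℕ) → List A → Bool × ℕ → Set
Found P w xs r = (Σ[ x ∈ _ ] x ∈ xs × P x × r ≡ (true , w x)) ⊎ (All (¬_ ∘ P) xs × r ≡ (false , 0))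

find-spec : ∀ {A : Set} {P : A → Set} {p : A → Bool × ℕ → Bool} (w : A → ℕ) →
  (∀ x acc → Reflects (P x) (p x acc)) →
  ∀ xs → Found P w xs (foldl (λ acc x → ite (p x acc) (true , w x) acc) (false , 0) xs)
find-spec {A} {P} {p} w r = λ xs → go xs [] (inj₂ ([] , refl))
  where
  go : ∀ xs ys {acc} → Found P w ys acc →
       Found P w xs (foldl (λ acc x → ite (p x acc) (true , w x) acc) (false , 0) xs)
  -- After a hit only a later hit can change the result.
  step′ : ∀ xs {x} → P x →
          let r = foldl (λ acc x → ite (p x acc) (true , w x) acc) (true , w x) xs in
          (r ≡ (true , w x)) ⊎ (Σ[ y ∈ A ] y ∈ xs × P y × r ≡ (true , w y))
  step′ [] px = inj₁ refl
  step′ (y ∷ ys) {x} px with p y (true , w x) | r y (true , w x)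
  ... | true  | ofʸ py with step′ ys py
  ...   | inj₁ eq = inj₂ (y , here refl , py , eq)
  ...   | inj₂ (z , z∈ , pz , eq) = inj₂ (z , there z∈ , pz , eq)
  step′ (y ∷ ys) {x} px | false | ofⁿ _ with step′ ys px
  ...   | inj₁ eq = inj₁ eq
  ...   | inj₂ (z , z∈ , pz , eq) = inj₂ (z , there z∈ , pz , eq)
  go []       ys f = inj₂ ([] , refl)
  go (x ∷ xs) ys f with p x (false , 0) | r x (false , 0)
  ... | true  | ofʸ px with step′ xs px
  ...   | inj₁ eq = inj₁ (x , here refl , px , eq)
  ...   | inj₂ (z , z∈ , pz , eq) = inj₁ (z , there z∈ , pz , eq)
  go (x ∷ xs) ys f | false | ofⁿ ¬p with go xs ys f
  ... | inj₁ (z , z∈ , pz , eq) = inj₁ (z , there z∈ , pz , eq)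
  ... | inj₂ (all , eq)         = inj₂ (¬p ∷ all , eq)

opaque
  unfolding subₜ
  sub-correct : ∀ a b → ⟦ subₜ ⟧ (a ∷ b ∷ []) ≡ a ∸ b
  sub-correct a       zero    = refl
  sub-correct zero    (suc b) = trans (sub-correct zero b) (0∸n≡0 b)
  sub-correct (suc a) (suc b) = sub-correct a b

opaque
  unfolding leₜ
  le-reflects : ∀ a b → Reflects (a ≤ b) (⟦ leₜ ⟧ (a ∷ b ∷ []))
  le-reflects a b rewrite sub-correct a b with a ∸ b in eq
  ... | zero  = ofʸ (m∸n≡0⇒m≤n eq)
  ... | suc _ = ofⁿ λ a≤b → 1+n≢0 (trans (sym eq) (m≤n⇒m∸n≡0 a≤b))

  eq-reflects : ∀ a b → Reflects (a ≡ b) (⟦ eqₜ ⟧ (a ∷ b ∷ []))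
  eq-reflects a b =
    map-reflects (λ (p , q) → ≤-antisym p q) (λ { refl → ≤-refl , ≤-refl })
                 (∧-ite (le-reflects a b) (le-reflects b a))

opaque
  unfolding memₜ
  mem-reflects : ∀ v xs → Reflects (v ∈ xs) (⟦ memₜ ⟧ (v ∷ xs ∷ []))
  mem-reflects v xs = any-reflects (λ x _ → eq-reflects v x) xs

nth : ∀ {A} → Op₀ A → List (Val A) → ℕ → Val A
nth d xs i = ⟦ nthₜ d ⟧ (xs ∷ i ∷ [])

adj : Val Matrix → ℕ → ℕ → Bool
adj g u v = ⟦ adjₜ ⟧ (g ∷ u ∷ v ∷ [])

Lab : Set
Lab = Val Label

Burns IsDef : Lab → Set
Burns l = proj₁ l ≡ true
IsDef l = ¬ Burns l × proj₁ (proj₂ l) ≡ true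

time : Lab → ℕ
time l = proj₂ (proj₂ l)

Closed Clash : Lab → Lab → Set
Closed l l′ = Burns l → (Burns l′ ⊎ proj₁ (proj₂ l′) ≡ true) × pred (time l′) ≤ time l
Clash  l l′ = IsDef l × IsDef l′ × time l ≡ time l′

record Compat (g : Val Matrix) (p q : ℕ × Lab) : Set where
  constructor compatible
  field
    no-clash : ¬ Clash (proj₂ p) (proj₂ q)
    closed   : adj g (proj₁ p) (proj₁ q) ≡ true →
               Closed (proj₂ p) (proj₂ q) × Closed (proj₂ q) (proj₂ p)

def-reflects : ∀ (l : Lab) → Reflects (IsDef l) (ite (ite (proj₁ l) false true) (proj₁ (proj₂ l)) false)
def-reflects l = ∧-ite (¬-ite (is-true _)) (is-true _)

opaque
  unfolding closedₜ
  closed-reflects : ∀ l l′ → Reflects (Closed l l′) (⟦ closedₜ ⟧ (l ∷ l′ ∷ []))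
  closed-reflects l l′ =
    →-ite (is-true _) (∧-ite (∨-ite (is-true _) (is-true _)) (le-reflects _ _))

  clash-reflects : ∀ l l′ → Reflects (Clash l l′) (⟦ clashₜ ⟧ (l ∷ l′ ∷ []))
  clash-reflects l l′ = ∧-ite (def-reflects l) (∧-ite (def-reflects l′) (eq-reflects _ _))

opaque
  unfolding compatₜ
  compat-reflects : ∀ g p q → Reflects (Compat g p q) (⟦ compatₜ ⟧ (g ∷ p ∷ q ∷ []))
  compat-reflects g (u , l) (v , l′) =
    map-reflects (λ (a , b) → compatible a b) (λ (compatible a b) → a , b)
      (∧-ite (¬-ite (clash-reflects l l′))
             (→-ite (is-true _) (∧-ite (closed-reflects l l′) (closed-reflects l′ l))))

Ok : Val Matrix → Val Entry → ℕ × Lab → Set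
Ok g e q = All (λ p → Compat g p q) e

ok : Val Matrix → Val Entry → ℕ × Lab → Bool
ok g e q = ⟦ okₜ ⟧ (g ∷ e ∷ q ∷ [])

opaque
  unfolding okₜ
  ok-reflects : ∀ g e q → Reflects (Ok g e q) (ok g e q)
  ok-reflects g e q = all-reflects (λ p _ → compat-reflects g p q) e

Key : Val Matrix → List ℕ → List Lab → List ℕ → Val Entry → Val Entry → Set
Key g V Λ P e e′ = All (λ v → v ∈ P ⊎ All (λ l → ok g e (v , l) ≡ ok g e′ (v , l)) Λ) V

opaque
  unfolding keyₜ
  key-reflects : ∀ g V Λ P e e′ → Reflects (Key g V Λ P e e′) (⟦ keyₜ ⟧ (g ∷ V ∷ Λ ∷ P ∷ e ∷ e′ ∷ []))
  key-reflects g V Λ P e e′ =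
    all-reflects (λ v _ → ∨-ite (mem-reflects v P) (all-reflects (λ l _ → ≡-ite _ _) Λ)) V

record Dominates (g : Val Matrix) (V : List ℕ) (Λ : List Lab) (P : List ℕ) (new old : Val Scored) : Set where
  constructor dominates
  field
    same-key : Key g V Λ P (proj₂ old) (proj₂ new)
    better   : proj₁ new ≤ proj₁ old

opaque
  unfolding insertₜ
  insert-spec : ∀ g V Λ P new tbl → let r = ⟦ insertₜ ⟧ (g ∷ V ∷ Λ ∷ P ∷ new ∷ tbl ∷ []) in
    (Any (Dominates g V Λ P new) tbl × r ≡ tbl) ⊎
    (¬ Any (Dominates g V Λ P new) tbl × r ≡ new ∷ tbl)
  insert-spec g V Λ P new tbl = decide
    (any-reflects (λ old _ → map-reflects (λ (a , b) → dominates a b) (λ (dominates a b) → a , b)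
      (∧-ite (key-reflects g V Λ P (proj₂ old) (proj₂ new)) (le-reflects (proj₁ new) (proj₁ old)))) tbl)
    where
    decide : ∀ {Q : Set} {b} → Reflects Q b →
             (Q × ite b tbl (new ∷ tbl) ≡ tbl) ⊎ (¬ Q × ite b tbl (new ∷ tbl) ≡ new ∷ tbl)
    decide (ofʸ q)  = inj₁ (q , refl)
    decide (ofⁿ ¬q) = inj₂ (¬q , refl)

Preferred : Val Matrix → List Bool → ℕ → List ℕ → ℕ → Set
Preferred g X s P v =
  nth ff X v ≡ true ⊎ Any (λ w → ¬ nth ff X w ≡ true × ¬ w ≡ s × adj g w v ≡ true) P

opaque
  unfolding preferredₜ
  preferred-reflects : ∀ g X s P v →
    Reflects (Preferred g X s P v) (⟦ preferredₜ ⟧ (g ∷ X ∷ s ∷ P ∷ v ∷ []))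
  preferred-reflects g X s P v =
    ∨-ite (is-true _)
      (any-reflects (λ w _ → ∧-ite (¬-ite (is-true _)) (∧-ite (¬-ite (eq-reflects w s)) (is-true _))) P)

data Next (g : Val Matrix) (V : List ℕ) (X : List Bool) (s : ℕ) (P : List ℕ) : Bool × ℕ → Set where
  finished : All (_∈ P) V → Next g V X s P (false , 0)
  chosen : ∀ {u} → u ∈ V → u ∉ P →
         (Preferred g X s P u ⊎ All (λ v → v ∉ P → ¬ Preferred g X s P v) V) →
         Next g V X s P (true , u)

opaque
  unfolding nextₜ
  next-spec : ∀ g V X s P → Next g V X s P (⟦ nextₜ ⟧ (g ∷ V ∷ X ∷ s ∷ P ∷ []))
  next-spec g V X s P = first
    (find-spec id (λ v _ → ∧-ite (¬-ite (mem-reflects v P)) (preferred-reflects g X s P v)) V)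
    (find-spec id (λ v _ → ¬-ite (mem-reflects v P)) V)
    where
    -- The failed search only refutes non-membership; decidability turns this into membership.
    back : ∀ {v} → ¬ (v ∉ P) → v ∈ P
    back {v} ¬¬p with ⟦ memₜ ⟧ (v ∷ P ∷ []) | mem-reflects v P
    ... | _ | ofʸ p  = p
    ... | _ | ofⁿ ¬p = ⊥-elim (¬¬p ¬p)
    first : ∀ {r r′} → Found (λ v → v ∉ P × Preferred g X s P v) id V r → Found (_∉ P) id V r′ → Next g V X s P (ite (proj₁ r) r r′)
    first (inj₁ (u , u∈V , (u∉P , pr) , refl)) _ = chosen u∈V u∉P (inj₁ pr)
    first (inj₂ (all , refl)) (inj₁ (u , u∈V , u∉P , refl)) =
      chosen u∈V u∉P (inj₂ (All.map (λ f v∉P pr → f (v∉P , pr)) all))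
    first (inj₂ (_ , refl)) (inj₂ (all , refl)) = finished (All.map back all)

Threat : Val Matrix → List ℕ → List ℕ → ℕ → Set
Threat g bs ds v = v ∉ bs × v ∉ ds × Any (λ u → adj g u v ≡ true) bs

threat : Val Matrix → List ℕ → List ℕ → ℕ → Bool
threat g bs ds v = ⟦ threatₜ ⟧ (g ∷ bs ∷ ds ∷ v ∷ [])

opaque
  unfolding threatₜ
  threat-reflects : ∀ g bs ds v → Reflects (Threat g bs ds v) (threat g bs ds v)
  threat-reflects g bs ds v =
    ∧-ite (¬-ite (mem-reflects v bs)) (∧-ite (¬-ite (mem-reflects v ds)) (any-reflects (λ u _ → is-true _) bs))

-- The table of partial labellings

-- Pigeonhole principle: one occurrence of `x` is cut out of `ys`, and no other element of `xs`
-- relies on it. The size of the table and the number of saved vertices are both compared in this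
-- way.
unique⊆⇒length≤ : ∀ {A : Set} {xs ys : List A} → Unique xs → All (_∈ ys) xs → length xs ≤ length ys
unique⊆⇒length≤ [] [] = z≤n
unique⊆⇒length≤ {xs = x ∷ xs} (x∉ ∷ u) (x∈ ∷ ps) with ∈-∃++ x∈
... | as , bs , refl = begin
  suc (length xs)             ≤⟨ s≤s (unique⊆⇒length≤ u (All.zipWith (λ (x≢ , y∈) → drop x≢ y∈) (x∉ , ps))) ⟩
  suc (length (as ++ bs))     ≡⟨ cong suc (length-++ as) ⟩
  suc (length as + length bs) ≡⟨ +-suc (length as) (length bs) ⟨
  length as + suc (length bs) ≡⟨ length-++ as ⟨
  length (as ++ x ∷ bs)       ∎
  where
  open ≤-Reasoning
  drop : ∀ {y} → x ≢ y → y ∈ as ++ x ∷ bs → y ∈ as ++ bs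
  drop x≢y y∈ with ∈-++⁻ as y∈
  ... | inj₁ p         = ∈-++⁺ˡ p
  ... | inj₂ (here eq) = ⊥-elim (x≢y (sym eq))
  ... | inj₂ (there p) = ∈-++⁺ʳ as p

map-≡⇒ : ∀ {A C : Set} {f h : A → C} {xs} → map f xs ≡ map h xs → ∀ {x} → x ∈ xs → f x ≡ h x
map-≡⇒ {xs = y ∷ ys} eq (here refl) = proj₁ (∷-injective eq)
map-≡⇒ {xs = y ∷ ys} eq (there x∈)  = map-≡⇒ (proj₂ (∷-injective eq)) x∈

++-≡⇒ : ∀ {A : Set} {as bs cs ds : List A} → length as ≡ length cs → as ++ bs ≡ cs ++ ds →
        as ≡ cs × bs ≡ ds
++-≡⇒ {as = []}     {cs = []}     len eq = refl , eq
++-≡⇒ {as = a ∷ as} {cs = c ∷ cs} len eq with ∷-injective eq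
... | refl , eq′ = let (p , q) = ++-≡⇒ {as = as} {cs = cs} (suc-injective len) eq′ in cong (a ∷_) p , q

length-cartesianProduct : ∀ {A C : Set} (xs : List A) (ys : List C) →
                          length (cartesianProduct xs ys) ≡ length xs * length ys
length-cartesianProduct []       ys = refl
length-cartesianProduct (x ∷ xs) ys = trans (length-++ (map (x ,_) ys))
  (cong₂ _+_ (length-map (x ,_) ys) (length-cartesianProduct xs ys))

bits : ℕ → List (List Bool)
bits zero    = [] ∷ []
bits (suc m) = cartesianProductWith _∷_ (true ∷ false ∷ []) (bits m)

length-bits : ∀ m → length (bits m) ≡ 2 ^ m
length-bits zero    = refl
length-bits (suc m) = begin
  length (map (true ∷_) (bits m) ++ map (false ∷_) (bits m) ++ [])
    ≡⟨ length-++ (map (true ∷_) (bits m)) ⟩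
  length (map (true ∷_) (bits m)) + length (map (false ∷_) (bits m) ++ [])
    ≡⟨ cong₂ _+_ (length-map _ (bits m)) (length-++ (map (false ∷_) (bits m))) ⟩
  length (bits m) + (length (map (false ∷_) (bits m)) + 0)
    ≡⟨ cong (λ a → length (bits m) + (a + 0)) (length-map _ (bits m)) ⟩
  length (bits m) + (length (bits m) + 0)
    ≡⟨ cong (2 *_) (length-bits m) ⟩
  2 ^ suc m ∎
  where open ≡-Reasoning

∈-bits : ∀ {m} (bs : List Bool) → length bs ≡ m → bs ∈ bits m
∈-bits {zero} [] refl = here refl
∈-bits {suc m} (true ∷ bs) eq = ∈-++⁺ˡ (∈-map⁺ _ (∈-bits bs (suc-injective eq)))
∈-bits {suc m} (false ∷ bs) eq =
  ∈-++⁺ʳ (map (true ∷_) (bits m)) (∈-++⁺ˡ (∈-map⁺ _ (∈-bits bs (suc-injective eq))))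

foldl-inv : ∀ {A C : Set} (I : C → Set) {f : C → A → C} {xs} →
            (∀ {acc x} → x ∈ xs → I acc → I (f acc x)) → ∀ {acc} → I acc → I (foldl f acc xs)
foldl-inv I {xs = []}     pres i = i
foldl-inv I {xs = x ∷ xs} pres i = foldl-inv I (pres ∘ there) (pres (here refl) i)

-- For loops that collect candidates: `Q` is gained at the decisive element, whatever the state, and
-- survives the rest.
foldl-hit : ∀ {A C : Set} (I Q : C → Set) {f : C → A → C} {xs x₀} →
            (∀ {acc x} → x ∈ xs → I acc → I (f acc x)) →
            (∀ {acc x} → x ∈ xs → I acc → Q acc → Q (f acc x)) →
            x₀ ∈ xs → (∀ {acc} → I acc → Q (f acc x₀)) →
            ∀ {acc} → I acc → Q (foldl f acc xs)
foldl-hit I Q {xs = x ∷ xs} pres keep (here refl) hit i = proj₂ (foldl-inv (λ acc → I acc × Q acc)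
  (λ x∈ (i , q) → pres (there x∈) i , keep (there x∈) i q) (pres (here refl) i , hit i))
foldl-hit I Q {xs = x ∷ xs} pres keep (there x∈) hit i =
  foldl-hit I Q (pres ∘ there) (keep ∘ there) x∈ hit (pres (here refl) i)

pattern burn i = true , false , i
pattern def i  = false , true , i
pattern safe   = false , false , 0

score : Val Entry → ℕ
score []            = 0
score ((_ , l) ∷ e) = ite (proj₁ l) (score e) (suc (score e))

score≤length : ∀ e → score e ≤ length e
score≤length []                    = z≤n
score≤length ((_ , true  , _) ∷ e) = ≤-trans (score≤length e) (n≤1+n _)
score≤length ((_ , false , _) ∷ e) = s≤s (score≤length e)

restrict : (ℕ → Lab) → List ℕ → Val Entry
restrict λ′ = map (λ v → v , λ′ v)

domain : Val Entry → List ℕ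
domain = map proj₁

domain-unique : ∀ {e v l l′} → Unique (domain e) → (v , l) ∈ e → (v , l′) ∈ e → l ≡ l′
domain-unique u       (here refl) (here refl) = refl
domain-unique (n ∷ u) (here refl) (there q)  = ⊥-elim (All.lookup n (∈-map⁺ proj₁ q) refl)
domain-unique (n ∷ u) (there p)   (here refl) = ⊥-elim (All.lookup n (∈-map⁺ proj₁ p) refl)
domain-unique (n ∷ u) (there p)   (there q)  = domain-unique u p q

opaque
 unfolding bestₜ
 best-spec : ∀ x xs → let r = ⟦ bestₜ ⟧ ((x ∷ xs) ∷ []) in
             r ∈ x ∷ xs × All (λ y → proj₁ y ≤ proj₁ r) (x ∷ xs)
 best-spec x xs =
   -- The initial accumulator has score 0 and gives way to the first entry, so the default is never
   -- chosen from a nonempty table.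
   subst (λ a → let r = foldl choose a xs in r ∈ x ∷ xs × All (λ y → proj₁ y ≤ proj₁ r) (x ∷ xs))
         (cong (λ b → ite b x (0 , [])) (sym (⇒true (le-reflects 0 (proj₁ x)) z≤n)))
         (let (m , b , bs) = go xs x in m , b ∷ bs)
   where
   choose : Val Scored → Val Scored → Val Scored
   choose a y = ite (⟦ leₜ ⟧ (proj₁ a ∷ proj₁ y ∷ [])) y a
   go : ∀ xs acc → let r = foldl choose acc xs in
        (r ∈ acc ∷ xs) × proj₁ acc ≤ proj₁ r × All (λ y → proj₁ y ≤ proj₁ r) xs
   go []       acc = here refl , ≤-refl , []
   go (y ∷ ys) acc with ⟦ leₜ ⟧ (proj₁ acc ∷ proj₁ y ∷ []) | le-reflects (proj₁ acc) (proj₁ y)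
   ... | true  | ofʸ le = let (m , b , bs) = go ys y in there m , ≤-trans le b , b ∷ bs
   ... | false | ofⁿ ¬le with go ys acc
   ...   | here eq , b , bs = here eq , b , ≤-trans (≰⇒≥ ¬le) b ∷ bs
   ...   | there m , b , bs = there (there m) , b , ≤-trans (≰⇒≥ ¬le) b ∷ bs

module DP (g : Val Matrix) (V : List ℕ) (X : List Bool) (s : ℕ) (Λ : List Lab)
          (s∈V : s ∈ V) (start∈Λ : burn 0 ∈ Λ)
          (adj-sym : ∀ {u v} → u ∈ V → v ∈ V → adj g u v ≡ true → adj g v u ≡ true)
          where

  InX Inner : ℕ → Set
  InX w   = nth ff X w ≡ true
  Inner w = ¬ InX w × w ≢ s

  InX? : ∀ w → Dec (InX w)
  InX? w = nth ff X w Bool.≟ true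

  -- The newest vertex stands first and was tested against the older ones, whence the order of
  -- arguments in `compat`. By `has-start` all entries agree at s.
  record WF (P : List ℕ) (x : Val Scored) : Set where
    constructor wf
    field
      scored    : proj₁ x ≡ score (proj₂ x)
      covers    : domain (proj₂ x) ≡ P
      compat    : AllPairs (λ p q → Compat g q p) (proj₂ x)
      labelled  : All (λ p → proj₂ p ∈ Λ) (proj₂ x)
      has-start : (s , burn 0) ∈ proj₂ x

  Table : List ℕ → Val (L Scored) → Set
  Table P tbl = All (WF P) tbl × AllPairs (λ new old → ¬ Dominates g V Λ P new old) tbl

  record Feasible (λ′ : ℕ → Lab) : Set where
    constructor feasible
    field
      consistent : ∀ {u v} → u ∈ V → v ∈ V → u ≢ v → Compat g (u , λ′ u) (v , λ′ v)
      source     : λ′ s ≡ burn 0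
      inΛ        : ∀ v → λ′ v ∈ Λ

  -- The exchange invariant: on the processed vertices the entry can replace `λ′` without loss of
  -- score, and each remaining label of `λ′` still fits it.
  Cover : (ℕ → Lab) → List ℕ → Val Scored → Set
  Cover λ′ P x = score (restrict λ′ P) ≤ proj₁ x ×
                 (∀ {w} → w ∈ V → w ∉ P → Ok g (proj₂ x) (w , λ′ w))

  -- The remaining labels of `λ′` belong to `Λ`, so the common key transfers their acceptance.
  cover-dominated : ∀ {λ′ P new old} → Feasible λ′ → Dominates g V Λ P new old →
                    Cover λ′ P new → Cover λ′ P old
  cover-dominated {λ′} {P} {new} {old} F (dominates key le) (sc , oks) = ≤-trans sc le , ok-old
    where
    ok-old : ∀ {w} → w ∈ V → w ∉ P → Ok g (proj₂ old) (w , λ′ w)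
    ok-old {w} w∈V w∉P with All.lookup key w∈V
    ... | inj₁ w∈P = ⊥-elim (w∉P w∈P)
    ... | inj₂ eqs = true⇒ (ok-reflects g (proj₂ old) _)
            (trans (All.lookup eqs (Feasible.inΛ F w)) (⇒true (ok-reflects g (proj₂ new) _) (oks w∈V w∉P)))

  insert-table : ∀ {P new tbl} → WF P new → Table P tbl →
                 Table P (⟦ insertₜ ⟧ (g ∷ V ∷ Λ ∷ P ∷ new ∷ tbl ∷ []))
  insert-table {P} {new} {tbl} w (ws , sep) with insert-spec g V Λ P new tbl
  ... | inj₁ (_ , eq)   = subst (Table P) (sym eq) (ws , sep)
  ... | inj₂ (¬a , eq) = subst (Table P) (sym eq) (w ∷ ws , All.¬Any⇒All¬ tbl ¬a ∷ sep)

  insert-keeps : ∀ {P new tbl} {Q : Val Scored → Set} → Any Q tbl →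
                 Any Q (⟦ insertₜ ⟧ (g ∷ V ∷ Λ ∷ P ∷ new ∷ tbl ∷ []))
  insert-keeps {P} {new} {tbl} {Q} a with insert-spec g V Λ P new tbl
  ... | inj₁ (_ , eq) = subst (Any Q) (sym eq) a
  ... | inj₂ (_ , eq) = subst (Any Q) (sym eq) (there a)

  insert-covers : ∀ {λ′ P new tbl} → Feasible λ′ → Cover λ′ P new →
                  Any (Cover λ′ P) (⟦ insertₜ ⟧ (g ∷ V ∷ Λ ∷ P ∷ new ∷ tbl ∷ []))
  insert-covers {λ′} {P} {new} {tbl} F c with insert-spec g V Λ P new tbl
  ... | inj₁ (a , eq) = subst (Any _) (sym eq) (Any.map (λ d → cover-dominated F d c) a)
  ... | inj₂ (_ , eq) = subst (Any _) (sym eq) (here c)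

  extended : ℕ → Val Scored → Lab → Val Scored
  extended u x l = ite (proj₁ l) (proj₁ x) (suc (proj₁ x)) , (u , l) ∷ proj₂ x

  extended-wf : ∀ {P x u l} → WF P x → l ∈ Λ → Ok g (proj₂ x) (u , l) → WF (u ∷ P) (extended u x l)
  extended-wf {u = u} {l} (wf refl refl c λs st) l∈ o = wf refl refl (o ∷ c) (l∈ ∷ λs) (there st)

  tryᶠ : List ℕ → ℕ → Val Scored → Lab → Val (L Scored) → Val (L Scored)
  tryᶠ P u x l tbl = ⟦ tryₜ ⟧ (g ∷ V ∷ Λ ∷ P ∷ u ∷ x ∷ l ∷ tbl ∷ [])

  opaque
   unfolding tryₜ
   try-table : ∀ {P u x l tbl} → WF P x → l ∈ Λ → Table (u ∷ P) tbl → Table (u ∷ P) (tryᶠ P u x l tbl)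
   try-table {P} {u} {x} {l} w l∈ t
     with ⟦ okₜ ⟧ (g ∷ proj₂ x ∷ (u , l) ∷ []) | ok-reflects g (proj₂ x) (u , l)
   ... | true  | ofʸ o = insert-table (extended-wf w l∈ o) t
   ... | false | ofⁿ _ = t

   try-keeps : ∀ {P u x l tbl} {Q : Val Scored → Set} → Any Q tbl → Any Q (tryᶠ P u x l tbl)
   try-keeps {P} {u} {x} {l} {tbl} a with ⟦ okₜ ⟧ (g ∷ proj₂ x ∷ (u , l) ∷ [])
   ... | true  = insert-keeps {new = extended u x l} a
   ... | false = a

   try-covers : ∀ {λ′ P u x tbl} → Feasible λ′ → u ∈ V → u ∉ P → Cover λ′ P x →
                Any (Cover λ′ (u ∷ P)) (tryᶠ P u x (λ′ u) tbl)
   try-covers {λ′} {P} {u} {x} {tbl} F u∈V u∉P (sc , oks)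
     with ⟦ okₜ ⟧ (g ∷ proj₂ x ∷ (u , λ′ u) ∷ []) | ok-reflects g (proj₂ x) (u , λ′ u)
   ... | false | ofⁿ ¬o = ⊥-elim (¬o (oks u∈V u∉P))
   ... | true  | ofʸ _  = insert-covers {new = extended u x (λ′ u)} {tbl} F (more (proj₁ (λ′ u)) sc , λ {w} w∈V w∉ →
       Feasible.consistent F u∈V w∈V (λ { refl → w∉ (here refl) }) ∷ oks w∈V (w∉ ∘ there))
     where
     more : ∀ b {m n} → m ≤ n → ite b m (suc m) ≤ ite b n (suc n)
     more true  le = le
     more false le = s≤s le

  innerᶠ : List ℕ → ℕ → Val (L Scored) → Val Scored → Val (L Scored)
  innerᶠ P u acc x = foldl (λ acc′ l → tryᶠ P u x l acc′) acc Λ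

  inner-table : ∀ {P u x tbl} → WF P x → Table (u ∷ P) tbl → Table (u ∷ P) (innerᶠ P u tbl x)
  inner-table w t = foldl-inv (Table _) (λ l∈ t′ → try-table w l∈ t′) t

  extendᶠ : List ℕ → ℕ → Val (L Scored) → Val (L Scored)
  extendᶠ P u tbl = ⟦ extendₜ ⟧ (g ∷ V ∷ Λ ∷ P ∷ u ∷ tbl ∷ [])

  opaque
   unfolding extendₜ
   extend-table : ∀ {P u tbl} → Table P tbl → Table (u ∷ P) (extendᶠ P u tbl)
   extend-table {P} {u} {tbl} (ws , _) =
     foldl-inv (Table (u ∷ P)) {f = innerᶠ P u} (λ x∈ t → inner-table (All.lookup ws x∈) t) ([] , [])

   extend-covers : ∀ {λ′ P u tbl} → Feasible λ′ → u ∈ V → u ∉ P → Any (Cover λ′ P) tbl →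
                   Any (Cover λ′ (u ∷ P)) (extendᶠ P u tbl)
   extend-covers {λ′} {P} {u} {tbl} F u∈V u∉P a with find a
   ... | x , x∈ , c = foldl-hit (λ _ → ⊤) (Any (Cover λ′ (u ∷ P))) {f = innerᶠ P u} (λ _ _ → tt)
     (λ {_} {y} _ _ q → foldl-inv (Any (Cover λ′ (u ∷ P))) {xs = Λ} (λ {acc} {l} _ q′ → try-keeps {P} {u} {y} {l} {acc} q′) q)
     x∈ (λ _ → foldl-hit (λ _ → ⊤) (Any (Cover λ′ (u ∷ P))) (λ _ _ → tt)
           (λ {acc} {l} _ _ q → try-keeps {P} {u} {x} {l} {acc} q) (Feasible.inΛ F u)
           (λ {acc} _ → try-covers {tbl = acc} F u∈V u∉P c) tt)
     tt

  -- The order of processing and what it leaves open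

  record Frontier (P : List ℕ) : Set where
    constructor frontier
    field
      modulator-first : ∀ {x w} → x ∈ V → x ∉ P → InX x → w ∈ P → ¬ Inner w
      {centre}        : ℕ
      only-centre     : ∀ {w v} → w ∈ P → v ∈ V → v ∉ P → Inner w → Inner v → adj g w v ≡ true →
                        w ≡ centre

  record Processed (P : List ℕ) : Set where
    constructor processed
    field
      unique   : Unique P
      inV      : All (_∈ V) P
      s∈P      : s ∈ P
      boundary : Frontier P

  -- The form in which the stars enter the dynamic program: outside X there is neither a path on
  -- four vertices nor, with `d` equal to `a`, a triangle.
  PathFree : Set
  PathFree = ∀ {a b c d} → a ∈ V → b ∈ V → c ∈ V → d ∈ V →
             ¬ InX a → ¬ InX b → ¬ InX c → ¬ InX d →
             adj g a b ≡ true → adj g b c ≡ true → adj g c d ≡ true → a ≡ c ⊎ b ≡ d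

  module _ (path-free : PathFree) where

    -- If nothing was preferred, no earlier inner vertex has unprocessed neighbours, and `u` becomes
    -- the centre. If `u` lies in X, the centre stays. Otherwise `u` is a neighbour of the centre,
    -- and only one of the two can have further inner neighbours, for else there would be a path on
    -- four vertices.
    frontier-step : ∀ {P u} → Processed P → u ∈ V → u ∉ P →
      (Preferred g X s P u ⊎ All (λ v → v ∉ P → ¬ Preferred g X s P v) V) → Frontier (u ∷ P)
    frontier-step {P} {u} (processed _ inV s∈P (frontier first {c} only)) u∈V u∉P pref =
      frontier first′ (proj₂ (only′ pref))
      where
      u≢s : u ≢ s
      u≢s refl = u∉P s∈P
      uncovered : ∀ {x} → x ∈ V → x ∉ u ∷ P → InX x → ¬ InX u →
        ¬ (Preferred g X s P u ⊎ All (λ v → v ∉ P → ¬ Preferred g X s P v) V)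
      uncovered x∈V x∉ mx ¬mu (inj₁ (inj₁ mu)) = ¬mu mu
      uncovered x∈V x∉ mx ¬mu (inj₁ (inj₂ a)) with find a
      ... | w , w∈ , ¬mw , w≢s , _ = first x∈V (x∉ ∘ there) mx w∈ (¬mw , w≢s)
      uncovered x∈V x∉ mx ¬mu (inj₂ nope) = All.lookup nope x∈V (x∉ ∘ there) (inj₁ mx)
      first′ : ∀ {x w} → x ∈ V → x ∉ u ∷ P → InX x → w ∈ u ∷ P → ¬ Inner w
      first′ x∈V x∉ mx (there w∈) iw = first x∈V (x∉ ∘ there) mx w∈ iw
      first′ x∈V x∉ mx (here refl) (¬mu , _) = uncovered x∈V x∉ mx ¬mu pref
      Only : ℕ → Set
      Only c = ∀ {w v} → w ∈ u ∷ P → v ∈ V → v ∉ u ∷ P → Inner w → Inner v → adj g w v ≡ true → w ≡ c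
      more? : Dec (Any (λ v → v ∉ u ∷ P × ¬ InX v × adj g c v ≡ true) V)
      more? = Any.any? (λ v → ¬? (member? _≟_ v (u ∷ P)) ×-dec (¬? (InX? v) ×-dec (adj g c v Bool.≟ true))) V
      only′ : Preferred g X s P u ⊎ All (λ v → v ∉ P → ¬ Preferred g X s P v) V → Σ[ c ∈ ℕ ] Only c
      only′ pref with pref | InX? u
      ... | inj₂ nope | _ = u , λ where
        (here refl) _ _ _ _ _ → refl
        (there w∈) v∈V v∉ (¬mw , w≢s) _ a →
          ⊥-elim (All.lookup nope v∈V (v∉ ∘ there) (inj₂ (lose w∈ (¬mw , w≢s , a))))
      ... | inj₁ _ | yes mu = c , λ where
        (here refl) _ _ (¬mu , _) _ _ → ⊥-elim (¬mu mu)
        (there w∈) v∈V v∉ iw iv a → only w∈ v∈V (v∉ ∘ there) iw iv a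
      ... | inj₁ (inj₁ mu) | no ¬mu = ⊥-elim (¬mu mu)
      ... | inj₁ (inj₂ a) | no ¬mu with find a
      ...   | w₀ , w₀∈ , ¬mw₀ , w₀≢s , a₀ with only w₀∈ u∈V u∉P (¬mw₀ , w₀≢s) (¬mu , u≢s) a₀ | more?
      ...     | refl | no ¬more = u , λ where
        (here refl) _ _ _ _ _ → refl
        (there w∈) v∈V v∉ iw iv a → ⊥-elim (¬more (lose v∈V
          (v∉ , proj₁ iv , subst (λ z → adj g z _ ≡ true) (only w∈ v∈V (v∉ ∘ there) iw iv a) a)))
      ...     | refl | yes some with find some
      ...       | v₀ , v₀∈V , v₀∉ , ¬mv₀ , av₀ = c , λ where
        (there w∈) v∈V v∉ iw iv a → only w∈ v∈V (v∉ ∘ there) iw iv a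
        (here refl) v∈V v∉ iw (¬mv , _) a →
          -- The forbidden path leads from `v₀` through the old centre and `u` to `v`.
          let c∈V = All.lookup inV w₀∈ in
          ⊥-elim ([ (λ { refl → v₀∉ (here refl) }) , (λ { refl → v∉ (there w₀∈) }) ]′
            (path-free v₀∈V c∈V u∈V v∈V ¬mv₀ ¬mw₀ ¬mu ¬mv (adj-sym c∈V v₀∈V av₀) a₀ a))

  -- Two entries that agree on X, on the centre and on the set of labels in
  -- use cannot be told apart by unprocessed vertices.
  Xs : List ℕ
  Xs = filter InX? V

  _≟ₗ_ : (l l′ : Lab) → Dec (l ≡ l′)
  _≟ₗ_ = ≡-dec Bool._≟_ (≡-dec Bool._≟_ _≟_)

  _≟ₚ_ : (p q : ℕ × Lab) → Dec (p ≡ q)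
  _≟ₚ_ = ≡-dec _≟_ _≟ₗ_

  code : ℕ → Val Entry → List Bool
  code c e = map (λ p → does (member? _≟ₚ_ p e)) (cartesianProduct (c ∷ Xs) Λ) ++
             map (λ l → does (member? _≟ₗ_ l (map proj₂ e))) Λ

  codeLength : ℕ
  codeLength = (suc (length Xs)) * length Λ + length Λ

  length-code : ∀ c e → length (code c e) ≡ codeLength
  length-code c e = trans (length-++ (map _ (cartesianProduct (c ∷ Xs) Λ)))
    (cong₂ _+_ (trans (length-map _ (cartesianProduct (c ∷ Xs) Λ)) (length-cartesianProduct (c ∷ Xs) Λ))
               (length-map _ Λ))

  does⇒ : ∀ {A C : Set} {p : Dec A} {q : Dec C} → does p ≡ does q → A → C
  does⇒ {p = yes _} {q = yes c} _ _ = c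
  does⇒ {p = no ¬a} _ a = ⊥-elim (¬a a)

  module _ {P e e′} (pr : Processed P) {x x′} (w : WF P (x , e)) (w′ : WF P (x′ , e′)) where
    open Processed pr
    open Frontier boundary

    -- A clash shows in the bits for labels in use, whichever vertex carries the label. An edge from
    -- a processed vertex to `v` starts in X, at s or at the centre, and there both entries have the
    -- same label.
    ok-transfer : code centre e′ ≡ code centre e → ∀ {v l} → v ∈ V → v ∉ P →
                  Ok g e (v , l) → Ok g e′ (v , l)
    ok-transfer eq {v} {l} v∈V v∉P o = All.tabulate λ {p} p∈ →
      let l∈ = All.lookup (WF.labelled w′) p∈ in compatible (clash l∈ p∈) (edge l∈ p∈)
      where
      split = ++-≡⇒ {as = map _ (cartesianProduct (centre ∷ Xs) Λ)} (trans (length-map _ (cartesianProduct (centre ∷ Xs) Λ))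
                           (sym (length-map _ (cartesianProduct (centre ∷ Xs) Λ)))) eq
      clash : ∀ {u l′} → l′ ∈ Λ → (u , l′) ∈ e′ → ¬ Clash l′ l
      clash {u} {l′} l∈ p∈ cl with ∈-map⁻ proj₂ (does⇒ {p = member? _≟ₗ_ l′ (map proj₂ e′)} {q = member? _≟ₗ_ l′ (map proj₂ e)} (map-≡⇒ (proj₂ split) l∈) (∈-map⁺ proj₂ p∈))
      ... | (u₁ , _) , p∈e , refl = Compat.no-clash (All.lookup o p∈e) cl
      via : ∀ {u l′} → l′ ∈ Λ → u ∈ centre ∷ Xs → (u , l′) ∈ e′ → adj g u v ≡ true →
            Closed l′ l × Closed l l′
      via {u} {l′} l∈ u∈ p∈ a = Compat.closed (All.lookup o
        (does⇒ {p = member? _≟ₚ_ (u , l′) e′} {q = member? _≟ₚ_ (u , l′) e}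
          (map-≡⇒ (proj₁ split) (∈-cartesianProduct⁺ u∈ l∈)) p∈)) a
      edge : ∀ {u l′} → l′ ∈ Λ → (u , l′) ∈ e′ → adj g u v ≡ true → Closed l′ l × Closed l l′
      edge {u} {l′} l∈ p∈ a with subst (u ∈_) (WF.covers w′) (∈-map⁺ proj₁ p∈)
      ... | u∈P with InX? u | u ≟ s | InX? v
      ...   | yes mu | _ | _ = via l∈ (there (∈-filter⁺ InX? (All.lookup inV u∈P) mu)) p∈ a
      ...   | no _ | yes refl | _ =
        Compat.closed (All.lookup o (subst (λ l → (s , l) ∈ e)
          (domain-unique (subst Unique (sym (WF.covers w′)) unique) (WF.has-start w′) p∈) (WF.has-start w))) a
      ...   | no ¬mu | no u≢s | yes mv = ⊥-elim (modulator-first v∈V v∉P mv u∈P (¬mu , u≢s))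
      ...   | no ¬mu | no u≢s | no ¬mv =
        via l∈ (here (only-centre u∈P v∈V v∉P (¬mu , u≢s) (¬mv , λ { refl → v∉P s∈P }) a)) p∈ a

  code⇒key : ∀ {P} (pr : Processed P) {x y} → WF P x → WF P y →
    let c = Frontier.centre (Processed.boundary pr) in
    code c (proj₂ x) ≡ code c (proj₂ y) → Key g V Λ P (proj₂ x) (proj₂ y)
  code⇒key {P} pr {x} {y} wx wy eq = All.tabulate λ {v} v∈V → decide v∈V (member? _≟_ v P)
    where
    both : ∀ {a b} {A C : Set} → Reflects A a → Reflects C b → (A → C) → (C → A) → a ≡ b
    both (ofʸ _) (ofʸ _)  f h = refl
    both (ofʸ a) (ofⁿ ¬c) f h = ⊥-elim (¬c (f a))
    both (ofⁿ ¬a) (ofʸ c) f h = ⊥-elim (¬a (h c))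
    both (ofⁿ _) (ofⁿ _)  f h = refl
    decide : ∀ {v} → v ∈ V → Dec (v ∈ P) → v ∈ P ⊎ All (λ l → ok g (proj₂ x) (v , l) ≡ ok g (proj₂ y) (v , l)) Λ
    decide v∈V (yes v∈P) = inj₁ v∈P
    decide {v} v∈V (no v∉P) = inj₂ (All.universal (λ l → both (ok-reflects g _ _) (ok-reflects g _ _)
      (ok-transfer pr wx wy (sym eq) v∈V v∉P) (ok-transfer pr wy wx eq v∈V v∉P)) Λ)

  -- The size of the table

  capacity : ℕ
  capacity = 2 ^ codeLength * suc (length V)

  processed-length : ∀ {P} → Processed P → length P ≤ length V
  processed-length pr = unique⊆⇒length≤ (Processed.unique pr) (Processed.inV pr)

  entry-length : ∀ {P x} → Processed P → WF P x → length (proj₂ x) ≤ length V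
  entry-length {P} {x} pr w = ≤-trans (≤-reflexive (trans (sym (length-map proj₁ (proj₂ x))) (cong length (WF.covers w)))) (processed-length pr)

  -- Code and score together identify an entry: equal codes give equal keys, and of two entries with
  -- equal key and score the newer would have been rejected.
  table-length : ∀ {P tbl} → Processed P → Table P tbl → length tbl ≤ capacity
  table-length {P} {tbl} pr (ws , sep) = begin
    length tbl                       ≡⟨ length-map tag tbl ⟨
    length (map tag tbl)             ≤⟨ unique⊆⇒length≤ (AllPairs.map⁺ (distinct ws sep)) (All.map⁺ (All.map listed ws)) ⟩
    length (cartesianProduct (bits codeLength) (upTo (suc (length V))))
      ≡⟨ length-cartesianProduct (bits codeLength) (upTo (suc (length V))) ⟩
    length (bits codeLength) * length (upTo (suc (length V)))
      ≡⟨ cong₂ _*_ (length-bits codeLength) (length-upTo (suc (length V))) ⟩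
    capacity ∎
    where
    open ≤-Reasoning
    c = Frontier.centre (Processed.boundary pr)
    tag : Val Scored → List Bool × ℕ
    tag x = code c (proj₂ x) , proj₁ x
    listed : ∀ {x} → WF P x → tag x ∈ cartesianProduct (bits codeLength) (upTo (suc (length V)))
    listed {x} w = ∈-cartesianProduct⁺ (∈-bits _ (length-code c (proj₂ x)))
      (∈-upTo⁺ (s≤s (≤-trans (≤-reflexive (WF.scored w)) (≤-trans (score≤length (proj₂ x)) (entry-length pr w)))))
    separate : ∀ {x y} → WF P x → WF P y → ¬ Dominates g V Λ P x y → tag x ≢ tag y
    separate {x} {y} wx wy ¬d eq =
      ¬d (dominates (code⇒key pr wy wx (sym (cong proj₁ eq))) (≤-reflexive (cong proj₂ eq)))
    distinct : ∀ {xs} → All (WF P) xs → AllPairs (λ x y → ¬ Dominates g V Λ P x y) xs →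
               AllPairs (λ x y → tag x ≢ tag y) xs
    distinct []       []       = []
    distinct (w ∷ ws) (d ∷ ds) = All.zipWith (λ (w′ , ¬d) → separate w w′ ¬d) (ws , d) ∷ distinct ws ds

  record Invariant (st : Val State) : Set where
    constructor invariant
    field
      proc  : Processed (proj₁ st)
      table : Table (proj₁ st) (proj₂ st)
      cover : ∀ {λ′} → Feasible λ′ → Any (Cover λ′ (proj₁ st)) (proj₂ st)

  module _ (path-free : PathFree) where

    grow : ∀ {P u} → Processed P → u ∈ V → u ∉ P →
      (Preferred g X s P u ⊎ All (λ v → v ∉ P → ¬ Preferred g X s P v) V) → Processed (u ∷ P)
    grow pr u∈V u∉P pref = processed (All.¬Any⇒All¬ _ u∉P ∷ Processed.unique pr)
      (u∈V ∷ Processed.inV pr) (there (Processed.s∈P pr)) (frontier-step path-free pr u∈V u∉P pref)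

    roundᶠ : Val State → Val State
    roundᶠ st = ⟦ roundₜ ⟧ (g ∷ V ∷ Λ ∷ X ∷ s ∷ st ∷ [])

    -- Each round adds a vertex or finds none left. With one round per vertex, starting from the
    -- list of s alone, the second alternative ends up exceeding the number of vertices.
    record Progress (m : ℕ) (st : Val State) : Set where
      constructor progress
      field
        inv  : Invariant st
        full : All (_∈ proj₁ st) V ⊎ m ≤ length (proj₁ st)

    opaque
      unfolding roundₜ
      round-progress : ∀ {m st} → Progress m st → Progress (suc m) (roundᶠ st)
      round-progress {m} {P , tbl} (progress inv full) with ⟦ nextₜ ⟧ (g ∷ V ∷ X ∷ s ∷ P ∷ []) | next-spec g V X s P
      ... | _ | finished all = progress inv (inj₁ all)
      ... | _ | chosen u∈V u∉P pref =
        progress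
          (invariant (grow proc u∈V u∉P pref) (extend-table table) (λ F → extend-covers F u∈V u∉P (cover F)))
          (inj₂ (s≤s ([ (λ all → ⊥-elim (u∉P (All.lookup all u∈V))) , id ]′ full)))
        where open Invariant inv

    start : Val State
    start = s ∷ [] , (0 , (s , burn 0) ∷ []) ∷ []

    start-invariant : Invariant start
    start-invariant = invariant
      (processed ([] ∷ []) (s∈V ∷ []) (here refl) (frontier
        (λ { _ _ _ (here refl) (_ , s≢s) → s≢s refl })
        {s} (λ { (here refl) _ _ (_ , s≢s) _ _ → ⊥-elim (s≢s refl) })))
      (wf refl refl ([] ∷ []) (start∈Λ ∷ []) (here refl) ∷ [] , [] ∷ [])
      λ {λ′} F → here (≤-reflexive (cong (λ l → ite (proj₁ l) 0 1) (Feasible.source F)) ,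
        λ {w} w∈V w∉ → subst (λ l → Compat g (s , l) (w , λ′ w)) (Feasible.source F)
          (Feasible.consistent F s∈V w∈V (λ { refl → w∉ (here refl) })) ∷ [])

    tableᶠ : Val State
    tableᶠ = ⟦ tableₜ ⟧ (g ∷ V ∷ Λ ∷ X ∷ s ∷ [])

    opaque
      unfolding tableₜ
      table-progress : Progress (suc (length V)) tableᶠ
      table-progress = subst (λ m → Progress m tableᶠ) (+-comm (length V) 1)
        (go V start (progress start-invariant (inj₂ ≤-refl)))
        where
        go : ∀ (xs : List ℕ) {m} st → Progress m st → Progress (length xs + m) (foldl (λ st _ → roundᶠ st) st xs)
        go []       st p = p
        go (x ∷ xs) {m} st p =
          subst (λ j → Progress j (foldl (λ st _ → roundᶠ st) (roundᶠ st) xs)) (+-suc (length xs) m)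
            (go xs {suc m} (roundᶠ st) (round-progress p))

    record Solution (P : List ℕ) (x : Val Scored) : Set where
      constructor solution
      field
        well-formed : WF P x
        proc        : Processed P
        complete    : All (_∈ P) V
        optimal     : ∀ {λ′} → Feasible λ′ → score (restrict λ′ P) ≤ score (proj₂ x)

    -- A labelling that exists in every instance, so the final table cannot be empty.
    all-burn : Feasible (λ _ → burn 0)
    all-burn = feasible
      (λ _ _ _ → compatible (λ ((¬b , _) , _) → ¬b refl) (λ _ → (λ _ → inj₁ refl , z≤n) , λ _ → inj₁ refl , z≤n))
      refl (λ _ → start∈Λ)

    best-solution : Solution (proj₁ tableᶠ) (⟦ bestₜ ⟧ (proj₂ tableᶠ ∷ []))
    best-solution with tableᶠ | table-progress
    ... | P , [] | progress (invariant _ _ cover) _ with () ← cover all-burn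
    ... | P , x ∷ xs | progress (invariant proc (ws , sep) cover) full = solution w proc complete λ F → let (y , y∈ , sc , _) = find (cover F) in
        ≤-trans sc (≤-trans (All.lookup (proj₂ best) y∈) (≤-reflexive (WF.scored w)))
      where
      best = best-spec x xs
      w = All.lookup ws (proj₁ best)
      complete : All (_∈ P) V
      complete = [ id , (λ lt → ⊥-elim (<-irrefl refl (≤-trans lt (processed-length proc)))) ]′ full

  -- Safety of the dynamic program

  module Bounds (M : ℕ) (cap : capacity ≤ M) (V≤ : Bnd (L N) M V) (Λ≤ : Bnd (L Label) M Λ)
                (g≤ : Bnd Matrix M g) (X≤ : Bnd (L 𝔹) M X) where

    vertex≤ : ∀ {v} → v ∈ V → v ≤ M
    vertex≤ = All.lookup (proj₂ V≤)

    processed≤ : ∀ {P} → Processed P → Bnd (L N) M P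
    processed≤ pr = ≤-trans (processed-length pr) (proj₁ V≤) , All.map vertex≤ (Processed.inV pr)

    scored≤ : ∀ {P x} → Processed P → WF P x → Bnd Scored M x
    scored≤ {P} {x} pr w =
      ≤-trans (≤-reflexive (WF.scored w)) (≤-trans (score≤length (proj₂ x)) len≤) , len≤ ,
      All.tabulate λ {p} p∈ →
        vertex≤ (All.lookup (Processed.inV pr) (subst (proj₁ p ∈_) (WF.covers w) (∈-map⁺ proj₁ p∈))) ,
        All.lookup (proj₂ Λ≤) (All.lookup (WF.labelled w) p∈)
      where
      len≤ : length (proj₂ x) ≤ M
      len≤ = ≤-trans (entry-length pr w) (proj₁ V≤)

    table≤ : ∀ {P tbl} → Processed P → Table P tbl → Bnd (L Scored) M tbl
    table≤ pr t = ≤-trans (table-length pr t) cap , All.map (scored≤ pr) (proj₁ t)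

    ite-both : ∀ {A C : Set} b → A → C → ite b A C
    ite-both true  a c = a
    ite-both false a c = c

    opaque
      unfolding insertₜ keyₜ memₜ eqₜ leₜ subₜ okₜ compatₜ adjₜ nthₜ closedₜ clashₜ
      -- `insertₜ` may lengthen the table, which `Free` forbids, so only its test is treated as
      -- free. That the table stays short is supplied by the counting of codes.
      insert-safe : ∀ {P new tbl} → Bnd (L N) M P → Bnd Scored M new → Bnd (L Scored) M tbl →
                    Safe M insertₜ (g ∷ V ∷ Λ ∷ P ∷ new ∷ tbl ∷ [])
      insert-safe {P} {new} {tbl} P≤ new≤ tbl≤ =
        proj₁ (free-bounded (anyₜ x₅ (call keyₜ (x₂ ∷ x₃ ∷ x₄ ∷ x₅ ∷ sndₜ x₀ ∷ sndₜ x₆ ∷ []) ∧ₜ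
                 call leₜ (fstₜ x₆ ∷ fstₜ x₀ ∷ []))) {g ∷ V ∷ Λ ∷ P ∷ new ∷ tbl ∷ []} _
                 (g≤ , V≤ , Λ≤ , P≤ , new≤ , tbl≤ , tt)) ,
        ite-both (⟦ anyₜ x₅ (call keyₜ (x₂ ∷ x₃ ∷ x₄ ∷ x₅ ∷ sndₜ x₀ ∷ sndₜ x₆ ∷ []) ∧ₜ
                 call leₜ (fstₜ x₆ ∷ fstₜ x₀ ∷ [])) ⟧ (g ∷ V ∷ Λ ∷ P ∷ new ∷ tbl ∷ [])) tt (tt , tt)

    opaque
      unfolding okₜ compatₜ adjₜ nthₜ closedₜ clashₜ eqₜ leₜ subₜ
      ok-free : Free okₜ
      ok-free = _

    opaque
      unfolding tryₜ
      try-safe : ∀ {P u x l tbl} → Processed P → Processed (u ∷ P) → WF P x → l ∈ Λ →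
                 Table (u ∷ P) tbl → Safe M tryₜ (g ∷ V ∷ Λ ∷ P ∷ u ∷ x ∷ l ∷ tbl ∷ [])
      try-safe {P} {u} {x} {l} {tbl} pr pr′ w l∈ t =
        proj₁ (free-bounded (call okₜ (x₀ ∷ sndₜ x₅ ∷ (x₄ ,ₜ x₆) ∷ []))
                            {g ∷ V ∷ Λ ∷ P ∷ u ∷ x ∷ l ∷ tbl ∷ []} (_ , ok-free) (g≤ , V≤ , Λ≤ , processed≤ pr , u≤ , scored≤ pr w ,
                                All.lookup (proj₂ Λ≤) l∈ , table≤ pr′ t , tt)) ,
        branch (ok-reflects g (proj₂ x) (u , l))
        where
        u≤ : u ≤ M
        u≤ = vertex≤ (All.head (Processed.inV pr′))
        branch : ∀ {b} → Reflects (Ok g (proj₂ x) (u , l)) b → ite b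
          ((⊤ × ⊤ × ⊤ × (⊤ × ⊤) × ((⊤ × ite (proj₁ l) ⊤ ⊤) × (⊤ × ⊤) × ⊤) × ⊤ × ⊤) ×
            Safe M insertₜ (g ∷ V ∷ Λ ∷ (u ∷ P) ∷ extended u x l ∷ tbl ∷ [])) ⊤
        branch (ofʸ o) = (tt , tt , tt , (tt , tt) , ((tt , ite-both (proj₁ l) tt tt) , (tt , tt) , tt) , tt , tt) ,
          insert-safe (processed≤ pr′) (scored≤ pr′ (extended-wf w l∈ o)) (table≤ pr′ t)
        branch (ofⁿ _) = tt

    opaque
      unfolding extendₜ
      extend-safe : ∀ {P u tbl} → Processed P → Processed (u ∷ P) → Table P tbl →
                    Safe M extendₜ (g ∷ V ∷ Λ ∷ P ∷ u ∷ tbl ∷ [])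
      extend-safe {P} {u} {tbl} pr pr′ t = tt , tt , proj₁ (table≤ pr t) ,
        proj₁ (along-inv (Table (u ∷ P)) {Q = WF P}
          (λ {x} {acc} w t′ →
            (tt , tt , proj₁ Λ≤ ,
             proj₁ (along-inv (Table (u ∷ P)) {Q = _∈ Λ}
               (λ l∈ t″ → (_ , try-safe pr pr′ w l∈ t″) , try-table w l∈ t″) (All.tabulate id) t′)) ,
            inner-table w t′)
          (proj₁ t) ([] , []))

    opaque
      unfolding nextₜ preferredₜ memₜ eqₜ leₜ subₜ adjₜ nthₜ
      next-free : Free nextₜ
      next-free = _

    opaque
      unfolding bestₜ leₜ subₜ
      best-free : Free bestₜ
      best-free = _

    module _ (path-free : PathFree) where
      opaque
        unfolding roundₜ
        round-safe : ∀ {st} → Invariant st → Safe M roundₜ (g ∷ V ∷ Λ ∷ X ∷ s ∷ st ∷ [])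
        round-safe {P , tbl} (invariant pr t _) =
          (_ , proj₁ (free-bounded nextₜ next-free (g≤ , V≤ , X≤ , vertex≤ s∈V , processed≤ pr , tt))) ,
          tt , branch (next-spec g V X s P)
          where
          branch : ∀ {r} → Next g V X s P r → ite (proj₁ r)
            ((⊤ × ⊤) × ((⊤ × ⊤ × ⊤ × ⊤ × ⊤ × ⊤ × ⊤) ×
              Safe M extendₜ (g ∷ V ∷ Λ ∷ P ∷ proj₂ r ∷ tbl ∷ []))) ⊤
          branch (finished _) = tt
          branch (chosen u∈V u∉P pref) = _ , _ , extend-safe pr (grow path-free pr u∈V u∉P pref) t

      opaque
        unfolding tableₜ
        table-safe : Safe M tableₜ (g ∷ V ∷ Λ ∷ X ∷ s ∷ [])
        table-safe = tt , _ , proj₁ V≤ ,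
          proj₁ (along-inv Invariant {Q = λ _ → ⊤} (λ _ inv → (_ , round-safe inv) ,
            Progress.inv (round-progress path-free {0} (progress inv (inj₂ z≤n)))) (All.universal (λ _ → tt) V) (start-invariant path-free))

-- Spread of the fire

x∈p─q⇒x∉q : ∀ {n x} {p q : Subset n} → x Subset.∈ p ─ q → x Subset.∉ q
x∈p─q⇒x∉q {p = outside ∷ p} {inside ∷ q}  () Vec.here
x∈p─q⇒x∉q {p = inside ∷ p}  {inside ∷ q}  () Vec.here
x∈p─q⇒x∉q {p = _ ∷ p} {_ ∷ q} (Vec.there x∈) (Vec.there x∈q) = x∈p─q⇒x∉q x∈ x∈q

∈-⋃⁺ : ∀ {n x} {p : Subset n} {ps} → p ∈ ps → x Subset.∈ p → x Subset.∈ ⋃ ps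
∈-⋃⁺ {ps = p ∷ ps} (here refl) x∈ = Subset.x∈p∪q⁺ (inj₁ x∈)
∈-⋃⁺ {ps = p ∷ ps} (there p∈)  x∈ = Subset.x∈p∪q⁺ {p = p} (inj₂ (∈-⋃⁺ p∈ x∈))

∈-⋃⁻ : ∀ {n x} {ps : List (Subset n)} → x Subset.∈ ⋃ ps → ∃[ p ] p ∈ ps × x Subset.∈ p
∈-⋃⁻ {ps = []}     x∈ = ⊥-elim (Subset.∉⊥ x∈)
∈-⋃⁻ {ps = p ∷ ps} x∈ with Subset.x∈p∪q⁻ p (⋃ ps) x∈
... | inj₁ x∈p = p , here refl , x∈p
... | inj₂ x∈ps = let (q , q∈ , x∈q) = ∈-⋃⁻ x∈ps in q , there q∈ , x∈q

module Spread {n} (G : Graph n) where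

  ∈-spread⁺ : ∀ {B D u v} → u Subset.∈ B → Adjacent G u v → v Subset.∉ D → v Subset.∈ spread G B D
  ∈-spread⁺ {B} {D} {u} u∈B a v∉D = Subset.x∈p∪q⁺ {p = B} (inj₂ (Subset.x∈p∧x∉q⇒x∈p─q
    (∈-⋃⁺ (∈-map⁺ (neighbours G) (∈-filter⁺ (Subset._∈? B) (∈-allFin u) u∈B)) a) v∉D))

  ⊆-spread : ∀ {B D} → B Subset.⊆ spread G B D
  ⊆-spread {B} = Subset.p⊆p∪q {p = B} _

  ∈-spread⁻ : ∀ {B D v} → v Subset.∈ spread G B D →
              v Subset.∈ B ⊎ (v Subset.∉ D × ∃[ u ] u Subset.∈ B × Adjacent G u v)
  ∈-spread⁻ {B} {D} {v} v∈ with Subset.x∈p∪q⁻ B (neighbourhood G B ─ D) v∈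
  ... | inj₁ v∈B = inj₁ v∈B
  ... | inj₂ v∈N with ∈-⋃⁻ (Subset.p─q⊆p (neighbourhood G B) D v∈N)
  ...   | p , p∈ , v∈p with ∈-map⁻ (neighbours G) p∈
  ...     | u , u∈ , refl = inj₂ (x∈p─q⇒x∉q {p = neighbourhood G B} v∈N , u , proj₂ (∈-filter⁻ (Subset._∈? B) {xs = allFin n} u∈) , v∈p)

  Threatened : Subset n → Subset n → Fin n → Set
  Threatened B D v = v Subset.∉ B × v Subset.∉ D × ∃[ u ] u Subset.∈ B × Adjacent G u v

  threatened? : ∀ B D v → Dec (Threatened B D v)
  threatened? B D v = ¬? (v Subset.∈? B) ×-dec (¬? (v Subset.∈? D) ×-dec
    Fin.any? (λ u → (u Subset.∈? B) ×-dec (v Subset.∈? neighbours G u)))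

  threatened⇒¬stopped : ∀ {B D v} → Threatened B D v → ¬ Stopped G B D
  threatened⇒¬stopped (v∉B , v∉D , u , u∈B , a) st = v∉B (st (∈-spread⁺ u∈B a v∉D))

  unthreatened⇒stopped : ∀ {B D} → (∀ v → ¬ Threatened B D v) → Stopped G B D
  unthreatened⇒stopped {B} none {v} v∈ with v Subset.∈? B | ∈-spread⁻ v∈
  ... | yes v∈B | _ = v∈B
  ... | no v∉B | inj₁ v∈B = ⊥-elim (v∉B v∈B)
  ... | no v∉B | inj₂ (v∉D , a) = ⊥-elim (none v (v∉B , v∉D , a))

  ¬stopped⇒threatened : ∀ {B D} → ¬ Stopped G B D → ∃[ v ] Threatened B D v
  ¬stopped⇒threatened {B} {D} ¬st with Fin.any? (threatened? B D)
  ... | yes t = t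
  ... | no ¬t = ⊥-elim (¬st (unthreatened⇒stopped λ v t → ¬t (v , t)))

  -- The part of validity that bounds the length. The process need not have stopped at the end, so a
  -- simulation cut off early qualifies too.
  Running : Subset n → Subset n → List (Fin n) → Set
  Running B D []      = ⊤
  Running B D (v ∷ S) = ¬ Stopped G B D × Running (spread G B (D ∪ ⁅ v ⁆)) (D ∪ ⁅ v ⁆) S

  valid⇒running : ∀ {B D} S → ValidFrom G B D S → Running B D S
  valid⇒running []      _            = tt
  valid⇒running (v ∷ S) (¬st , _ , vf) = ¬st , valid⇒running S vf

  -- A vertex threatened after a step got its fire from one that caught
  -- fire in that very step.
  backtrack : ∀ {B D w u} → w Subset.∉ spread G B D → w Subset.∉ D → u Subset.∈ spread G B D →
              Adjacent G u w → u Subset.∉ B × u Subset.∉ D × ∃[ u′ ] u′ Subset.∈ B × Adjacent G u′ u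
  backtrack {B} {D} {w} {u} w∉B′ w∉D u∈B′ a with u Subset.∈? B | ∈-spread⁻ u∈B′
  ... | yes u∈B | _ = ⊥-elim (w∉B′ (∈-spread⁺ u∈B a w∉D))
  ... | no u∉B | inj₁ u∈B = ⊥-elim (u∉B u∈B)
  ... | no u∉B | inj₂ (u∉D , p) = u∉B , u∉D , p

  record Step (B D B′ : Subset n) : Set where
    constructor step
    field
      grows : B Subset.⊆ B′
      back  : ∀ {w u} → w Subset.∉ B′ → w Subset.∉ D → u Subset.∈ B′ → Adjacent G u w →
              u Subset.∉ B × u Subset.∉ D × ∃[ u′ ] u′ Subset.∈ B × Adjacent G u′ u

  spread-step : ∀ {B D} → Step B D (spread G B D)
  spread-step = step ⊆-spread backtrack

  -- The duration of the fire

  module _ {X : Subset n} (stars : StarsOutside G X) where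

    -- All four vertices lie in the star of `b`, and each of the three edges contains its centre.
    no-path : ∀ {a b c d} → a Subset.∉ X → b Subset.∉ X → c Subset.∉ X → d Subset.∉ X →
              Adjacent G a b → Adjacent G b c → Adjacent G c d → a ≡ c ⊎ b ≡ d
    no-path {a} {b} {c} {d} a∉ b∉ c∉ d∉ ab bc cd with stars b b∉
    ... | z , _ , star with to (star Wa Wb) ab | to (star Wb Wc) bc | to (star Wc Wd) cd
      where
      open Equivalence
      Wa = (b∉ , a∉ , symmetric G ab) ◅ ε
      Wb = ε
      Wc = (b∉ , c∉ , bc) ◅ ε
      Wd = (b∉ , c∉ , bc) ◅ (c∉ , d∉ , cd) ◅ ε
    ... | a≢b , inj₁ refl | _ , inj₁ refl | _ = ⊥-elim (a≢b refl)
    ... | _ , inj₁ refl | _ , inj₂ refl | _ = inj₁ refl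
    ... | _ , inj₂ refl | b≢c , _ | _ , inj₁ refl = ⊥-elim (b≢c refl)
    ... | _ , inj₂ refl | _ | _ , inj₂ refl = inj₂ refl

    shrink : ∀ {B B′ x} → B Subset.⊆ B′ → x Subset.∈ X → x Subset.∈ B′ → x Subset.∉ B →
             suc ∣ X ─ B′ ∣ ≤ ∣ X ─ B ∣
    shrink {B} {B′} {x} B⊆ x∈X x∈B′ x∉B = Subset.p⊂q⇒∣p∣<∣q∣
      ( (λ y∈ → Subset.x∈p∧x∉q⇒x∈p─q (Subset.p─q⊆p X B′ y∈) (x∈p─q⇒x∉q {p = X} y∈ ∘ B⊆))
      , x , Subset.x∈p∧x∉q⇒x∈p─q x∈X x∉B , λ x∈ → x∈p─q⇒x∉q {p = X} x∈ x∈B′)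

    -- Of four vertices that catch fire one after the other, one lies in X.
    chain : ∀ {B₀ B₁ B₂ B₃ B₄ D₁ D₂ D₃ D₄ w} → Step B₀ D₁ B₁ → Step B₁ D₂ B₂ → Step B₂ D₃ B₃ →
            Step B₃ D₄ B₄ → D₁ Subset.⊆ D₂ → D₂ Subset.⊆ D₃ → D₃ Subset.⊆ D₄ → Threatened B₄ D₄ w →
            suc ∣ X ─ B₄ ∣ ≤ ∣ X ─ B₀ ∣
    chain {B₀} {B₁} {B₂} {B₃} {B₄} (step m₁ k₁) (step m₂ k₂) (step m₃ k₃) (step m₄ k₄) d₁ d₂ d₃
      (w∉B₄ , w∉D₄ , u₄ , u₄∈B₄ , a₄) with k₄ w∉B₄ w∉D₄ u₄∈B₄ a₄
    ... | u₄∉B₃ , u₄∉D₄ , u₃ , u₃∈B₃ , a₃ with k₃ u₄∉B₃ (u₄∉D₄ ∘ d₃) u₃∈B₃ a₃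
    ... | u₃∉B₂ , u₃∉D₃ , u₂ , u₂∈B₂ , a₂ with k₂ u₃∉B₂ (u₃∉D₃ ∘ d₂) u₂∈B₂ a₂
    ... | u₂∉B₁ , u₂∉D₂ , u₁ , u₁∈B₁ , a₁ with k₁ u₂∉B₁ (u₂∉D₂ ∘ d₁) u₁∈B₁ a₁
    ... | u₁∉B₀ , _ = one-of (u₁ Subset.∈? X) (u₂ Subset.∈? X) (u₃ Subset.∈? X) (u₄ Subset.∈? X)
      where
      B₀⊆B₄ : B₀ Subset.⊆ B₄
      B₀⊆B₄ = m₄ ∘ m₃ ∘ m₂ ∘ m₁
      one-of : Dec (u₁ Subset.∈ X) → Dec (u₂ Subset.∈ X) → Dec (u₃ Subset.∈ X) → Dec (u₄ Subset.∈ X) →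
               suc ∣ X ─ B₄ ∣ ≤ ∣ X ─ B₀ ∣
      one-of (yes m) _ _ _ = shrink B₀⊆B₄ m (m₄ (m₃ (m₂ u₁∈B₁))) u₁∉B₀
      one-of _ (yes m) _ _ = shrink B₀⊆B₄ m (m₄ (m₃ u₂∈B₂)) (u₂∉B₁ ∘ m₁)
      one-of _ _ (yes m) _ = shrink B₀⊆B₄ m (m₄ u₃∈B₃) (u₃∉B₂ ∘ m₂ ∘ m₁)
      one-of _ _ _ (yes m) = shrink B₀⊆B₄ m u₄∈B₄ (u₄∉B₃ ∘ m₃ ∘ m₂ ∘ m₁)
      one-of (no n₁) (no n₂) (no n₃) (no n₄) =
        ⊥-elim ([ (λ { refl → u₃∉B₂ (m₂ u₁∈B₁) }) , (λ { refl → u₄∉B₃ (m₃ u₂∈B₂) }) ]′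
                (no-path n₁ n₂ n₃ n₄ a₁ a₂ a₃))

    -- Four steps after which the fire still spreads set a new vertex of X on fire, by `chain`; the
    -- summand 4 covers the last steps, at most four.
    running-length : ∀ {B D} S → Running B D S → length S ≤ 4 * ∣ X ─ B ∣ + 4
    running-length [] _ = z≤n
    running-length (_ ∷ []) _ = ≤-trans (s≤s z≤n) (m≤n+m 4 _)
    running-length (_ ∷ _ ∷ []) _ = ≤-trans (s≤s (s≤s z≤n)) (m≤n+m 4 _)
    running-length (_ ∷ _ ∷ _ ∷ []) _ = ≤-trans (s≤s (s≤s (s≤s z≤n))) (m≤n+m 4 _)
    running-length (_ ∷ _ ∷ _ ∷ _ ∷ []) _ = m≤n+m 4 _
    running-length {B₀} (v₁ ∷ v₂ ∷ v₃ ∷ v₄ ∷ v₅ ∷ S) (_ , _ , _ , _ , r) =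
      combine (running-length (v₅ ∷ S) r)
        (chain spread-step spread-step spread-step spread-step (Subset.p⊆p∪q _) (Subset.p⊆p∪q _) (Subset.p⊆p∪q _)
               (proj₂ (¬stopped⇒threatened (proj₁ r))))
      where
      rearrange : ∀ m → 4 + (4 * m + 4) ≡ 4 * suc m + 4
      rearrange = solve-∀
      combine : ∀ {l m} → l ≤ 4 * m + 4 → suc m ≤ ∣ X ─ B₀ ∣ → 4 + l ≤ 4 * ∣ X ─ B₀ ∣ + 4
      combine {l} {m} p q = ≤-trans (+-monoʳ-≤ 4 p) (≤-trans (≤-reflexive (rearrange m)) (+-monoˡ-≤ 4 (*-monoʳ-≤ 4 q)))

  -- From a strategy to a labelling

  labelFrom : ℕ → (B D : Subset n) → List (Fin n) → Fin n → Lab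
  labelFrom i B D []      v with v Subset.∈? B
  ... | yes _ = burn i
  ... | no _  = safe
  labelFrom i B D (x ∷ S) v with v Subset.∈? B | v Fin.≟ x
  ... | yes _ | _     = burn i
  ... | no _  | yes _ = def (suc i)
  ... | no _  | no _  = labelFrom (suc i) (spread G B (D ∪ ⁅ x ⁆)) (D ∪ ⁅ x ⁆) S v

  label-burning : ∀ {i B D v} S → v Subset.∈ B → labelFrom i B D S v ≡ burn i
  label-burning {B = B} {v = v} [] v∈ with v Subset.∈? B
  ... | yes _ = refl
  ... | no v∉ = ⊥-elim (v∉ v∈)
  label-burning {B = B} {v = v} (x ∷ S) v∈ with v Subset.∈? B | v Fin.≟ x
  ... | yes _ | _ = refl
  ... | no v∉ | _ = ⊥-elim (v∉ v∈)

  label-time : ∀ i B D S v → Burns (labelFrom i B D S v) → i ≤ time (labelFrom i B D S v)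
  label-time i B D [] v b with v Subset.∈? B
  ... | yes _ = ≤-refl
  label-time i B D (x ∷ S) v b with v Subset.∈? B | v Fin.≟ x
  ... | yes _ | _     = ≤-refl
  ... | no _  | no _  = ≤-trans (n≤1+n i) (label-time (suc i) _ _ S v b)

  label-def-time : ∀ i B D S v → IsDef (labelFrom i B D S v) → i < time (labelFrom i B D S v)
  label-def-time i B D [] v d with v Subset.∈? B
  ... | yes _ = ⊥-elim (proj₁ d refl)
  label-def-time i B D (x ∷ S) v d with v Subset.∈? B | v Fin.≟ x
  ... | yes _ | _     = ⊥-elim (proj₁ d refl)
  ... | no _  | yes _ = ≤-refl
  ... | no _  | no _  = ≤-trans (n≤1+n (suc i)) (label-def-time (suc i) _ _ S v d)

  -- Each step defends a single vertex, and later steps assign strictly later defence times.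
  label-clash : ∀ i B D S {u v} → u ≢ v → ¬ Clash (labelFrom i B D S u) (labelFrom i B D S v)
  label-clash i B D [] {u} {v} u≢v (d , _) with u Subset.∈? B
  ... | yes _ = proj₁ d refl
  label-clash i B D (x ∷ S) {u} {v} u≢v (d , d′ , eq) with u Subset.∈? B | u Fin.≟ x | v Subset.∈? B | v Fin.≟ x
  ... | yes _ | _ | _ | _ = proj₁ d refl
  ... | no _ | _ | yes _ | _ = proj₁ d′ refl
  ... | no _ | yes refl | no _ | yes refl = u≢v refl
  ... | no _ | yes _ | no _ | no _ = <⇒≢ (label-def-time (suc i) _ _ S v d′) eq
  ... | no _ | no _ | no _ | yes _ = <⇒≢ (label-def-time (suc i) _ _ S u d) (sym eq)
  ... | no _ | no _ | no _ | no _ = label-clash (suc i) _ _ S u≢v (d , d′ , eq)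

  ∉-∪-⁅⁆ : ∀ {D : Subset n} {v x} → v Subset.∉ D → v ≢ x → v Subset.∉ D ∪ ⁅ x ⁆
  ∉-∪-⁅⁆ {D} {v} {x} v∉D v≢x v∈ = [ v∉D , v≢x ∘ Subset.x∈⁅y⁆⇒x≡y x ]′ (Subset.x∈p∪q⁻ D ⁅ x ⁆ v∈)

  -- A vertex of `D` would have received its label in an earlier step. At the end of `S`, the
  -- stopped process has set every undefended neighbour of the fire alight.
  label-closed : ∀ i B D S {u v} → Adjacent G u v → v Subset.∉ D → ValidFrom G B D S →
                 Closed (labelFrom i B D S u) (labelFrom i B D S v)
  label-closed i B D [] {u} {v} a v∉D st b with u Subset.∈? B | v Subset.∈? B
  ... | yes u∈ | yes _ = inj₁ refl , pred[n]≤n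
  ... | yes u∈ | no v∉ = ⊥-elim (v∉ (st (∈-spread⁺ u∈ a v∉D)))
  label-closed i B D (x ∷ S) {u} {v} a v∉D (_ , _ , vf) b
    with u Subset.∈? B | u Fin.≟ x | v Subset.∈? B | v Fin.≟ x
  ... | yes _  | _     | yes _ | _     = inj₁ refl , pred[n]≤n
  ... | yes _  | _     | no _  | yes _ = inj₂ refl , ≤-refl
  ... | yes u∈ | _     | no _  | no v≢x
    rewrite label-burning {suc i} {D = D ∪ ⁅ x ⁆} S (∈-spread⁺ u∈ a (∉-∪-⁅⁆ v∉D v≢x)) = inj₁ refl , ≤-refl
  ... | no _   | no _  | yes _ | _     =
    inj₁ refl , ≤-trans pred[n]≤n (≤-trans (n≤1+n i) (label-time (suc i) _ _ S u b))
  ... | no _   | no _  | no _  | yes _ = inj₂ refl , ≤-trans (n≤1+n i) (label-time (suc i) _ _ S u b)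
  ... | no _   | no _  | no _  | no v≢x = label-closed (suc i) _ _ S a (∉-∪-⁅⁆ v∉D v≢x) vf b

  label-burned : ∀ i B D S v → Burns (labelFrom i B D S v) → v Subset.∈ burnedFrom G B D S
  label-burned i B D [] v b with v Subset.∈? B
  ... | yes v∈ = v∈
  label-burned i B D (x ∷ S) v b with v Subset.∈? B | v Fin.≟ x
  ... | yes v∈ | _    = burned-mono S (⊆-spread v∈)
    where
    burned-mono : ∀ {B D} S → B Subset.⊆ burnedFrom G B D S
    burned-mono []      v∈ = v∈
    burned-mono (x ∷ S) v∈ = burned-mono S (⊆-spread v∈)
  ... | no _   | no _ = label-burned (suc i) _ _ S v b

  data InRange (m : ℕ) : Lab → Set where
    burns    : ∀ {j} → j ≤ m → InRange m (burn j)
    defended : ∀ {j} → suc j ≤ m → InRange m (def (suc j))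
    spared   : InRange m safe

  label-range : ∀ i B D S v {m} → i + length S ≤ m → InRange m (labelFrom i B D S v)
  label-range i B D [] v le with v Subset.∈? B
  ... | yes _ = burns (≤-trans (m≤m+n i 0) le)
  ... | no _  = spared
  label-range i B D (x ∷ S) v le with v Subset.∈? B | v Fin.≟ x
  ... | yes _ | _     = burns (≤-trans (m≤m+n i _) le)
  ... | no _  | yes _ = defended (≤-trans (s≤s (m≤m+n i (length S))) (≤-trans (≤-reflexive (sym (+-suc i (length S)))) le))
  ... | no _  | no _  = label-range (suc i) _ _ S v (≤-trans (≤-reflexive (sym (+-suc i (length S)))) le)

-- Simulating a labelling

elems : ∀ {n} → Subset n → List ℕ
elems []            = []
elems (inside ∷ p)  = 0 ∷ map suc (elems p)
elems (outside ∷ p) = map suc (elems p)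

length-elems : ∀ {n} (p : Subset n) → length (elems p) ≡ ∣ p ∣
length-elems []            = refl
length-elems (inside ∷ p)  = cong suc (trans (length-map suc (elems p)) (length-elems p))
length-elems (outside ∷ p) = trans (length-map suc (elems p)) (length-elems p)

elems-unique : ∀ {n} (p : Subset n) → Unique (elems p)
elems-unique []            = []
elems-unique (inside ∷ p)  = All.map⁺ (All.universal (λ _ ()) _) ∷ Unique.map⁺ suc-injective (elems-unique p)
elems-unique (outside ∷ p) = Unique.map⁺ suc-injective (elems-unique p)

∈-elems⁺ : ∀ {n} {p : Subset n} {v} → v Subset.∈ p → toℕ v ∈ elems p
∈-elems⁺ {p = inside ∷ p}  Vec.here      = here refl
∈-elems⁺ {p = inside ∷ p}  (Vec.there m) = there (∈-map⁺ suc (∈-elems⁺ m))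
∈-elems⁺ {p = outside ∷ p} (Vec.there m) = ∈-map⁺ suc (∈-elems⁺ m)

∈-elems⁻ : ∀ {n} {p : Subset n} {x} → x ∈ elems p → ∃[ v ] toℕ v ≡ x × v Subset.∈ p
∈-elems⁻ {p = inside ∷ p} (here refl) = zero , refl , Vec.here
∈-elems⁻ {p = inside ∷ p} (there m) with ∈-map⁻ suc m
... | _ , y∈ , refl = let (v , eq , v∈) = ∈-elems⁻ y∈ in suc v , cong suc eq , Vec.there v∈
∈-elems⁻ {p = outside ∷ p} m with ∈-map⁻ suc m
... | _ , y∈ , refl = let (v , eq , v∈) = ∈-elems⁻ y∈ in suc v , cong suc eq , Vec.there v∈

kept : Val Entry → List ℕ
kept []            = []
kept ((v , l) ∷ e) = ite (proj₁ l) (kept e) (v ∷ kept e)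

length-kept : ∀ e → length (kept e) ≡ score e
length-kept []                    = refl
length-kept ((_ , true  , _) ∷ e) = length-kept e
length-kept ((_ , false , _) ∷ e) = cong suc (length-kept e)

∈-kept⁺ : ∀ {e v l} → (v , l) ∈ e → ¬ Burns l → v ∈ kept e
∈-kept⁺ {(_ , true , _) ∷ e}  (here refl) ¬b = ⊥-elim (¬b refl)
∈-kept⁺ {(_ , false , _) ∷ e} (here refl) ¬b = here refl
∈-kept⁺ {(_ , true , _) ∷ e}  (there m)   ¬b = ∈-kept⁺ m ¬b
∈-kept⁺ {(_ , false , _) ∷ e} (there m)   ¬b = there (∈-kept⁺ m ¬b)

∈-kept⁻ : ∀ {e v} → v ∈ kept e → ∃[ l ] (v , l) ∈ e × ¬ Burns l
∈-kept⁻ {(_ , true , _) ∷ e}  m           = let (l , m′ , b) = ∈-kept⁻ {e} m in l , there m′ , b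
∈-kept⁻ {(_ , false , _) ∷ e} (here refl) = _ , here refl , λ ()
∈-kept⁻ {(_ , false , _) ∷ e} (there m)   = let (l , m′ , b) = ∈-kept⁻ {e} m in l , there m′ , b

kept-unique : ∀ {e} → Unique (domain e) → Unique (kept e)
kept-unique {[]} [] = []
kept-unique {(_ , true , _) ∷ e}  (_ ∷ u) = kept-unique u
kept-unique {(_ , false , _) ∷ e} (n ∷ u) = All.tabulate (λ m → let (_ , m′ , _) = ∈-kept⁻ {e} m in All.lookup n (∈-map⁺ proj₁ m′)) ∷ kept-unique u

opaque
  unfolding nthₜ
  nth-lookup : ∀ {A n} (d : Op₀ A) (xs : Vec (Val A) n) i → nth d (Vec.toList xs) (toℕ i) ≡ Vec.lookup xs i
  nth-lookup d (x ∷ xs) zero    = refl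
  nth-lookup d (x ∷ xs) (suc i) = nth-lookup d xs i

opaque
  unfolding reverseₜ
  reverse-correct : ∀ xs → ⟦ reverseₜ ⟧ (xs ∷ []) ≡ reverse xs
  reverse-correct xs = refl

  reverse-safe : ∀ {M} xs → length xs ≤ M → Safe M reverseₜ (xs ∷ [])
  reverse-safe xs le = tt , tt , le , proj₁ (along-inv (λ _ → ⊤) {Q = λ _ → ⊤} (λ _ _ → _ , tt) (All.universal (λ _ → tt) xs) tt)

opaque
  unfolding verticesₜ
  vertices-correct : ∀ g → ⟦ verticesₜ ⟧ (g ∷ []) ≡ downFrom (length g)
  vertices-correct g = trans (cong proj₂ (go g 0)) (cong downFrom (+-identityʳ (length g)))
    where
    go : ∀ (xs : List (List Bool)) c →
         foldl (λ acc _ → suc (proj₁ acc) , proj₁ acc ∷ proj₂ acc) (c , downFrom c) xs ≡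
         (length xs + c , downFrom (length xs + c))
    go []       c = refl
    go (x ∷ xs) c = trans (go xs (suc c)) (cong (λ m → m , downFrom m) (+-suc (length xs) c))

  vertices-safe : ∀ {M} g → length g ≤ M → Safe M verticesₜ (g ∷ [])
  vertices-safe g le = tt , _ , le , proj₁ (along-inv (λ _ → ⊤) {Q = λ _ → ⊤} (λ _ _ → _ , tt) (All.universal (λ _ → tt) g) tt)

opaque
  unfolding horizonₜ
  horizon-correct : ∀ {n} (X : Subset n) → ⟦ horizonₜ ⟧ (Vec.toList X ∷ []) ≡ 4 * ∣ X ∣ + 4
  horizon-correct X = go X 4
    where
    rearrange : ∀ m c → 4 * m + (4 + c) ≡ 4 * suc m + c
    rearrange = solve-∀
    go : ∀ {n} (X : Subset n) c → foldl (λ acc b → ite b (4 + acc) acc) c (Vec.toList X) ≡ 4 * ∣ X ∣ + c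
    go []            c = refl
    go (inside ∷ X)  c = trans (go X (4 + c)) (rearrange ∣ X ∣ c)
    go (outside ∷ X) c = go X c

  horizon-safe : ∀ {M} X → length X ≤ M → Safe M horizonₜ (X ∷ [])
  horizon-safe X le = tt , _ , le ,
    proj₁ (along-inv (λ _ → ⊤) {Q = λ _ → ⊤} (λ { {true} _ _ → _ , tt ; {false} _ _ → _ , tt }) (All.universal (λ _ → tt) X) tt)

labelList : ℕ → List Lab
labelList zero    = burn 0 ∷ safe ∷ []
labelList (suc m) = burn (suc m) ∷ def (suc m) ∷ labelList m

opaque
  unfolding labelsₜ
  labels-correct : ∀ m → ⟦ labelsₜ ⟧ (m ∷ []) ≡ labelList m
  labels-correct m = trans (cong proj₂ (go m 0)) (cong labelList (+-identityʳ m))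
    where
    go : ∀ k c →
         foldl (λ acc _ → suc (proj₁ acc) , burn (suc (proj₁ acc)) ∷ def (suc (proj₁ acc)) ∷ proj₂ acc)
               (c , labelList c) (replicate k false) ≡ (k + c , labelList (k + c))
    go zero    c = refl
    go (suc k) c = trans (go k (suc c)) (cong (λ m → m , labelList m) (+-suc k c))

  labels-safe : ∀ {M} m → m ≤ M → Safe M labelsₜ (m ∷ [])
  labels-safe m le = tt , _ , ≤-trans (≤-reflexive (length-replicate m)) le ,
    proj₁ (along-inv (λ _ → ⊤) {Q = λ _ → ⊤} (λ _ _ → _ , tt) (All.universal (λ _ → tt) (replicate m false)) tt)

length-labelList : ∀ m → length (labelList m) ≡ 2 * m + 2
length-labelList zero    = refl
length-labelList (suc m) = trans (cong (2 +_) (length-labelList m)) (rearrange m)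
  where
  rearrange : ∀ m → 2 + (2 * m + 2) ≡ 2 * suc m + 2
  rearrange = solve-∀

labelList-times : ∀ {M} m → m ≤ M → All (Bnd Label M) (labelList m)
labelList-times zero    le = (tt , tt , z≤n) ∷ (tt , tt , z≤n) ∷ []
labelList-times (suc m) le = (tt , tt , le) ∷ (tt , tt , le) ∷ labelList-times m (≤-trans (n≤1+n m) le)

burn∈labelList : ∀ {j} m → j ≤ m → burn j ∈ labelList m
burn∈labelList zero    z≤n = here refl
burn∈labelList (suc m) le with m≤n⇒m<n∨m≡n le
... | inj₁ (s≤s lt) = there (there (burn∈labelList m lt))
... | inj₂ refl     = here refl

def∈labelList : ∀ {j} m → suc j ≤ m → def (suc j) ∈ labelList m
def∈labelList (suc m) le with m≤n⇒m<n∨m≡n le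
... | inj₁ (s≤s lt) = there (there (def∈labelList m lt))
... | inj₂ refl     = there (here refl)

safe∈labelList : ∀ m → safe ∈ labelList m
safe∈labelList zero    = there (here refl)
safe∈labelList (suc m) = there (there (safe∈labelList m))

data Picked (V : List ℕ) (e : Val Entry) (t : ℕ) (bs : List ℕ) (v : ℕ) : Set where
  scheduled : ∀ {l} → (v , l) ∈ e → IsDef l → time l ≡ t → v ∉ bs → Picked V e t bs v
  arbitrary : All (λ p → ¬ (IsDef (proj₂ p) × time (proj₂ p) ≡ t × proj₁ p ∉ bs)) e →
              v ∈ V → v ∉ bs → Picked V e t bs v

pick : List ℕ → Val Entry → ℕ → List ℕ → ℕ
pick V e t bs = ⟦ pickₜ ⟧ (V ∷ e ∷ t ∷ bs ∷ [])

opaque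
  unfolding pickₜ
  pick-spec : ∀ V e t bs → Any (_∉ bs) V → Picked V e t bs (pick V e t bs)
  pick-spec V e t bs any = choose
    (find-spec proj₁ (λ p _ → ∧-ite (def-reflects (proj₂ p)) (∧-ite (eq-reflects _ t) (¬-ite (mem-reflects _ bs)))) e)
    (find-spec id (λ v _ → ¬-ite (mem-reflects v bs)) V)
    where
    choose : ∀ {r r′} → Found (λ p → IsDef (proj₂ p) × time (proj₂ p) ≡ t × proj₁ p ∉ bs) proj₁ e r →
             Found (_∉ bs) id V r′ → Picked V e t bs (ite (proj₁ r) (proj₂ r) (proj₂ r′))
    choose (inj₁ (p , p∈ , (d , eq , p∉) , refl)) _ = scheduled p∈ d eq p∉
    choose (inj₂ (none , refl)) (inj₁ (v , v∈ , v∉ , refl)) = arbitrary none v∈ v∉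
    choose (inj₂ (none , refl)) (inj₂ (all , _)) = ⊥-elim (All.All¬⇒¬Any all any)

spreadᶠ : Val Matrix → List ℕ → List ℕ → List ℕ → List ℕ
spreadᶠ g V bs ds = ⟦ spreadₜ ⟧ (g ∷ V ∷ bs ∷ ds ∷ [])

opaque
  unfolding spreadₜ
  spread-spec : ∀ g V bs ds v → (v ∈ spreadᶠ g V bs ds → v ∈ bs ⊎ (v ∈ V × Threat g bs ds v)) ×
                                (v ∈ bs ⊎ (v ∈ V × Threat g bs ds v) → v ∈ spreadᶠ g V bs ds)
  spread-spec g V bs ds v = go V bs
    where
    f : List ℕ → ℕ → List ℕ
    f acc x = ite (threat g bs ds x) (x ∷ acc) acc
    go : ∀ xs acc → (v ∈ foldl f acc xs → v ∈ acc ⊎ (v ∈ xs × Threat g bs ds v)) ×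
                    (v ∈ acc ⊎ (v ∈ xs × Threat g bs ds v) → v ∈ foldl f acc xs)
    go []       acc = inj₁ , λ { (inj₁ m) → m }
    go (x ∷ xs) acc with threat g bs ds x | threat-reflects g bs ds x
    ... | true  | ofʸ t =
      (λ m → [ (λ { (here refl) → inj₂ (here refl , t) ; (there m′) → inj₁ m′ })
             , (λ (m′ , t′) → inj₂ (there m′ , t′)) ]′ (proj₁ (go xs (x ∷ acc)) m)) ,
      λ { (inj₁ m) → proj₂ (go xs (x ∷ acc)) (inj₁ (there m))
        ; (inj₂ (here refl , _)) → proj₂ (go xs (x ∷ acc)) (inj₁ (here refl))
        ; (inj₂ (there m , t′)) → proj₂ (go xs (x ∷ acc)) (inj₂ (m , t′)) }
    ... | false | ofⁿ ¬t =
      (λ m → [ inj₁ , (λ (m′ , t′) → inj₂ (there m′ , t′)) ]′ (proj₁ (go xs acc) m)) ,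
      λ { (inj₁ m) → proj₂ (go xs acc) (inj₁ m)
        ; (inj₂ (here refl , t)) → ⊥-elim (¬t t)
        ; (inj₂ (there m , t′)) → proj₂ (go xs acc) (inj₂ (m , t′)) }

  -- Free of repetitions, the list of burning vertices is no longer than `V`; the time bound relies
  -- on this.
  spread-unique : ∀ {g V bs ds} → Unique V → Unique bs → Unique (spreadᶠ g V bs ds)
  spread-unique {g} {V} {bs} {ds} uV ub = go V uV ub (λ _ t → proj₁ t)
    where
    f : List ℕ → ℕ → List ℕ
    f acc x = ite (threat g bs ds x) (x ∷ acc) acc
    go : ∀ xs {acc} → Unique xs → Unique acc → (∀ {x} → x ∈ xs → Threat g bs ds x → x ∉ acc) →
         Unique (foldl f acc xs)
    go []       ux ua fresh = ua
    go (x ∷ xs) (x∉ ∷ ux) ua fresh with threat g bs ds x | threat-reflects g bs ds x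
    ... | true  | ofʸ t = go xs ux (All.¬Any⇒All¬ _ (fresh (here refl) t) ∷ ua)
            λ { y∈ t′ (here refl) → All.lookup x∉ y∈ refl ; y∈ t′ (there m) → fresh (there y∈) t′ m }
    ... | false | ofⁿ _ = go xs ux ua (fresh ∘ there)

  spread-safe : ∀ {M} g V bs ds → length V ≤ M →
                (∀ {v} → v ∈ V → Safe M threatₜ (g ∷ bs ∷ ds ∷ v ∷ [])) →
                Safe M spreadₜ (g ∷ V ∷ bs ∷ ds ∷ [])
  spread-safe {M} g V bs ds le safe-threat = tt , tt , le ,
    proj₁ (along-inv (λ _ → ⊤) {Q = _∈ V}
      (λ {x} {acc} x∈ _ → ((_ , safe-threat x∈) , branch (threat g bs ds x)) , tt) (All.tabulate id) tt)
    where
    branch : ∀ b → ite b (⊤ × ⊤) ⊤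
    branch true  = tt , tt
    branch false = tt

opaque
  unfolding threatₜ memₜ eqₜ leₜ subₜ adjₜ nthₜ
  threat-free : Free threatₜ
  threat-free = _

opaque
  unfolding pickₜ memₜ eqₜ leₜ subₜ
  pick-free : Free pickₜ
  pick-free = _

data Moved (g : Val Matrix) (V : List ℕ) (e : Val Entry) : Val Fire → Val Fire → Set where
  still : ∀ {i bs ds} → All (λ v → ¬ Threat g bs ds v) V → Moved g V e (i , bs , ds) (i , bs , ds)
  moved : ∀ {i bs ds} → Any (Threat g bs ds) V → let v = pick V e (suc i) bs in
          Moved g V e (i , bs , ds) (suc i , spreadᶠ g V bs (v ∷ ds) , v ∷ ds)

module Simulate (g : Val Matrix) (V : List ℕ) (e : Val Entry) where

  moveᶠ : Val Fire → Val Fire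
  moveᶠ st = ⟦ moveₜ ⟧ (g ∷ V ∷ e ∷ st ∷ [])

  opaque
    unfolding moveₜ
    move-spec : ∀ st → Moved g V e st (moveᶠ st)
    move-spec (i , bs , ds) = decide (any-reflects (λ v _ → threat-reflects g bs ds v) V)
      where
      decide : ∀ {b} → Reflects (Any (Threat g bs ds) V) b → let v = pick V e (suc i) bs in
               Moved g V e (i , bs , ds)
                 (ite b (suc i , spreadᶠ g V bs (v ∷ ds) , v ∷ ds) (i , bs , ds))
      decide (ofʸ t)  = moved t
      decide (ofⁿ ¬t) = still (All.¬Any⇒All¬ V ¬t)

  iterate : ℕ → Val Fire → Val Fire
  iterate zero    st = st
  iterate (suc m) st = iterate m (moveᶠ st)

  opaque
    unfolding simulateₜ
    simulate-correct : ∀ s m → ⟦ simulateₜ ⟧ (g ∷ V ∷ e ∷ s ∷ m ∷ []) ≡ iterate m (0 , s ∷ [] , [])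
    simulate-correct s m = go m (0 , s ∷ [] , [])
      where
      go : ∀ m st → foldl (λ st _ → moveᶠ st) st (replicate m false) ≡ iterate m st
      go zero    st = refl
      go (suc m) st = go m (moveᶠ st)

  module _ (M : ℕ) (g≤ : Bnd Matrix M g) (V≤ : Bnd (L N) M V) (e≤ : Bnd Entry M e) (uV : Unique V) where

    -- An arbitrary pick may repeat a defended vertex, so the list of defended vertices is bounded
    -- by the number of moves, at most `j`, and not by the number of vertices.
    record Tame (j : ℕ) (st : Val Fire) : Set where
      constructor tame
      field
        clock  : proj₁ st ≤ j
        unique : Unique (proj₁ (proj₂ st))
        inV    : All (_∈ V) (proj₁ (proj₂ st))
        few    : length (proj₂ (proj₂ st)) ≤ j
        small  : All (_≤ M) (proj₂ (proj₂ st))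

    burning≤ : ∀ {bs} → Unique bs → All (_∈ V) bs → Bnd (L N) M bs
    burning≤ u i = ≤-trans (unique⊆⇒length≤ u i) (proj₁ V≤) , All.map (All.lookup (proj₂ V≤)) i

    pick-bounded : ∀ {j st} → suc j ≤ M → Tame j st →
      Safe M pickₜ (V ∷ e ∷ suc (proj₁ st) ∷ proj₁ (proj₂ st) ∷ []) ×
      pick V e (suc (proj₁ st)) (proj₁ (proj₂ st)) ≤ M
    pick-bounded le (tame c u i _ _) = free-bounded pickₜ pick-free
      (V≤ , e≤ , ≤-trans (s≤s c) le , burning≤ u i , tt)

    threat-safe : ∀ {bs ds v} → Bnd (L N) M bs → Bnd (L N) M ds → v ∈ V →
                  Safe M threatₜ (g ∷ bs ∷ ds ∷ v ∷ [])
    threat-safe b d v∈ = proj₁ (free-bounded threatₜ threat-free (g≤ , b , d , All.lookup (proj₂ V≤) v∈ , tt))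

    move-tame : ∀ {j st} → suc j ≤ M → Tame j st → Tame (suc j) (moveᶠ st)
    move-tame {j} {st} le t@(tame c u i f s) with moveᶠ st | move-spec st | pick-bounded le t
    ... | _ | still _ | _ = tame (≤-trans c (n≤1+n j)) u i (≤-trans f (n≤1+n j)) s
    ... | _ | moved {i = time} {bs} {ds} _ | _ , v≤ = tame (s≤s c) (spread-unique uV u)
      (All.tabulate λ {w} m → [ All.lookup i , proj₁ ]′ (proj₁ (spread-spec g V bs (pick V e (suc time) bs ∷ ds) w) m))
      (s≤s f) (v≤ ∷ s)

    opaque
      unfolding moveₜ
      move-safe : ∀ {j st} → suc j ≤ M → Tame j st → Safe M moveₜ (g ∷ V ∷ e ∷ st ∷ [])
      move-safe {j} {time , bs , ds} le t@(tame c u i f s) =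
        (tt , tt , proj₁ V≤ ,
         proj₁ (along-inv (λ _ → ⊤) {Q = _∈ V}
           (λ {x} {acc} x∈ _ → ((_ , threat-safe b≤ d≤ x∈) , branch (threat g bs ds x)) , tt) (All.tabulate id) tt)) ,
        decide _
        where
        b≤ : Bnd (L N) M bs
        b≤ = burning≤ u i
        d≤ : Bnd (L N) M ds
        d≤ = ≤-trans f (≤-trans (n≤1+n j) le) , s
        branch : ∀ b → ite b ⊤ ⊤
        branch true  = tt
        branch false = tt
        p : Safe M pickₜ (V ∷ e ∷ suc time ∷ bs ∷ []) × pick V e (suc time) bs ≤ M
        p = pick-bounded le t
        decide : ∀ b → ite b
          ((((⊤ × ⊤ × ⊤ × ⊤ × ⊤) × Safe M pickₜ (V ∷ e ∷ suc time ∷ bs ∷ [])) × ⊤) ×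
           (⊤ × ((⊤ × ⊤ × ⊤ × ⊤ × ⊤) × Safe M spreadₜ (g ∷ V ∷ bs ∷ (pick V e (suc time) bs ∷ ds) ∷ [])) × ⊤)) ⊤
        decide true = ((_ , proj₁ p) , tt) , tt ,
          (_ , spread-safe g V bs _ (proj₁ V≤) (threat-safe b≤ (≤-trans (s≤s f) le , proj₂ p ∷ s))) , tt
        decide false = tt

    opaque
      unfolding simulateₜ
      simulate-safe : ∀ {s} m → m ≤ M → s ∈ V → Safe M simulateₜ (g ∷ V ∷ e ∷ s ∷ m ∷ [])
      simulate-safe {s} m le s∈V = tt , _ , ≤-trans (≤-reflexive (length-replicate m)) le ,
        go m 0 (0 , s ∷ [] , []) le (tame z≤n ([] ∷ []) (s∈V ∷ []) z≤n [])
        where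
        go : ∀ k j st → j + k ≤ M → Tame j st →
             Along (λ x st → (⊤ × ⊤ × ⊤ × ⊤ × ⊤) × Safe M moveₜ (g ∷ V ∷ e ∷ st ∷ []))
                   (λ st _ → moveᶠ st) st (replicate k false)
        go zero    j st le t = tt
        go (suc k) j st le t = (_ , move-safe lt t) , go k (suc j) (moveᶠ st) le′ (move-tame lt t)
          where
          le′ : suc j + k ≤ M
          le′ = ≤-trans (≤-reflexive (sym (+-suc j k))) le
          lt : suc j ≤ M
          lt = ≤-trans (s≤s (m≤m+n j k)) le′

-- Labellings and strategies

allPairs-lookup : ∀ {A : Set} {R : A → A → Set} {xs x y} → AllPairs R xs → x ∈ xs → y ∈ xs →
                  x ≡ y ⊎ R x y ⊎ R y x
allPairs-lookup (_ ∷ _)  (here refl) (here refl) = inj₁ refl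
allPairs-lookup (r ∷ _)  (here refl) (there y∈)  = inj₂ (inj₁ (All.lookup r y∈))
allPairs-lookup (r ∷ _)  (there x∈)  (here refl) = inj₂ (inj₂ (All.lookup r x∈))
allPairs-lookup (_ ∷ rs) (there x∈)  (there y∈)  = allPairs-lookup rs x∈ y∈

labelList-def : ∀ {l} m → l ∈ labelList m → IsDef l → 1 ≤ time l
labelList-def zero    (here refl)         d = ⊥-elim (proj₁ d refl)
labelList-def zero    (there (here refl)) (_ , ())
labelList-def (suc m) (here refl)         d = ⊥-elim (proj₁ d refl)
labelList-def (suc m) (there (here refl)) d = s≤s z≤n
labelList-def (suc m) (there (there l∈))  d = labelList-def m l∈ d

matrix : ∀ {n} → Graph n → Val Matrix
matrix G = Vec.toList (Vec.tabulate (Vec.toList ∘ neighbours G))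

module Solve {n} (G : Graph n) (s : Fin n) (X : Subset n) (stars : StarsOutside G X) where

  open Spread G

  g : Val Matrix
  g = matrix G

  V : List ℕ
  V = downFrom n

  xs : List Bool
  xs = Vec.toList X

  horizon : ℕ
  horizon = 4 * ∣ X ∣ + 4

  Λ : List Lab
  Λ = labelList horizon

  toV : (v : Fin n) → toℕ v ∈ V
  toV v = ∈-downFrom⁺ (Fin.toℕ<n v)

  data Vertex : ℕ → Set where
    vertex : (v : Fin n) → Vertex (toℕ v)

  fromV : ∀ {x} → x ∈ V → Vertex x
  fromV x∈ = subst Vertex (Fin.toℕ-fromℕ< (∈-downFrom⁻ x∈)) (vertex (fromℕ< (∈-downFrom⁻ x∈)))

  opaque
    unfolding adjₜ
    adj-lookup : ∀ u v → adj g (toℕ u) (toℕ v) ≡ Vec.lookup (neighbours G u) v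
    adj-lookup u v = begin
      nth ff (nth [] g (toℕ u)) (toℕ v)
        ≡⟨ cong (λ r → nth ff r (toℕ v)) (nth-lookup [] (Vec.tabulate (Vec.toList ∘ neighbours G)) u) ⟩
      nth ff (Vec.lookup (Vec.tabulate (Vec.toList ∘ neighbours G)) u) (toℕ v)
        ≡⟨ cong (λ r → nth ff r (toℕ v)) (Vec.lookup∘tabulate (Vec.toList ∘ neighbours G) u) ⟩
      nth ff (Vec.toList (neighbours G u)) (toℕ v)
        ≡⟨ nth-lookup ff (neighbours G u) v ⟩
      Vec.lookup (neighbours G u) v ∎
      where open ≡-Reasoning

  adj⇒ : ∀ {u v} → adj g (toℕ u) (toℕ v) ≡ true → Adjacent G u v
  adj⇒ {u} {v} eq = Vec.lookup⇒[]= v (neighbours G u) (trans (sym (adj-lookup u v)) eq)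

  ⇒adj : ∀ {u v} → Adjacent G u v → adj g (toℕ u) (toℕ v) ≡ true
  ⇒adj {u} {v} a = trans (adj-lookup u v) (Vec.[]=⇒lookup a)

  inX⇒ : ∀ {v} → nth ff xs (toℕ v) ≡ true → v Subset.∈ X
  inX⇒ {v} eq = Vec.lookup⇒[]= v X (trans (sym (nth-lookup ff X v)) eq)

  ⇒inX : ∀ {v} → v Subset.∈ X → nth ff xs (toℕ v) ≡ true
  ⇒inX {v} v∈ = trans (nth-lookup ff X v) (Vec.[]=⇒lookup v∈)

  adj-sym : ∀ {u v} → u ∈ V → v ∈ V → adj g u v ≡ true → adj g v u ≡ true
  adj-sym u∈ v∈ a with fromV u∈ | fromV v∈
  ... | vertex u | vertex v = ⇒adj (symmetric G (adj⇒ a))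

  open DP g V xs (toℕ s) Λ (toV s) (burn∈labelList horizon z≤n) adj-sym public

  path-free : PathFree
  path-free a∈ b∈ c∈ d∈ a∉ b∉ c∉ d∉ ab bc cd with fromV a∈ | fromV b∈ | fromV c∈ | fromV d∈
  ... | vertex a | vertex b | vertex c | vertex d =
    [ inj₁ ∘ cong toℕ , inj₂ ∘ cong toℕ ]′
      (no-path stars (a∉ ∘ ⇒inX) (b∉ ∘ ⇒inX) (c∉ ∘ ⇒inX) (d∉ ∘ ⇒inX) (adj⇒ ab) (adj⇒ bc) (adj⇒ cd))

  running≤horizon : ∀ {B D} S → Running B D S → length S ≤ horizon
  running≤horizon {B} S r = ≤-trans (running-length stars S r)
    (+-monoˡ-≤ 4 (*-monoʳ-≤ 4 (Subset.∣p─q∣≤∣p∣ X B)))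

  module FromStrategy (S : List (Fin n)) (valid : Valid G s S) where

    lab : Fin n → Lab
    lab = labelFrom 0 ⁅ s ⁆ Subset.⊥ S

    lab′ : ℕ → Lab
    lab′ x with x <? n
    ... | yes lt = lab (fromℕ< lt)
    -- Numbers from n on are not vertices; any label of `Λ` can stand here.
    ... | no _   = safe

    lab′-toℕ : ∀ v → lab′ (toℕ v) ≡ lab v
    lab′-toℕ v with toℕ v <? n
    ... | yes lt = cong lab (Fin.fromℕ<-toℕ v lt)
    ... | no ¬lt = ⊥-elim (¬lt (Fin.toℕ<n v))

    range∈Λ : ∀ {l} → InRange horizon l → l ∈ Λ
    range∈Λ (burns le)    = burn∈labelList horizon le
    range∈Λ (defended le) = def∈labelList horizon le
    range∈Λ spared        = safe∈labelList horizon

    lab-feasible : Feasible lab′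
    lab-feasible = feasible consistent
      (trans (lab′-toℕ s) (label-burning S (Subset.x∈⁅x⁆ s))) inΛ
      where
      consistent : ∀ {u v} → u ∈ V → v ∈ V → u ≢ v → Compat g (u , lab′ u) (v , lab′ v)
      consistent u∈ v∈ u≢v with fromV u∈ | fromV v∈
      ... | vertex u | vertex v rewrite lab′-toℕ u | lab′-toℕ v = compatible
        (label-clash 0 _ _ S (u≢v ∘ cong toℕ))
        (λ a → label-closed 0 _ _ S (adj⇒ a) Subset.∉⊥ valid ,
               label-closed 0 _ _ S (symmetric G (adj⇒ a)) Subset.∉⊥ valid)
      inΛ : ∀ x → lab′ x ∈ Λ
      inΛ x with x <? n
      ... | yes lt = range∈Λ (label-range 0 _ _ S (fromℕ< lt) (running≤horizon {⁅ s ⁆} {Subset.⊥} S (valid⇒running S valid)))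
      ... | no _   = safe∈labelList horizon

    saved≤score : ∀ {P} → All (_∈ P) V → saved G s S ≤ score (restrict lab′ P)
    saved≤score {P} complete = begin
      ∣ ∁ burned ∣                   ≡⟨ length-elems (∁ burned) ⟨
      length (elems (∁ burned))      ≤⟨ unique⊆⇒length≤ (elems-unique (∁ burned)) (All.tabulate keep) ⟩
      length (kept (restrict lab′ P)) ≡⟨ length-kept (restrict lab′ P) ⟩
      score (restrict lab′ P)        ∎
      where
      open ≤-Reasoning
      burned : Subset n
      burned = burnedFrom G ⁅ s ⁆ Subset.⊥ S
      keep : ∀ {x} → x ∈ elems (∁ burned) → x ∈ kept (restrict lab′ P)
      keep x∈ with ∈-elems⁻ {p = ∁ burned} x∈
      ... | v , refl , v∈ = ∈-kept⁺ (∈-map⁺ (λ v → v , lab′ v) (All.lookup complete (toV v)))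
        (λ b → Subset.x∈∁p⇒x∉p v∈ (label-burned 0 _ _ S v (subst Burns (lab′-toℕ v) b)))

  -- From an optimal entry to a strategy

  module FromEntry {P : List ℕ} {x : Val Scored} (sol : Solution path-free P x) where

    open Solution sol
    open Processed proc using (unique; inV)
    open WF well-formed

    e : Val Entry
    e = proj₂ x

    open Simulate g V e

    e-unique : Unique (domain e)
    e-unique = subst Unique (sym covers) unique

    labelOf : ∀ v → ∃[ l ] (toℕ v , l) ∈ e
    labelOf v with ∈-map⁻ proj₁ (subst (toℕ v ∈_) (sym covers) (All.lookup complete (toV v)))
    ... | (_ , l) , m , refl = l , m

    e∈V : ∀ {v l} → (v , l) ∈ e → v ∈ V
    e∈V m = All.lookup inV (subst (_ ∈_) covers (∈-map⁺ proj₁ m))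

    e-def : ∀ {u v l l′} → (u , l) ∈ e → (v , l′) ∈ e → IsDef l → IsDef l′ → time l ≡ time l′ → u ≡ v
    e-def m m′ d d′ eq with allPairs-lookup compat m m′
    ... | inj₁ refl     = refl
    ... | inj₂ (inj₁ c) = ⊥-elim (Compat.no-clash c (d′ , d , sym eq))
    ... | inj₂ (inj₂ c) = ⊥-elim (Compat.no-clash c (d , d′ , eq))

    e-closed : ∀ {u v l l′} → (toℕ u , l) ∈ e → (toℕ v , l′) ∈ e → Adjacent G u v → Closed l l′
    e-closed {u} {v} m m′ a with allPairs-lookup compat m m′
    ... | inj₂ (inj₁ c) = proj₂ (Compat.closed c (⇒adj (symmetric G a)))
    ... | inj₂ (inj₂ c) = proj₁ (Compat.closed c (⇒adj a))
    ... | inj₁ eq with Fin.toℕ-injective (cong proj₁ eq)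
    ...   | refl = ⊥-elim (irreflexive G u a)

    record Rep (bs : List ℕ) (B : Subset n) : Set where
      constructor rep
      field
        vertices : All (_∈ V) bs
        sound    : ∀ {v} → toℕ v ∈ bs → v Subset.∈ B
        whole    : ∀ {v} → v Subset.∈ B → toℕ v ∈ bs

    rep-threat⁺ : ∀ {bs ds B D v} → Rep bs B → Rep ds D → Threat g bs ds (toℕ v) → Threatened B D v
    rep-threat⁺ (rep vb sb wb) (rep _ _ wd) (v∉bs , v∉ds , a) with find a
    ... | u , u∈ , adj-uv with fromV (All.lookup vb u∈)
    ...   | vertex u′ = v∉bs ∘ wb , v∉ds ∘ wd , u′ , sb u∈ , adj⇒ adj-uv

    rep-threat⁻ : ∀ {bs ds B D v} → Rep bs B → Rep ds D → Threatened B D v → Threat g bs ds (toℕ v)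
    rep-threat⁻ (rep _ sb wb) (rep _ sd _) (v∉B , v∉D , u , u∈B , a) =
      v∉B ∘ sb , v∉D ∘ sd , lose (wb u∈B) (⇒adj a)

    rep-insert : ∀ {ds D v} → Rep ds D → Rep (toℕ v ∷ ds) (D ∪ ⁅ v ⁆)
    rep-insert {ds} {D} {v} (rep vd sd wd) = rep (toV v ∷ vd) sound whole
      where
      sound : ∀ {w} → toℕ w ∈ toℕ v ∷ ds → w Subset.∈ D ∪ ⁅ v ⁆
      sound (here eq) with Fin.toℕ-injective eq
      ... | refl = Subset.x∈p∪q⁺ {p = D} (inj₂ (Subset.x∈⁅x⁆ v))
      sound (there m) = Subset.x∈p∪q⁺ (inj₁ (sd m))
      whole : ∀ {w} → w Subset.∈ D ∪ ⁅ v ⁆ → toℕ w ∈ toℕ v ∷ ds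
      whole w∈ with Subset.x∈p∪q⁻ D ⁅ v ⁆ w∈
      ... | inj₁ w∈D = there (wd w∈D)
      ... | inj₂ w∈v = here (cong toℕ (Subset.x∈⁅y⁆⇒x≡y v w∈v))

    rep-spread : ∀ {bs ds B D} → Rep bs B → Rep ds D → Rep (spreadᶠ g V bs ds) (spread G B D)
    rep-spread {bs} {ds} {B} {D} rb rd = rep vertices sound whole
      where
      vertices : All (_∈ V) (spreadᶠ g V bs ds)
      vertices = All.tabulate λ {w} m →
        [ All.lookup (Rep.vertices rb) , proj₁ ]′ (proj₁ (spread-spec g V bs ds w) m)
      sound : ∀ {w} → toℕ w ∈ spreadᶠ g V bs ds → w Subset.∈ spread G B D
      sound {w} m with proj₁ (spread-spec g V bs ds (toℕ w)) m
      ... | inj₁ w∈bs = ⊆-spread (Rep.sound rb w∈bs)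
      ... | inj₂ (_ , t) = let (_ , w∉D , u , u∈B , a) = rep-threat⁺ rb rd t in ∈-spread⁺ u∈B a w∉D
      whole : ∀ {w} → w Subset.∈ spread G B D → toℕ w ∈ spreadᶠ g V bs ds
      whole {w} w∈ with w Subset.∈? B | ∈-spread⁻ w∈
      ... | yes w∈B | _        = proj₂ (spread-spec g V bs ds (toℕ w)) (inj₁ (Rep.whole rb w∈B))
      ... | no _    | inj₁ w∈B = proj₂ (spread-spec g V bs ds (toℕ w)) (inj₁ (Rep.whole rb w∈B))
      ... | no w∉B  | inj₂ (w∉D , ex) = proj₂ (spread-spec g V bs ds (toℕ w))
              (inj₂ (toV w , rep-threat⁻ rb rd (w∉B , w∉D , ex)))

    -- The labels predict the fire from above, and vertices are defended
    -- according to their labels.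
    record Predicted (i : ℕ) (B D : Subset n) : Set where
      constructor predicted
      field
        burnt   : ∀ {v} → v Subset.∈ B → ∃[ l ] (toℕ v , l) ∈ e × Burns l × time l ≤ i
        guarded : ∀ {v l} → (toℕ v , l) ∈ e → IsDef l → time l ≤ i → v Subset.∈ D

    -- If `w` is due in this step, no other vertex can be the scheduled one, as defence times are
    -- distinct, and the pick is not arbitrary, as only vertices with burning labels are on fire.
    guarded-step : ∀ {i bs B D v} → Rep bs B → Predicted i B D → Picked V e (suc i) bs (toℕ v) →
                   ∀ {w l} → (toℕ w , l) ∈ e → IsDef l → time l ≤ suc i → w Subset.∈ D ∪ ⁅ v ⁆
    guarded-step {i} {bs} {B} {D} {v} rb (predicted bt gd) pk {w} {l} m d le with m≤n⇒m<n∨m≡n le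
    ... | inj₁ (s≤s lt) = Subset.x∈p∪q⁺ (inj₁ (gd m d lt))
    ... | inj₂ eq = Subset.x∈p∪q⁺ {p = D} (inj₂ (subst (w Subset.∈_) (cong ⁅_⁆ (Fin.toℕ-injective (same pk))) (Subset.x∈⁅x⁆ w)))
      where
      same : Picked V e (suc i) bs (toℕ v) → toℕ w ≡ toℕ v
      same (scheduled m′ d′ eq′ _) = e-def m m′ d d′ (trans eq (sym eq′))
      same (arbitrary none _ _) = ⊥-elim (All.lookup none m (d , eq , λ w∈bs →
        let (l′ , m′ , b , _) = bt (Rep.sound rb w∈bs) in
        proj₁ d (subst Burns (domain-unique e-unique m′ m) b)))

    -- The label of a newly burning vertex is constrained by that of a burning neighbour: it burns
    -- or defends by time i + 1, and in the latter case the vertex would already be in `D′`.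
    burnt-step : ∀ {i B D} → Predicted i B D → ∀ {D′} →
                 (∀ {v l} → (toℕ v , l) ∈ e → IsDef l → time l ≤ suc i → v Subset.∈ D′) →
                 ∀ {v} → v Subset.∈ spread G B D′ → ∃[ l ] (toℕ v , l) ∈ e × Burns l × time l ≤ suc i
    burnt-step {i} {B} {D} (predicted bt gd) {D′} gd′ {v} v∈ with v Subset.∈? B | ∈-spread⁻ v∈
    ... | yes v∈B | _ = let (l , m , b , le) = bt v∈B in l , m , b , ≤-trans le (n≤1+n i)
    ... | no v∉B | inj₁ v∈B = ⊥-elim (v∉B v∈B)
    ... | no _ | inj₂ (v∉D′ , u , u∈B , a) with bt u∈B | labelOf v
    ...   | l , m , b , le | l′ , m′ = ignite (e-closed m m′ a b)
      where
      soon : ∀ {t} → pred t ≤ time l → t ≤ suc i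
      soon {zero}  _   = z≤n
      soon {suc t} le′ = s≤s (≤-trans le′ le)
      ignite : (Burns l′ ⊎ proj₁ (proj₂ l′) ≡ true) × pred (time l′) ≤ time l →
               ∃[ l ] (toℕ v , l) ∈ e × Burns l × time l ≤ suc i
      ignite (kind , early) with proj₁ l′ in eq
      ... | true  = l′ , m′ , eq , soon early
      ... | false = ⊥-elim (v∉D′ (gd′ m′
              ((λ b′ → false≢true (trans (sym eq) b′)) , [ (λ ()) , id ]′ kind) (soon early)))
        where
        false≢true : ¬ false ≡ true
        false≢true ()

    iterate-still : ∀ m {i bs ds} → All (λ v → ¬ Threat g bs ds v) V →
                    iterate m (i , bs , ds) ≡ (i , bs , ds)
    iterate-still zero    none = refl
    iterate-still (suc m) {i} {bs} {ds} none with moveᶠ (i , bs , ds) | move-spec (i , bs , ds)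
    ... | _ | still _ = iterate-still m none
    ... | _ | moved t = ⊥-elim (All.All¬⇒¬Any none t)

    picked∈V : ∀ {t bs v} → Picked V e t bs v → v ∈ V
    picked∈V (scheduled m _ _ _) = e∈V m
    picked∈V (arbitrary _ v∈ _)  = v∈

    picked∉ : ∀ {t bs v} → Picked V e t bs v → v ∉ bs
    picked∉ (scheduled _ _ _ v∉) = v∉
    picked∉ (arbitrary _ _ v∉)   = v∉

    -- `ds′` is the final list of defended vertices, latest first, and `strategy` is what the
    -- simulation adds to `ds`. The second alternative of `status` is a simulation whose moves ran
    -- out.
    record Outcome (m : ℕ) (ds′ ds : List ℕ) (B D : Subset n) : Set where
      constructor outcome
      field
        strategy : List (Fin n)
        defends  : reverse ds′ ≡ reverse ds ++ map toℕ strategy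
        status   : ValidFrom G B D strategy ⊎ (Running B D strategy × length strategy ≡ m)
        kindled  : ∀ {v} → v Subset.∈ burnedFrom G B D strategy → ∃[ l ] (toℕ v , l) ∈ e × Burns l

    simulate-sound : ∀ m {i bs ds B D} → Rep bs B → Rep ds D → Predicted i B D →
                     Outcome m (proj₂ (proj₂ (iterate m (i , bs , ds)))) ds B D
    simulate-sound zero rb rd pr = outcome [] (sym (++-identityʳ _)) (inj₂ (tt , refl))
      (λ v∈ → let (l , m , b , _) = Predicted.burnt pr v∈ in l , m , b)
    simulate-sound (suc m) {i} {bs} {ds} {B} {D} rb rd pr
      with moveᶠ (i , bs , ds) | move-spec (i , bs , ds)
    ... | _ | still none = outcome []
      (trans (cong (λ st → reverse (proj₂ (proj₂ st))) (iterate-still m none)) (sym (++-identityʳ _)))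
      (inj₁ (unthreatened⇒stopped λ v t → All.lookup none (toV v) (rep-threat⁻ rb rd t)))
      (λ v∈ → let (l , m , b , _) = Predicted.burnt pr v∈ in l , m , b)
    ... | _ | moved t with find t
    ...   | w , w∈V , tw with pick V e (suc i) bs | pick-spec V e (suc i) bs (lose w∈V (proj₁ tw))
    ...     | x′ | pk with fromV (picked∈V pk)
    ...       | vertex v = extend (simulate-sound m {suc i} (rep-spread rb rd′) rd′ (predicted (burnt-step pr gd′) gd′))
      where
      rd′ : Rep (toℕ v ∷ ds) (D ∪ ⁅ v ⁆)
      rd′ = rep-insert rd
      gd′ : ∀ {w l} → (toℕ w , l) ∈ e → IsDef l → time l ≤ suc i → w Subset.∈ D ∪ ⁅ v ⁆
      gd′ = guarded-step rb pr pk
      alive : ¬ Stopped G B D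
      alive with fromV w∈V
      ... | vertex _ = threatened⇒¬stopped (rep-threat⁺ rb rd tw)
      extend : ∀ {ds′} → Outcome m ds′ (toℕ v ∷ ds) (spread G B (D ∪ ⁅ v ⁆)) (D ∪ ⁅ v ⁆) →
               Outcome (suc m) ds′ ds B D
      extend (outcome S eq st bu) = outcome (v ∷ S)
        (trans eq (trans (cong (_++ map toℕ S) (unfold-reverse (toℕ v) ds)) (++-assoc (reverse ds) _ _)))
        ([ (λ vf → inj₁ (alive , picked∉ pk ∘ Rep.whole rb , vf))
         , (λ (r , len) → inj₂ ((alive , r) , cong suc len)) ]′ st)
        bu

    opaque
      final : Outcome (suc horizon) (proj₂ (proj₂ (iterate (suc horizon) (0 , toℕ s ∷ [] , [])))) [] ⁅ s ⁆ Subset.⊥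
      -- One move beyond the horizon: if all of them were made, the strategy would be longer than
      -- any running one.
      final = simulate-sound (suc horizon)
        (rep (toV s ∷ []) (λ { (here eq) → subst (Subset._∈ ⁅ s ⁆) (sym (Fin.toℕ-injective eq)) (Subset.x∈⁅x⁆ s) })
             (λ v∈ → here (cong toℕ (Subset.x∈⁅y⁆⇒x≡y s v∈))))
        (rep [] (λ ()) (⊥-elim ∘ Subset.∉⊥))
        (predicted (λ v∈ → burn 0 , subst (λ v → (toℕ v , burn 0) ∈ e) (sym (Subset.x∈⁅y⁆⇒x≡y s v∈)) has-start , refl , z≤n)
          -- No label defends at time 0, so nothing has to be guarded yet.
          (λ {v} m d le → ⊥-elim (<-irrefl refl (≤-trans (labelList-def horizon (All.lookup labelled m) d) le))))

    open Outcome final public using (strategy; defends)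

    strategy-valid : Valid G s strategy
    strategy-valid with Outcome.status final
    ... | inj₁ vf = vf
    ... | inj₂ (r , len) = ⊥-elim (<-irrefl refl (≤-trans (≤-reflexive (sym len)) (running≤horizon {⁅ s ⁆} {Subset.⊥} strategy r)))

    score≤saved : score e ≤ saved G s strategy
    score≤saved = begin
      score e                   ≡⟨ length-kept e ⟨
      length (kept e)           ≤⟨ unique⊆⇒length≤ (kept-unique e-unique) (All.tabulate unburned) ⟩
      length (elems (∁ burned)) ≡⟨ length-elems (∁ burned) ⟩
      ∣ ∁ burned ∣              ∎
      where
      open ≤-Reasoning
      burned : Subset n
      burned = burnedFrom G ⁅ s ⁆ Subset.⊥ strategy
      unburned : ∀ {y} → y ∈ kept e → y ∈ elems (∁ burned)
      unburned y∈ with ∈-kept⁻ {e} y∈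
      ... | l , m , ¬b with fromV (e∈V m)
      ...   | vertex v = ∈-elems⁺ (Subset.x∉p⇒x∈∁p λ v∈ →
                let (l′ , m′ , b) = Outcome.kindled final v∈ in ¬b (subst Burns (domain-unique e-unique m′ m) b))

    -- A rival saves at most the score of its own labelling, the entry scores at least that, and
    -- replaying the entry saves at least its score.
    strategy-optimal : Optimal G s strategy
    strategy-optimal = strategy-valid , λ S′ valid′ → let open FromStrategy S′ valid′ in
      ≤-trans (saved≤score complete) (≤-trans (optimal lab-feasible) score≤saved)

-- The bound

-- The parameter function must be computable; written in the fold language, it gets its program from
-- the compiler.
ArithmeticTerm : (ℕ → ℕ) → Set
ArithmeticTerm h = Σ[ t ∈ Tm (N ∷ []) N ] (∀ k → ⟦ t ⟧ (k ∷ []) ≡ h k)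

addₜ mulₜ powₜ : Tm (N ∷ N ∷ []) N
addₜ = fold (unitsₜ x₁) x₀ (sucₜ x₁)
mulₜ = fold (unitsₜ x₀) 0ₜ (call addₜ (x₃ ∷ x₁ ∷ []))
powₜ = fold (unitsₜ x₁) (sucₜ 0ₜ) (call mulₜ (x₂ ∷ x₁ ∷ []))

foldl-units : ∀ {A : Set} (f h : A → A) → (∀ x → f x ≡ h x) → ∀ m x →
              foldl (λ acc (_ : Bool) → f acc) x (replicate m false) ≡ foldl (λ acc _ → h acc) x (replicate m false)
foldl-units f h eq zero    x = refl
foldl-units f h eq (suc m) x = trans (foldl-units f h eq m (f x)) (cong (λ y → foldl (λ acc _ → h acc) y (replicate m false)) (eq x))

add-correct : ∀ a b → ⟦ addₜ ⟧ (a ∷ b ∷ []) ≡ b + a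
add-correct a zero    = refl
add-correct a (suc b) = trans (add-correct (suc a) b) (+-suc b a)

mul-correct : ∀ a b → ⟦ mulₜ ⟧ (a ∷ b ∷ []) ≡ a * b
mul-correct a b = trans (foldl-units (λ acc → ⟦ addₜ ⟧ (b ∷ acc ∷ [])) (_+ b) (add-correct b) a 0)
  (trans (go a 0) (+-identityʳ (a * b)))
  where
  go : ∀ a c → foldl (λ acc _ → acc + b) c (replicate a false) ≡ a * b + c
  go zero    c = refl
  go (suc a) c = trans (go a (c + b)) (rearrange (a * b) b c)
    where
    rearrange : ∀ x b c → x + (c + b) ≡ b + x + c
    rearrange = solve-∀

pow-correct : ∀ a b → ⟦ powₜ ⟧ (a ∷ b ∷ []) ≡ a ^ b
pow-correct a b = trans (foldl-units (λ acc → ⟦ mulₜ ⟧ (a ∷ acc ∷ [])) (a *_) (mul-correct a) b 1)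
  (trans (go b 1) (*-identityʳ (a ^ b)))
  where
  go : ∀ b c → foldl (λ acc _ → a * acc) c (replicate b false) ≡ a ^ b * c
  go zero    c = sym (+-identityʳ c)
  go (suc b) c = trans (go b (a * c)) (rearrange (a ^ b) a c)
    where
    rearrange : ∀ x a c → x * (a * c) ≡ a * x * c
    rearrange = solve-∀

constᵃ : ∀ m → ArithmeticTerm (λ _ → m)
constᵃ zero    = 0ₜ , λ _ → refl
constᵃ (suc m) = let (t , eq) = constᵃ m in sucₜ t , λ k → cong suc (eq k)

idᵃ : ArithmeticTerm id
idᵃ = x₀ , λ _ → refl

_+ᵃ_ : ∀ {g h} → ArithmeticTerm g → ArithmeticTerm h → ArithmeticTerm (λ k → g k + h k)
(t , p) +ᵃ (u , q) = call addₜ (u ∷ t ∷ []) , λ k → trans (add-correct (⟦ u ⟧ (k ∷ [])) (⟦ t ⟧ (k ∷ []))) (cong₂ _+_ (p k) (q k))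

_*ᵃ_ : ∀ {g h} → ArithmeticTerm g → ArithmeticTerm h → ArithmeticTerm (λ k → g k * h k)
(t , p) *ᵃ (u , q) = call mulₜ (t ∷ u ∷ []) , λ k → trans (mul-correct (⟦ t ⟧ (k ∷ [])) (⟦ u ⟧ (k ∷ []))) (cong₂ _*_ (p k) (q k))

_^ᵃ_ : ∀ {g h} → ArithmeticTerm g → ArithmeticTerm h → ArithmeticTerm (λ k → g k ^ h k)
(t , p) ^ᵃ (u , q) = call powₜ (t ∷ u ∷ []) , λ k → trans (pow-correct (⟦ t ⟧ (k ∷ [])) (⟦ u ⟧ (k ∷ []))) (cong₂ _^_ (p k) (q k))

computable : ∀ {h} → ArithmeticTerm h → Computable h
computable (t , eq) = program t , λ k → let (steps , run , _) = program-correct t k in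
  steps , subst (λ m → program t on encodeℕ k outputs encodeℕ m inTime steps) (eq k) run

-- There are 2 (4k + 4) + 2 labels, and each of them gives one bit for every
-- vertex of X, one for the centre and one for its use anywhere.
codeBound : ℕ → ℕ
codeBound k = (k + 2) * (2 * (4 * k + 4) + 2)

-- The 3 separates k from n: `suc (E * suc n)` is at most `3 * E * n` for positive E and n.
tableFactor : ℕ → ℕ
tableFactor k = 3 * 2 ^ codeBound k

opaque
  unfolding mainₜ
  main-correct : ∀ {g s xs V T Λ} → ⟦ verticesₜ ⟧ (g ∷ []) ≡ V → ⟦ horizonₜ ⟧ (xs ∷ []) ≡ T →
    ⟦ labelsₜ ⟧ (T ∷ []) ≡ Λ →
    let best = ⟦ bestₜ ⟧ (proj₂ (⟦ tableₜ ⟧ (g ∷ V ∷ Λ ∷ xs ∷ s ∷ [])) ∷ []) in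
    ⟦ mainₜ ⟧ ((g , s , xs) ∷ []) ≡
    reverse (proj₂ (proj₂ (⟦ simulateₜ ⟧ (g ∷ V ∷ proj₂ best ∷ s ∷ suc T ∷ []))))
  main-correct refl refl refl = reverse-correct _

  main-safe : ∀ {M g s xs V T Λ} → ⟦ verticesₜ ⟧ (g ∷ []) ≡ V → ⟦ horizonₜ ⟧ (xs ∷ []) ≡ T →
    ⟦ labelsₜ ⟧ (T ∷ []) ≡ Λ →
    let table = ⟦ tableₜ ⟧ (g ∷ V ∷ Λ ∷ xs ∷ s ∷ [])
        best  = ⟦ bestₜ ⟧ (proj₂ table ∷ [])
        fire  = ⟦ simulateₜ ⟧ (g ∷ V ∷ proj₂ best ∷ s ∷ suc T ∷ []) in
    Safe M verticesₜ (g ∷ []) → Safe M horizonₜ (xs ∷ []) → Safe M labelsₜ (T ∷ []) →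
    Safe M tableₜ (g ∷ V ∷ Λ ∷ xs ∷ s ∷ []) → Safe M bestₜ (proj₂ table ∷ []) →
    Safe M simulateₜ (g ∷ V ∷ proj₂ best ∷ s ∷ suc T ∷ []) →
    Safe M reverseₜ (proj₂ (proj₂ fire) ∷ []) →
    Safe M mainₜ ((g , s , xs) ∷ [])
  main-safe refl refl refl s₁ s₂ s₃ s₄ s₅ s₆ s₇ =
    (_ , s₁) , (_ , s₂) , (_ , s₃) , (_ , s₄) , (_ , s₅) , (_ , s₆) , (_ , s₇)

-- Puts `codeBound k` below M, and with it the number of labels and the horizon, so that one M
-- bounds all lists.
n<2^n : ∀ m → m < 2 ^ m
n<2^n zero    = s≤s z≤n
n<2^n (suc m) = ≤-trans (+-mono-≤ (m^n>0 2 m) (n<2^n m)) (+-monoʳ-≤ (2 ^ m) (m≤m+n (2 ^ m) 0))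

length-toList-tabulate : ∀ {A : Set} {n} (f : Fin n → A) → length (Vec.toList (Vec.tabulate f)) ≡ n
length-toList-tabulate f = Vec.length-toList (Vec.tabulate f)

all-toList-tabulate : ∀ {A : Set} {n} {Q : A → Set} (f : Fin n → A) → (∀ i → Q (f i)) → All Q (Vec.toList (Vec.tabulate f))
all-toList-tabulate {n = zero}  f q = []
all-toList-tabulate {n = suc n} f q = q zero ∷ all-toList-tabulate (f ∘ suc) (q ∘ suc)

encodeList-tabulate : ∀ {A C : Set} {n} (enc : C → Tree) (h : A → C) (f : Fin n → A) →
  encodeList enc (Vec.toList (Vec.tabulate (h ∘ f))) ≡ encodeList (enc ∘ h) (Vec.toList (Vec.tabulate f))
encodeList-tabulate {n = zero}  enc h f = refl
encodeList-tabulate {n = suc n} enc h f = cong (cons _) (encodeList-tabulate enc h (f ∘ suc))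

encode-strategy : ∀ {n} (S : List (Fin n)) → encodeList encodeℕ (map toℕ S) ≡ encodeStrategy S
encode-strategy []      = refl
encode-strategy (v ∷ S) = cong (cons _) (encode-strategy S)

-- The program on a given instance

module Run {n} (G : Graph n) (s : Fin n) (X : Subset n) (stars : StarsOutside G X) where

  open Solve G s X stars

  k : ℕ
  k = ∣ X ∣

  M : ℕ
  M = 2 ^ codeBound k * suc n

  best : Val Scored
  best = ⟦ bestₜ ⟧ (proj₂ (tableᶠ path-free) ∷ [])

  open FromEntry (best-solution path-free)

  vertices≡ : ⟦ verticesₜ ⟧ (g ∷ []) ≡ V
  vertices≡ = trans (vertices-correct g) (cong downFrom (length-toList-tabulate _))

  output≡ : ⟦ mainₜ ⟧ ((g , toℕ s , xs) ∷ []) ≡ map toℕ strategy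
  output≡ = trans (main-correct vertices≡ (horizon-correct X) (labels-correct horizon))
    (trans (cong (λ st → reverse (proj₂ (proj₂ st))) (Simulate.simulate-correct g V e (toℕ s) (suc horizon))) defends)

  code≤M : codeBound k ≤ M
  code≤M = ≤-trans (<⇒≤ (n<2^n (codeBound k))) (m≤m*n (2 ^ codeBound k) (suc n))

  n≤M : n ≤ M
  n≤M = ≤-trans (n≤1+n n) (m≤n*m (suc n) (2 ^ codeBound k) {{m^n≢0 2 (codeBound k)}})

  labels≤M : 2 * horizon + 2 ≤ M
  labels≤M = ≤-trans (m≤n*m (2 * horizon + 2) (k + 2) {{nonZero+2 k}}) code≤M
    where
    nonZero+2 : ∀ m → NonZero (m + 2)
    nonZero+2 zero    = _
    nonZero+2 (suc m) = _

  horizon<M : suc horizon ≤ M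
  horizon<M = ≤-trans (≤-trans (≤-reflexive (+-comm 1 horizon))
    (+-mono-≤ (m≤m+n horizon (horizon + 0)) (s≤s z≤n))) labels≤M

  V≤ : Bnd (L N) M V
  V≤ = ≤-trans (≤-reflexive (length-downFrom n)) n≤M ,
       All.tabulate (λ x∈ → ≤-trans (<⇒≤ (∈-downFrom⁻ x∈)) n≤M)

  Λ≤ : Bnd (L Label) M Λ
  Λ≤ = ≤-trans (≤-reflexive (length-labelList horizon)) labels≤M ,
       labelList-times horizon (≤-trans (n≤1+n horizon) horizon<M)

  row≤ : ∀ (p : Subset n) → Bnd (L 𝔹) M (Vec.toList p)
  row≤ p = ≤-trans (≤-reflexive (Vec.length-toList p)) n≤M , All.universal (λ _ → tt) _

  g≤ : Bnd Matrix M g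
  g≤ = ≤-trans (≤-reflexive (length-toList-tabulate _)) n≤M , all-toList-tabulate _ (λ v → row≤ (neighbours G v))

  Xs≤k : length Xs ≤ k
  Xs≤k = ≤-trans (unique⊆⇒length≤ (Unique.filter⁺ InX? (Unique.downFrom⁺ n)) (All.tabulate member))
                 (≤-reflexive (length-elems X))
    where
    member : ∀ {x} → x ∈ Xs → x ∈ elems X
    member x∈ with ∈-filter⁻ InX? {xs = V} x∈
    ... | x∈V , inX with fromV x∈V
    ...   | vertex v = ∈-elems⁺ (inX⇒ inX)

  capacity≤M : capacity ≤ M
  capacity≤M = *-mono-≤ (^-monoʳ-≤ 2 code≤) (s≤s (≤-reflexive (length-downFrom n)))
    where
    open ≤-Reasoning
    rearrange : ∀ k m → suc k * m + m ≡ (k + 2) * m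
    rearrange = solve-∀
    code≤ : codeLength ≤ codeBound k
    code≤ = begin
      suc (length Xs) * length Λ + length Λ
        ≤⟨ +-monoˡ-≤ (length Λ) (*-monoˡ-≤ (length Λ) (s≤s Xs≤k)) ⟩
      suc k * length Λ + length Λ
        ≡⟨ rearrange k (length Λ) ⟩
      (k + 2) * length Λ
        ≡⟨ cong ((k + 2) *_) (length-labelList horizon) ⟩
      codeBound k ∎

  safe-run : Safe M mainₜ ((g , toℕ s , xs) ∷ [])
  safe-run = main-safe vertices≡ (horizon-correct X) (labels-correct horizon)
    (vertices-safe g (proj₁ g≤))
    (horizon-safe xs (proj₁ (row≤ X)))
    (labels-safe horizon (≤-trans (n≤1+n horizon) horizon<M))
    (table-safe path-free)
    (proj₁ (free-bounded bestₜ best-free (table≤ proc tbl , tt)))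
    (simulate-safe M g≤ V≤ e≤ (Unique.downFrom⁺ n) (suc horizon) horizon<M (toV s))
    (reverse-safe _ (≤-trans (≤-reflexive (trans (cong (λ st → length (proj₂ (proj₂ st)))
        (simulate-correct (toℕ s) (suc horizon)))
        (trans (sym (length-reverse (proj₂ (proj₂ (iterate (suc horizon) (0 , toℕ s ∷ [] , [])))))) (trans (cong length defends) (length-map toℕ strategy)))))
      (≤-trans (running≤horizon {⁅ s ⁆} {Subset.⊥} strategy (valid⇒running strategy strategy-valid))
               (≤-trans (n≤1+n horizon) horizon<M))))
    where
    open Bounds M capacity≤M V≤ Λ≤ g≤ (row≤ X)
    open Invariant (Progress.inv (table-progress path-free)) renaming (table to tbl)
    open Simulate g V e
    open Spread G using (valid⇒running)
    sol : Solution path-free (proj₁ (tableᶠ path-free)) best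
    sol = best-solution path-free
    e≤ : Bnd Entry M e
    e≤ = proj₂ (scored≤ (Solution.proc sol) (Solution.well-formed sol))

work-bound : Σ[ c ∈ ℕ ] Σ[ d ∈ ℕ ] (∀ M → 5 + work M mainₜ ≤ c * suc M ^ d)
work-bound = poly-+ (poly-const 5) (work-poly mainₜ)

^-distribʳ-* : ∀ d a b → (a * b) ^ d ≡ a ^ d * b ^ d
^-distribʳ-* zero    a b = refl
^-distribʳ-* (suc d) a b = trans (cong (a * b *_) (^-distribʳ-* d a b)) (swap a b (a ^ d) (b ^ d))
  where
  swap : ∀ a b x y → a * b * (x * y) ≡ a * x * (b * y)
  swap = solve-∀

fpt-bound : ∀ c d E n → 1 ≤ n → 1 ≤ E → c * suc (E * suc n) ^ d ≤ (c * (3 * E) ^ d) * n ^ d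
fpt-bound c d E n 1≤n 1≤E = begin
  c * suc (E * suc n) ^ d      ≤⟨ *-monoʳ-≤ c (^-monoˡ-≤ d base) ⟩
  c * (3 * E * n) ^ d          ≡⟨ cong (c *_) (^-distribʳ-* d (3 * E) n) ⟩
  c * ((3 * E) ^ d * n ^ d)    ≡⟨ *-assoc c _ _ ⟨
  (c * (3 * E) ^ d) * n ^ d    ∎
  where
  open ≤-Reasoning
  expand : ∀ E n → E * n + (E * n + E * n) ≡ 3 * E * n
  expand = solve-∀
  swap : ∀ E n → suc (E * suc n) ≡ 1 + (E * 1 + E * n)
  swap = solve-∀
  base : suc (E * suc n) ≤ 3 * E * n
  base = begin
    suc (E * suc n)             ≡⟨ swap E n ⟩
    1 * 1 + (E * 1 + E * n)     ≤⟨ +-mono-≤ (*-mono-≤ 1≤E 1≤n) (+-monoˡ-≤ (E * n) (*-monoʳ-≤ E 1≤n)) ⟩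
    E * n + (E * n + E * n)     ≡⟨ expand E n ⟩
    3 * E * n                   ∎

theorem2 : Σ[ f ∈ (ℕ → ℕ) ] Computable f × (Σ[ A ∈ Program ] Σ[ c ∈ ℕ ]
    (∀ (k n : ℕ) (G : Graph n) (s : Fin n) (X : Subset n) →
    Connected G → ∣ X ∣ ≡ k → StarsOutside G X →
    Σ[ S ∈ List (Fin n) ] Σ[ t ∈ ℕ ]
    (A on encodeInstance G s X outputs encodeStrategy S inTime t) ×
    Optimal G s S ×
    t ≤ f k * n ^ c))
theorem2 with work-bound
... | c , d , bound =
  (λ k → c * tableFactor k ^ d) ,
  computable (constᵃ c *ᵃ ((constᵃ 3 *ᵃ (constᵃ 2 ^ᵃ codeᵃ)) ^ᵃ constᵃ d)) ,
  program mainₜ , d , solve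
  where
  codeᵃ : ArithmeticTerm codeBound
  codeᵃ = (idᵃ +ᵃ constᵃ 2) *ᵃ ((constᵃ 2 *ᵃ ((constᵃ 4 *ᵃ idᵃ) +ᵃ constᵃ 4)) +ᵃ constᵃ 2)
  solve : ∀ (k n : ℕ) (G : Graph n) (s : Fin n) (X : Subset n) →
    Connected G → ∣ X ∣ ≡ k → StarsOutside G X →
    Σ[ S ∈ List (Fin n) ] Σ[ t ∈ ℕ ]
    (program mainₜ on encodeInstance G s X outputs encodeStrategy S inTime t) ×
    Optimal G s S ×
    t ≤ (c * tableFactor k ^ d) * n ^ d
  solve k n G s X _ refl stars = strategy , steps , correct , strategy-optimal ,
    ≤-trans (proj₂ (proj₂ run) M safe-run)
      -- The source s witnesses that n is positive.
      (≤-trans (bound M) (fpt-bound c d (2 ^ codeBound k) n (≤-trans (s≤s z≤n) (Fin.toℕ<n s)) (m^n>0 2 (codeBound k))))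
    where
    open Run G s X stars using (M; safe-run; output≡)
    open Solve G s X stars
    open FromEntry (best-solution path-free)
    run = program-correct mainₜ (g , toℕ s , xs)
    steps : ℕ
    steps = proj₁ run
    correct : program mainₜ on encodeInstance G s X outputs encodeStrategy strategy inTime steps
    correct = subst₂ (λ a b → program mainₜ on a outputs b inTime steps)
      (cong (λ a → cons a (cons (encodeVertex s) (encodeSubset X)))
        (encodeList-tabulate (encodeList encodeBool) Vec.toList (neighbours G)))
      (trans (cong (encodeList encodeℕ) output≡) (encode-strategy strategy))
      (proj₁ (proj₂ run))
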